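{- Let $\Gamma = SU_3(3)$ be the simple group of order $6048$ and $\Gamma.2 = \mathrm{Aut}(\Gamma) \cong G_2(2)$, of order $12096$. Consider quadruples $C=(C_1,C_2,C_3,C_4)$ of non-identity conjugacy classes in $G$, for $G=\Gamma.2$ or $G=\Gamma$. (1) There are no strictly rigid quadruples in $G=\Gamma.2$. (2) Up to reordering and up to conjugation by the outer involution of $\Gamma$, there are exactly five strictly rigid quadruples in $G=\Gamma$, namely $$(3A,3A,3A,4B),\quad (4A,4A,4A,4B),\quad (2A,2A,3A,4A),\quad (4A,4A,4A,2A),\quad (4A,4A,3A,3A),$$ and the corresponding degree $28$ covers of the projective line have genus $9$, $9$, $3$, $6$, $9$ respectively. (3) Moreover, for $G = \Gamma$ or $G=\Gamma.2$, there are no other rigid quadruples $C$ with $\overline{\mu}(C) < 4$.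
   Context: **Groups and classes.** $\Gamma=SU_3(3)\subset SL_3(\mathbb{F}_9)$ is the special unitary group of a nondegenerate Hermitian form on $\mathbb{F}_9^3$ (its centre is trivial). $\Gamma.2=\mathrm{Aut}(\Gamma)$ is generated by $\Gamma$ and the involution induced by the Frobenius automorphism of $\mathbb{F}_9/\mathbb{F}_3$ in an orthonormal basis (the "outer involution"). Both groups act faithfully and transitively on the $28$ isotropic points of $\mathbb{P}^2(\mathbb{F}_9)$, giving $\Gamma\subset\Gamma.2\subset A_{28}$. Conjugacy classes of $\Gamma$ (Atlas names) used here, with cardinality and cycle type in degree $28$: - $2A$: the involutions, size $63$, cycle type $2^{12}1^4$. - $3A$: the unitary transvections, size $56$, cycle type $3^9 1$. - $4A$ and $4B$: the two classes of size $63$ of elements of order $4$, cycle type $4^6 1^4$. They are inverse to each other and interchanged by the outer involution. With $i\in\mathbb{F}_9$, $i^2=-1$, they are the classes of $\mathrm{diag}(i,i,-1)$ and $\mathrm{diag}(-i,-i,-1)$ in an orthonormal basis. **Rigidity.** For a finite centreless group $G$ and a list $C=(C_1,\dots,C_z)$ of conjugacy classes of $G$, let $$\overline{\Sigma}(C)=\{(g_1,\dots,g_z)\in C_1\times\cdots\times C_z : g_1\cdots g_z=1\},$$ $$\Sigma(C)=\{(g_1,\dots,g_z)\in\overline{\Sigma}(C):\langle g_1,\dots,g_z\rangle=G\},$$ and put $\overline{\mu}(C)=|\overline{\Sigma}(C)|/|G|$ and $\mu(C)=|\Sigma(C)|/|G|$. The list $C$ is *rigid* if $\mu(C)=1$,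 and *strictly rigid* if moreover $\overline{\mu}(C)=1$. **Genus.** For $G\subseteq S_n$ transitive and $(g_1,\dots,g_z)\in\Sigma(C)$, the associated degree $n$ cover of the complex projective line with local monodromies $g_i$ has genus $g$ given by $\sum_{i=1}^z|\lambda_i| = (z-2)n+2-2g$, where $|\lambda_i|$ is the number of cycles (fixed points included) of $g_i$ on $n$ points. Here $n=28$. -}

module Defs where

open import Algebra.Bundles using (Group; CommutativeRing)
import Algebra.Definitions.RawMonoid as RawMonoidSum
open import Algebra.Morphism.Structures using (module GroupMorphisms)
open import Algebra.Structures using (IsCommutativeRing)
import Algebra.Properties.Group as GroupProperties
import Algebra.Properties.Semiring.Sum as SemiringSum
open import Data.Bool.Base using (if_then_else_)
open import Data.Fin.Base as Fin using (Fin; toℕ)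
open import Data.Fin.Patterns using (0F; 1F; 2F; 3F; 4F)
open import Data.Fin.Permutation using (Permutation′; _⟨$⟩ʳ_)
import Data.Fin.Properties as Fin
open import Data.Integer.Base as ℤ using (ℤ)
open import Data.Maybe.Base using (just; nothing)
open import Data.Nat.Base as ℕ using (ℕ; NonZero)
open import Data.Nat.DivMod using (_mod_)
open import Data.Product.Base using (Σ-syntax; ∃-syntax; ∃₂; _×_; _,_; proj₁; proj₂)
open import Data.Rational.Base as ℚ using (ℚ; 1ℚ; _/_)
open import Data.Sum.Base using (_⊎_)
open import Data.Vec.Functional as Vector using (Vector; _∷_; [])
import Data.Vec.Functional.Relation.Binary.Equality.Setoid as VectorEquality
open import Function.Base using (_∘_; id)
open import Function.Bundles using (Inverse)
open import Level using (0ℓ; _⊔_)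
open import Relation.Binary.Bundles using (Setoid)
import Relation.Binary.Construct.Closure.Equivalence as EqClosure
import Relation.Binary.Construct.On as On
open import Relation.Binary.PropositionalEquality as ≡
  using (_≡_; _≢_; refl; cong; cong₂; sym; trans)
open import Relation.Binary.Structures using (IsEquivalence)
import Relation.Binary.Reasoning.Setoid as SetoidReasoning
open import Relation.Nullary using (¬_)
open import Relation.Nullary.Decidable
  using (Dec; does; map′; from-yes; ¬?; _→-dec_; _×-dec_)
open import Relation.Unary using (Pred; _∈_; _≐_)
open import Tactic.RingSolver using (solve-∀)
open import Tactic.RingSolver.Core.AlmostCommutativeRing
  using (AlmostCommutativeRing; fromCommutativeRing)

_HasSize_ : ∀ {a ℓ} → Setoid a ℓ → ℕ → Set (a ⊔ ℓ)
S HasSize n = Inverse (≡.setoid (Fin n)) S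

-- A subset is counted up to the ambient equality: membership proofs are
-- irrelevant.
subset : ∀ {a ℓ p} (S : Setoid a ℓ) → Pred (Setoid.Carrier S) p → Setoid (a ⊔ p) ℓ
subset S P = On.setoid {B = Σ[ x ∈ Setoid.Carrier S ] P x} S proj₁

-- S and T are finite, T is non-empty and |S| / |T| = q.
SizeRatio : Setoid 0ℓ 0ℓ → Setoid 0ℓ 0ℓ → ℚ → Set
SizeRatio S T q =
  ∃[ m ] ∃[ n ] Σ[ n≢0 ∈ NonZero n ]
    S HasSize m × T HasSize n × q ≡ _/_ (ℤ.+ m) n {{n≢0}}

module _ (G : Group 0ℓ 0ℓ) where
  open Group G
  open RawMonoidSum rawMonoid using () renaming (sum to product)
  open VectorEquality setoid using (≋-setoid)

  data Generated {z} (g : Vector Carrier z) : Pred Carrier 0ℓ where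
    gen  : ∀ i → Generated g (g i)
    unit : Generated g ε
    mul  : ∀ {x y} → Generated g x → Generated g y → Generated g (x ∙ y)
    inv  : ∀ {x} → Generated g x → Generated g (x ⁻¹)
    resp : ∀ {x y} → x ≈ y → Generated g x → Generated g y

  Conjugate : Carrier → Carrier → Set
  Conjugate x y = ∃[ k ] y ≈ k ∙ x ∙ k ⁻¹

  IsConjugacyClass : Pred Carrier 0ℓ → Set
  IsConjugacyClass C = ∃[ x ] C ≐ Conjugate x

  NonIdentityClasses : ∀ {z} → Vector (Pred Carrier 0ℓ) z → Set
  NonIdentityClasses C = ∀ i → IsConjugacyClass (C i) × ¬ (ε ∈ C i)

  InΣ̄ : ∀ {z} → Vector (Pred Carrier 0ℓ) z → Pred (Vector Carrier z) 0ℓ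
  InΣ̄ C g = (∀ i → g i ∈ C i) × product g ≈ ε

  InΣ : ∀ {z} → Vector (Pred Carrier 0ℓ) z → Pred (Vector Carrier z) 0ℓ
  InΣ C g = InΣ̄ C g × (∀ x → x ∈ Generated g)

  -- Relations, so that finiteness need not be established beforehand.
  μ̄[_]≐_ μ[_]≐_ : ∀ {z} → Vector (Pred Carrier 0ℓ) z → ℚ → Set
  μ̄[_]≐_ {z} C q = SizeRatio (subset (≋-setoid z) (InΣ̄ C)) setoid q
  μ[_]≐_ {z} C q = SizeRatio (subset (≋-setoid z) (InΣ C)) setoid q

  Rigid : ∀ {z} → Vector (Pred Carrier 0ℓ) z → Set
  Rigid C = μ[ C ]≐ 1ℚ

  StrictlyRigid : ∀ {z} → Vector (Pred Carrier 0ℓ) z → Set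
  StrictlyRigid C = Rigid C × μ̄[ C ]≐ 1ℚ

  μ̄<4 : ∀ {z} → Vector (Pred Carrier 0ℓ) z → Set
  μ̄<4 C = ∃[ q ] μ̄[ C ]≐ q × q ℚ.< ℤ.+ 4 / 1

module _ {c ℓ} (G : Group c ℓ) where
  open Group G
  open GroupMorphisms rawGroup rawGroup
  open GroupProperties G using (inverseˡ-unique; identityˡ-unique)
  open SetoidReasoning setoid

  record Automorphism : Set (c ⊔ ℓ) where
    field
      ⟦_⟧                : Carrier → Carrier
      isGroupIsomorphism : IsGroupIsomorphism ⟦_⟧
    open IsGroupIsomorphism isGroupIsomorphism public

  open Automorphism

  mkAutomorphism : (f f⁻ : Carrier → Carrier) →
                   (∀ {x y} → x ≈ y → f x ≈ f y) →
                   (∀ x y → f (x ∙ y) ≈ f x ∙ f y) →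
                   (∀ {x y} → x ≈ y → f⁻ x ≈ f⁻ y) →
                   (∀ x → f (f⁻ x) ≈ x) → (∀ x → f⁻ (f x) ≈ x) →
                   Automorphism
  mkAutomorphism f f⁻ f-cong f-homo f⁻-cong ff⁻ f⁻f = record
    { ⟦_⟧ = f
    ; isGroupIsomorphism = record
      { isGroupMonomorphism = record
        { isGroupHomomorphism = record
          { isMonoidHomomorphism = record
            { isMagmaHomomorphism = record
              { isRelHomomorphism = record { cong = f-cong }
              ; homo = f-homo
              }
            ; ε-homo = f-ε
            }
          ; ⁻¹-homo = λ x → inverseˡ-unique (f (x ⁻¹)) (f x) (begin
              f (x ⁻¹) ∙ f x  ≈⟨ f-homo (x ⁻¹) x ⟨
              f (x ⁻¹ ∙ x)    ≈⟨ f-cong (inverseˡ x) ⟩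
              f ε             ≈⟨ f-ε ⟩
              ε               ∎)
          }
        ; injective = λ {x} {y} fx≈fy → begin
            x         ≈⟨ f⁻f x ⟨
            f⁻ (f x)  ≈⟨ f⁻-cong fx≈fy ⟩
            f⁻ (f y)  ≈⟨ f⁻f y ⟩
            y         ∎
        }
      ; surjective = λ y → f⁻ y , λ {z} z≈ → begin
            f z       ≈⟨ f-cong z≈ ⟩
            f (f⁻ y)  ≈⟨ ff⁻ y ⟩
            y         ∎
      }
    }
    where
    f-ε : f ε ≈ ε
    f-ε = identityˡ-unique (f ε) (f ε) (begin
      f ε ∙ f ε  ≈⟨ f-homo ε ε ⟨
      f (ε ∙ ε)  ≈⟨ f-cong (identityˡ ε) ⟩
      f ε        ∎)

  pre : Automorphism → Carrier → Carrier
  pre f = proj₁ ∘ surjective f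

  pre-inverseʳ : ∀ f x → ⟦ f ⟧ (pre f x) ≈ x
  pre-inverseʳ f x = proj₂ (surjective f x) (Group.refl G)

  pre-inverseˡ : ∀ f x → pre f (⟦ f ⟧ x) ≈ x
  pre-inverseˡ f x = injective f (pre-inverseʳ f (⟦ f ⟧ x))

  pre-cong : ∀ f {x y} → x ≈ y → pre f x ≈ pre f y
  pre-cong f {x} {y} x≈y = injective f (begin
    ⟦ f ⟧ (pre f x)  ≈⟨ pre-inverseʳ f x ⟩
    x                ≈⟨ x≈y ⟩
    y                ≈⟨ pre-inverseʳ f y ⟨
    ⟦ f ⟧ (pre f y)  ∎)

  compose : Automorphism → Automorphism → Automorphism
  compose f g = mkAutomorphism (⟦ f ⟧ ∘ ⟦ g ⟧) (pre g ∘ pre f)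
    (⟦⟧-cong f ∘ ⟦⟧-cong g)
    (λ x y → Group.trans G (⟦⟧-cong f (∙-homo g x y)) (∙-homo f (⟦ g ⟧ x) (⟦ g ⟧ y)))
    (pre-cong g ∘ pre-cong f)
    (λ x → Group.trans G (⟦⟧-cong f (pre-inverseʳ g (pre f x))) (pre-inverseʳ f x))
    (λ x → Group.trans G (pre-cong g (pre-inverseˡ f (⟦ g ⟧ x))) (pre-inverseˡ g x))

  identity′ : Automorphism
  identity′ = mkAutomorphism id id id (λ _ _ → Group.refl G) id
    (λ _ → Group.refl G) (λ _ → Group.refl G)

  inverse′ : Automorphism → Automorphism
  inverse′ f = mkAutomorphism (pre f) ⟦ f ⟧ (pre-cong f)
    (λ x y → injective f (begin
      ⟦ f ⟧ (pre f (x ∙ y))              ≈⟨ pre-inverseʳ f (x ∙ y) ⟩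
      x ∙ y                              ≈⟨ ∙-cong (pre-inverseʳ f x) (pre-inverseʳ f y) ⟨
      ⟦ f ⟧ (pre f x) ∙ ⟦ f ⟧ (pre f y)  ≈⟨ ∙-homo f (pre f x) (pre f y) ⟨
      ⟦ f ⟧ (pre f x ∙ pre f y)          ∎))
    (⟦⟧-cong f) (pre-inverseˡ f) (pre-inverseʳ f)

  Aut : Group (c ⊔ ℓ) (c ⊔ ℓ)
  Aut = record
    { Carrier = Automorphism
    ; _≈_ = λ f g → ∀ x → ⟦ f ⟧ x ≈ ⟦ g ⟧ x
    ; _∙_ = compose
    ; ε   = identity′
    ; _⁻¹ = inverse′
    ; isGroup = record
      { isMonoid = record
        { isSemigroup = record
          { isMagma = record
            { isEquivalence = record
              { refl  = λ _ → Group.refl G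
              ; sym   = λ p x → Group.sym G (p x)
              ; trans = λ p q x → Group.trans G (p x) (q x)
              }
            ; ∙-cong = λ {f} {f′} {g} {g′} p q x →
                Group.trans G (⟦⟧-cong f (q x)) (p (⟦ g′ ⟧ x))
            }
          ; assoc = λ _ _ _ _ → Group.refl G
          }
        ; identity = (λ _ _ → Group.refl G) , (λ _ _ → Group.refl G)
        }
      ; inverse = pre-inverseˡ , pre-inverseʳ
      ; ⁻¹-cong = λ {f} {g} p x → injective f (begin
          ⟦ f ⟧ (pre f x)  ≈⟨ pre-inverseʳ f x ⟩
          x                ≈⟨ pre-inverseʳ g x ⟨
          ⟦ g ⟧ (pre g x)  ≈⟨ p (pre g x) ⟨
          ⟦ f ⟧ (pre g x)  ∎)
      }
    }

F₃ : Set
F₃ = Fin 3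

infixl 6 _+₃_
infixl 7 _*₃_
infix  8 -₃_

_+₃_ _*₃_ : F₃ → F₃ → F₃
x +₃ y = (toℕ x ℕ.+ toℕ y) mod 3
x *₃ y = (toℕ x ℕ.* toℕ y) mod 3

-₃_ : F₃ → F₃
-₃ x = (3 ℕ.∸ toℕ x) mod 3

F₃-isCommutativeRing : IsCommutativeRing _≡_ _+₃_ _*₃_ -₃_ 0F 1F
F₃-isCommutativeRing = record
  { isRing = record
    { +-isAbelianGroup = record
      { isGroup = record
        { isMonoid = record
          { isSemigroup = record
            { isMagma = record
              { isEquivalence = ≡.isEquivalence
              ; ∙-cong = cong₂ _+₃_
              }
            ; assoc = from-yes (Fin.all? λ x → Fin.all? λ y → Fin.all? λ z →
                (x +₃ y) +₃ z Fin.≟ x +₃ (y +₃ z))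
            }
          ; identity =
              from-yes (Fin.all? λ x → 0F +₃ x Fin.≟ x) ,
              from-yes (Fin.all? λ x → x +₃ 0F Fin.≟ x)
          }
        ; inverse =
            from-yes (Fin.all? λ x → -₃ x +₃ x Fin.≟ 0F) ,
            from-yes (Fin.all? λ x → x +₃ -₃ x Fin.≟ 0F)
        ; ⁻¹-cong = cong -₃_
        }
      ; comm = from-yes (Fin.all? λ x → Fin.all? λ y → x +₃ y Fin.≟ y +₃ x)
      }
    ; *-cong = cong₂ _*₃_
    ; *-assoc = from-yes (Fin.all? λ x → Fin.all? λ y → Fin.all? λ z →
        (x *₃ y) *₃ z Fin.≟ x *₃ (y *₃ z))
    ; *-identity =
        from-yes (Fin.all? λ x → 1F *₃ x Fin.≟ x) ,
        from-yes (Fin.all? λ x → x *₃ 1F Fin.≟ x)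
    ; distrib =
        from-yes (Fin.all? λ x → Fin.all? λ y → Fin.all? λ z →
          x *₃ (y +₃ z) Fin.≟ x *₃ y +₃ x *₃ z) ,
        from-yes (Fin.all? λ x → Fin.all? λ y → Fin.all? λ z →
          (y +₃ z) *₃ x Fin.≟ y *₃ x +₃ z *₃ x)
    }
  ; *-comm = from-yes (Fin.all? λ x → Fin.all? λ y → x *₃ y Fin.≟ y *₃ x)
  }

F₃-ring : AlmostCommutativeRing 0ℓ 0ℓ
F₃-ring = fromCommutativeRing
  (record { isCommutativeRing = F₃-isCommutativeRing }) λ where
    0F → just refl
    _  → nothing

infix 5 _+i_

-- a +i b stands for a + b i, with i² = -1.
record F₉ : Set where
  no-eta-equality
  pattern
  constructor _+i_
  field
    re im : F₃

infixl 6 _+_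
infixl 7 _*_
infix  8 -_

_+_ _*_ : F₉ → F₉ → F₉
(a +i b) + (c +i d) = (a +₃ c) +i (b +₃ d)
(a +i b) * (c +i d) = (a *₃ c +₃ -₃ (b *₃ d)) +i (a *₃ d +₃ b *₃ c)

-_ : F₉ → F₉
- (a +i b) = (-₃ a) +i (-₃ b)

0# 1# 𝕚 : F₉
0# = 0F +i 0F
1# = 1F +i 0F
𝕚  = 0F +i 1F

open IsCommutativeRing F₃-isCommutativeRing using ()
  renaming (+-assoc to +₃-assoc; +-comm to +₃-comm;
            +-identityˡ to +₃-identityˡ; +-identityʳ to +₃-identityʳ;
            -‿inverseˡ to -₃-inverseˡ; -‿inverseʳ to -₃-inverseʳ)

*-assoc-re : ∀ a b c d e f →
  (a *₃ c +₃ -₃ (b *₃ d)) *₃ e +₃ -₃ ((a *₃ d +₃ b *₃ c) *₃ f) ≡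
  a *₃ (c *₃ e +₃ -₃ (d *₃ f)) +₃ -₃ (b *₃ (c *₃ f +₃ d *₃ e))
*-assoc-re = solve-∀ F₃-ring

*-assoc-im : ∀ a b c d e f →
  (a *₃ c +₃ -₃ (b *₃ d)) *₃ f +₃ (a *₃ d +₃ b *₃ c) *₃ e ≡
  a *₃ (c *₃ f +₃ d *₃ e) +₃ b *₃ (c *₃ e +₃ -₃ (d *₃ f))
*-assoc-im = solve-∀ F₃-ring

*-comm-re : ∀ a b c d → a *₃ c +₃ -₃ (b *₃ d) ≡ c *₃ a +₃ -₃ (d *₃ b)
*-comm-re = solve-∀ F₃-ring

*-comm-im : ∀ a b c d → a *₃ d +₃ b *₃ c ≡ c *₃ b +₃ d *₃ a
*-comm-im = solve-∀ F₃-ring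

distribʳ-re : ∀ a b c d e f →
  (c +₃ e) *₃ a +₃ -₃ ((d +₃ f) *₃ b) ≡
  (c *₃ a +₃ -₃ (d *₃ b)) +₃ (e *₃ a +₃ -₃ (f *₃ b))
distribʳ-re = solve-∀ F₃-ring

distribʳ-im : ∀ a b c d e f →
  (c +₃ e) *₃ b +₃ (d +₃ f) *₃ a ≡
  (c *₃ b +₃ d *₃ a) +₃ (e *₃ b +₃ f *₃ a)
distribʳ-im = solve-∀ F₃-ring

*-comm : ∀ x y → x * y ≡ y * x
*-comm (a +i b) (c +i d) = cong₂ _+i_ (*-comm-re a b c d) (*-comm-im a b c d)

*-identityˡ-re : ∀ a b → 1F *₃ a +₃ -₃ (0F *₃ b) ≡ a
*-identityˡ-re = from-yes (Fin.all? λ a → Fin.all? λ b →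
  1F *₃ a +₃ -₃ (0F *₃ b) Fin.≟ a)

*-identityˡ-im : ∀ a b → 1F *₃ b +₃ 0F *₃ a ≡ b
*-identityˡ-im = from-yes (Fin.all? λ a → Fin.all? λ b →
  1F *₃ b +₃ 0F *₃ a Fin.≟ b)

*-identityˡ : ∀ x → 1# * x ≡ x
*-identityˡ (a +i b) = cong₂ _+i_ (*-identityˡ-re a b) (*-identityˡ-im a b)

distribʳ : ∀ x y z → (y + z) * x ≡ y * x + z * x
distribʳ (a +i b) (c +i d) (e +i f) =
  cong₂ _+i_ (distribʳ-re a b c d e f) (distribʳ-im a b c d e f)

F₉-isCommutativeRing : IsCommutativeRing _≡_ _+_ _*_ -_ 0# 1#
F₉-isCommutativeRing = record
  { isRing = record
    { +-isAbelianGroup = record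
      { isGroup = record
        { isMonoid = record
          { isSemigroup = record
            { isMagma = record
              { isEquivalence = ≡.isEquivalence
              ; ∙-cong = cong₂ _+_
              }
            ; assoc = λ { (a +i b) (c +i d) (e +i f) →
                cong₂ _+i_ (+₃-assoc a c e) (+₃-assoc b d f) }
            }
          ; identity =
              (λ { (a +i b) → cong₂ _+i_ (+₃-identityˡ a) (+₃-identityˡ b) }) ,
              (λ { (a +i b) → cong₂ _+i_ (+₃-identityʳ a) (+₃-identityʳ b) })
          }
        ; inverse =
            (λ { (a +i b) → cong₂ _+i_ (-₃-inverseˡ a) (-₃-inverseˡ b) }) ,
            (λ { (a +i b) → cong₂ _+i_ (-₃-inverseʳ a) (-₃-inverseʳ b) })
        ; ⁻¹-cong = cong -_
        }
      ; comm = λ { (a +i b) (c +i d) → cong₂ _+i_ (+₃-comm a c) (+₃-comm b d) }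
      }
    ; *-cong = cong₂ _*_
    ; *-assoc = λ { (a +i b) (c +i d) (e +i f) →
        cong₂ _+i_ (*-assoc-re a b c d e f) (*-assoc-im a b c d e f) }
    ; *-identity = *-identityˡ , λ x → trans (*-comm x 1#) (*-identityˡ x)
    ; distrib =
        (λ x y z → trans (*-comm x (y + z)) (trans (distribʳ x y z)
          (cong₂ _+_ (*-comm y x) (*-comm z x)))) ,
        distribʳ
    }
  ; *-comm = *-comm
  }

F₉-commutativeRing : CommutativeRing 0ℓ 0ℓ
F₉-commutativeRing = record { isCommutativeRing = F₉-isCommutativeRing }

F₉-ring : AlmostCommutativeRing 0ℓ 0ℓ
F₉-ring = fromCommutativeRing F₉-commutativeRing λ where
  (0F +i 0F) → just refl
  _          → nothing

_≟₉_ : (x y : F₉) → Dec (x ≡ y)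
(a +i b) ≟₉ (c +i d) =
  map′ (λ (p , q) → cong₂ _+i_ p q) (λ p → cong F₉.re p , cong F₉.im p)
    (a Fin.≟ c ×-dec b Fin.≟ d)

all₉? : {P : Pred F₉ 0ℓ} → (∀ x → Dec (P x)) → Dec (∀ x → P x)
all₉? P? = map′ (λ { p (a +i b) → p a b }) (λ p a b → p (a +i b))
  (Fin.all? λ a → Fin.all? λ b → P? (a +i b))

-- Frobenius, i.e. the conjugation a + b i ↦ a - b i.
conj : F₉ → F₉
conj x = x * x * x

conj-+ : ∀ x y → conj (x + y) ≡ conj x + conj y
conj-+ = from-yes (all₉? λ x → all₉? λ y → conj (x + y) ≟₉ (conj x + conj y))

conj-* : ∀ x y → conj (x * y) ≡ conj x * conj y
conj-* = from-yes (all₉? λ x → all₉? λ y → conj (x * y) ≟₉ (conj x * conj y))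

conj-- : ∀ x → conj (- x) ≡ - conj x
conj-- = from-yes (all₉? λ x → conj (- x) ≟₉ (- conj x))

conj-involutive : ∀ x → conj (conj x) ≡ x
conj-involutive = from-yes (all₉? λ x → conj (conj x) ≟₉ x)

recip : F₉ → F₉
recip x = x * x * x * x * x * x * x

recip-inverseˡ : ∀ x → x ≢ 0# → recip x * x ≡ 1#
recip-inverseˡ = from-yes (all₉? λ x → ¬? (x ≟₉ 0#) →-dec (recip x * x) ≟₉ 1#)

open CommutativeRing F₉-commutativeRing using (semiring; *-assoc; zeroʳ)
open SemiringSum semiring using (sum)

Vec₃ : Set
Vec₃ = Vector F₉ 3

Matrix : Set
Matrix = Fin 3 → Vec₃

infix 4 _≈ᴹ_
infixl 7 _*ᴹ_
infixr 8 _*ᵛ_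

_≈ᴹ_ : Matrix → Matrix → Set
A ≈ᴹ B = ∀ i j → A i j ≡ B i j

_*ᴹ_ : Matrix → Matrix → Matrix
(A *ᴹ B) i j = sum λ k → A i k * B k j

_*ᵛ_ : Matrix → Vec₃ → Vec₃
(A *ᵛ v) i = sum λ k → A i k * v k

diag : Vec₃ → Matrix
diag d i j = if does (i Fin.≟ j) then d i else 0#

1ᴹ : Matrix
1ᴹ = diag λ _ → 1#

det : Matrix → F₉
det A = A 0F 0F * (A 1F 1F * A 2F 2F + - (A 1F 2F * A 2F 1F))
      + A 0F 1F * (A 1F 2F * A 2F 0F + - (A 1F 0F * A 2F 2F))
      + A 0F 2F * (A 1F 0F * A 2F 1F + - (A 1F 1F * A 2F 0F))

adj : Matrix → Matrix
adj A 0F 0F = A 1F 1F * A 2F 2F + - (A 1F 2F * A 2F 1F)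
adj A 0F 1F = A 2F 1F * A 0F 2F + - (A 2F 2F * A 0F 1F)
adj A 0F 2F = A 0F 1F * A 1F 2F + - (A 0F 2F * A 1F 1F)
adj A 1F 0F = A 1F 2F * A 2F 0F + - (A 1F 0F * A 2F 2F)
adj A 1F 1F = A 2F 2F * A 0F 0F + - (A 2F 0F * A 0F 2F)
adj A 1F 2F = A 0F 2F * A 1F 0F + - (A 0F 0F * A 1F 2F)
adj A 2F 0F = A 1F 0F * A 2F 1F + - (A 1F 1F * A 2F 0F)
adj A 2F 1F = A 2F 0F * A 0F 1F + - (A 2F 1F * A 0F 0F)
adj A 2F 2F = A 0F 0F * A 1F 1F + - (A 0F 1F * A 1F 0F)

sum₃-cong : {u v : Vec₃} → (∀ i → u i ≡ v i) → sum u ≡ sum v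
sum₃-cong p = cong₂ _+_ (p 0F) (cong₂ _+_ (p 1F) (cong (_+ 0#) (p 2F)))

det-cong : ∀ {A B} → A ≈ᴹ B → det A ≡ det B
det-cong p = cong₂ _+_ (cong₂ _+_
  (term (p 0F 0F) (p 1F 1F) (p 2F 2F) (p 1F 2F) (p 2F 1F))
  (term (p 0F 1F) (p 1F 2F) (p 2F 0F) (p 1F 0F) (p 2F 2F)))
  (term (p 0F 2F) (p 1F 0F) (p 2F 1F) (p 1F 1F) (p 2F 0F))
  where
  term : ∀ {a b c d e a′ b′ c′ d′ e′} →
    a ≡ a′ → b ≡ b′ → c ≡ c′ → d ≡ d′ → e ≡ e′ →
    a * (b * c + - (d * e)) ≡ a′ * (b′ * c′ + - (d′ * e′))
  term refl refl refl refl refl = refl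

*ᵛ-congˡ : ∀ {A B} → A ≈ᴹ B → ∀ v i → (A *ᵛ v) i ≡ (B *ᵛ v) i
*ᵛ-congˡ p v i = sum₃-cong λ k → cong (_* v k) (p i k)

*ᵛ-congʳ : ∀ A {u v} → (∀ i → u i ≡ v i) → ∀ i → (A *ᵛ u) i ≡ (A *ᵛ v) i
*ᵛ-congʳ A p i = sum₃-cong λ k → cong (A i k *_) (p k)

*ᵛ-*ᴹ : ∀ A B v i → ((A *ᴹ B) *ᵛ v) i ≡ (A *ᵛ (B *ᵛ v)) i
*ᵛ-*ᴹ A B v i = lemma (A i 0F) (A i 1F) (A i 2F)
  (B 0F 0F) (B 0F 1F) (B 0F 2F) (B 1F 0F) (B 1F 1F) (B 1F 2F)
  (B 2F 0F) (B 2F 1F) (B 2F 2F) (v 0F) (v 1F) (v 2F)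
  where
  lemma : ∀ p q r a b c d e f g h k x y z →
    (p * a + (q * d + (r * g + 0#))) * x +
      ((p * b + (q * e + (r * h + 0#))) * y +
      ((p * c + (q * f + (r * k + 0#))) * z + 0#)) ≡
    p * (a * x + (b * y + (c * z + 0#))) +
      (q * (d * x + (e * y + (f * z + 0#))) +
      (r * (g * x + (h * y + (k * z + 0#))) + 0#))
  lemma = solve-∀ F₉-ring

*ᴹ-assoc : ∀ A B C → (A *ᴹ B) *ᴹ C ≈ᴹ A *ᴹ (B *ᴹ C)
*ᴹ-assoc A B C i j = *ᵛ-*ᴹ A B (λ k → C k j) i

*ᴹ-cong : ∀ {A A′ B B′} → A ≈ᴹ A′ → B ≈ᴹ B′ → A *ᴹ B ≈ᴹ A′ *ᴹ B′
*ᴹ-cong p q i j = sum₃-cong λ k → cong₂ _*_ (p i k) (q k j)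

diag-*ᵛ : ∀ d v i → (diag d *ᵛ v) i ≡ d i * v i
diag-*ᵛ d v = λ where
    0F → lemma₀ (d 0F) (v 0F) (v 1F) (v 2F)
    1F → lemma₁ (d 1F) (v 0F) (v 1F) (v 2F)
    2F → lemma₂ (d 2F) (v 0F) (v 1F) (v 2F)
  where
  lemma₀ : ∀ a x y z → a * x + (0# * y + (0# * z + 0#)) ≡ a * x
  lemma₀ = solve-∀ F₉-ring
  lemma₁ : ∀ a x y z → 0# * x + (a * y + (0# * z + 0#)) ≡ a * y
  lemma₁ = solve-∀ F₉-ring
  lemma₂ : ∀ a x y z → 0# * x + (0# * y + (a * z + 0#)) ≡ a * z
  lemma₂ = solve-∀ F₉-ring

1ᴹ-*ᵛ : ∀ v i → (1ᴹ *ᵛ v) i ≡ v i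
1ᴹ-*ᵛ v i = trans (diag-*ᵛ (λ _ → 1#) v i) (*-identityˡ (v i))

*ᴹ-identityˡ : ∀ A → 1ᴹ *ᴹ A ≈ᴹ A
*ᴹ-identityˡ A i j = 1ᴹ-*ᵛ (λ k → A k j) i

*ᴹ-identityʳ : ∀ A → A *ᴹ 1ᴹ ≈ᴹ A
*ᴹ-identityʳ A i = λ where
    0F → lemma₀ (A i 0F) (A i 1F) (A i 2F)
    1F → lemma₁ (A i 0F) (A i 1F) (A i 2F)
    2F → lemma₂ (A i 0F) (A i 1F) (A i 2F)
  where
  lemma₀ : ∀ x y z → x * 1# + (y * 0# + (z * 0# + 0#)) ≡ x
  lemma₀ = solve-∀ F₉-ring
  lemma₁ : ∀ x y z → x * 0# + (y * 1# + (z * 0# + 0#)) ≡ y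
  lemma₁ = solve-∀ F₉-ring
  lemma₂ : ∀ x y z → x * 0# + (y * 0# + (z * 1# + 0#)) ≡ z
  lemma₂ = solve-∀ F₉-ring

-- Row expansion of det (A B): the cofactors of the first row of A B are
-- combinations of the cofactors of B.
det-*ᴹ : ∀ A B → det (A *ᴹ B) ≡ det A * det B
det-*ᴹ A B = trans
  (cong₂ _+_ (cong₂ _+_
    (cong ((A *ᴹ B) 0F 0F *_) (minor 1F 2F))
    (cong ((A *ᴹ B) 0F 1F *_) (minor 2F 0F)))
    (cong ((A *ᴹ B) 0F 2F *_) (minor 0F 1F)))
  (expand (A 0F 0F) (A 0F 1F) (A 0F 2F) (adj A 0F 0F) (adj A 1F 0F) (adj A 2F 0F)
    (B 0F 0F) (B 0F 1F) (B 0F 2F) (B 1F 0F) (B 1F 1F) (B 1F 2F)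
    (B 2F 0F) (B 2F 1F) (B 2F 2F))
  where
  minor-poly : ∀ d e f g h k x y z x′ y′ z′ →
    (d * x + (e * y + (f * z + 0#))) * (g * x′ + (h * y′ + (k * z′ + 0#))) +
      - ((d * x′ + (e * y′ + (f * z′ + 0#))) * (g * x + (h * y + (k * z + 0#)))) ≡
    (e * k + - (f * h)) * (y * z′ + - (y′ * z)) +
      (f * g + - (d * k)) * (z * x′ + - (z′ * x)) +
      (d * h + - (e * g)) * (x * y′ + - (x′ * y))
  minor-poly = solve-∀ F₉-ring

  minor : ∀ j l →
    (A *ᴹ B) 1F j * (A *ᴹ B) 2F l + - ((A *ᴹ B) 1F l * (A *ᴹ B) 2F j) ≡
    adj A 0F 0F * (B 1F j * B 2F l + - (B 1F l * B 2F j)) +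
      adj A 1F 0F * (B 2F j * B 0F l + - (B 2F l * B 0F j)) +
      adj A 2F 0F * (B 0F j * B 1F l + - (B 0F l * B 1F j))
  minor j l = minor-poly (A 1F 0F) (A 1F 1F) (A 1F 2F) (A 2F 0F) (A 2F 1F) (A 2F 2F)
    (B 0F j) (B 1F j) (B 2F j) (B 0F l) (B 1F l) (B 2F l)

  expand : ∀ a b c P Q R x y z x′ y′ z′ x″ y″ z″ →
    (a * x + (b * x′ + (c * x″ + 0#))) *
      (P * (y′ * z″ + - (z′ * y″)) + Q * (y″ * z + - (z″ * y)) + R * (y * z′ + - (z * y′))) +
    (a * y + (b * y′ + (c * y″ + 0#))) *
      (P * (z′ * x″ + - (x′ * z″)) + Q * (z″ * x + - (x″ * z)) + R * (z * x′ + - (x * z′))) +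
    (a * z + (b * z′ + (c * z″ + 0#))) *
      (P * (x′ * y″ + - (y′ * x″)) + Q * (x″ * y + - (y″ * x)) + R * (x * y′ + - (y * x′))) ≡
    (a * P + b * Q + c * R) *
      (x * (y′ * z″ + - (z′ * y″)) + y * (z′ * x″ + - (x′ * z″)) + z * (x′ * y″ + - (y′ * x″)))
  expand = solve-∀ F₉-ring

adj-inverseʳ : ∀ A → det A ≡ 1# → A *ᴹ adj A ≈ᴹ 1ᴹ
adj-inverseʳ A detA i j =
  trans (entry i j) (trans (cong (λ x → diag (λ _ → x) i j) detA) refl)
  where
  d₀ : ∀ a b c d e f g h k →
    a * (e * k + - (f * h)) + (b * (f * g + - (d * k)) + (c * (d * h + - (e * g)) + 0#)) ≡
    a * (e * k + - (f * h)) + b * (f * g + - (d * k)) + c * (d * h + - (e * g))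
  d₀ = solve-∀ F₉-ring
  d₁ : ∀ a b c d e f g h k →
    d * (h * c + - (k * b)) + (e * (k * a + - (g * c)) + (f * (g * b + - (h * a)) + 0#)) ≡
    a * (e * k + - (f * h)) + b * (f * g + - (d * k)) + c * (d * h + - (e * g))
  d₁ = solve-∀ F₉-ring
  d₂ : ∀ a b c d e f g h k →
    g * (b * f + - (c * e)) + (h * (c * d + - (a * f)) + (k * (a * e + - (b * d)) + 0#)) ≡
    a * (e * k + - (f * h)) + b * (f * g + - (d * k)) + c * (d * h + - (e * g))
  d₂ = solve-∀ F₉-ring
  -- A repeated row.
  n₁ : ∀ a b c d e f →
    a * (b * f + - (c * e)) + (b * (c * d + - (a * f)) + (c * (a * e + - (b * d)) + 0#)) ≡ 0#
  n₁ = solve-∀ F₉-ring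
  n₂ : ∀ a b c d e f →
    a * (e * c + - (f * b)) + (b * (f * a + - (d * c)) + (c * (d * b + - (e * a)) + 0#)) ≡ 0#
  n₂ = solve-∀ F₉-ring

  entry : ∀ i j → (A *ᴹ adj A) i j ≡ diag (λ _ → det A) i j
  entry 0F 0F = d₀ (A 0F 0F) (A 0F 1F) (A 0F 2F) (A 1F 0F) (A 1F 1F) (A 1F 2F) (A 2F 0F) (A 2F 1F) (A 2F 2F)
  entry 1F 1F = d₁ (A 0F 0F) (A 0F 1F) (A 0F 2F) (A 1F 0F) (A 1F 1F) (A 1F 2F) (A 2F 0F) (A 2F 1F) (A 2F 2F)
  entry 2F 2F = d₂ (A 0F 0F) (A 0F 1F) (A 0F 2F) (A 1F 0F) (A 1F 1F) (A 1F 2F) (A 2F 0F) (A 2F 1F) (A 2F 2F)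
  entry 0F 1F = n₂ (A 0F 0F) (A 0F 1F) (A 0F 2F) (A 2F 0F) (A 2F 1F) (A 2F 2F)
  entry 0F 2F = n₁ (A 0F 0F) (A 0F 1F) (A 0F 2F) (A 1F 0F) (A 1F 1F) (A 1F 2F)
  entry 1F 0F = n₁ (A 1F 0F) (A 1F 1F) (A 1F 2F) (A 2F 0F) (A 2F 1F) (A 2F 2F)
  entry 1F 2F = n₂ (A 1F 0F) (A 1F 1F) (A 1F 2F) (A 0F 0F) (A 0F 1F) (A 0F 2F)
  entry 2F 0F = n₂ (A 2F 0F) (A 2F 1F) (A 2F 2F) (A 1F 0F) (A 1F 1F) (A 1F 2F)
  entry 2F 1F = n₁ (A 2F 0F) (A 2F 1F) (A 2F 2F) (A 0F 0F) (A 0F 1F) (A 0F 2F)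

-- The Hermitian form for which the standard basis is orthonormal.
⟪_,_⟫ : Vec₃ → Vec₃ → F₉
⟪ x , y ⟫ = sum λ i → x i * conj (y i)

⟪⟫-cong : ∀ {x x′ y y′} → (∀ i → x i ≡ x′ i) → (∀ i → y i ≡ y′ i) → ⟪ x , y ⟫ ≡ ⟪ x′ , y′ ⟫
⟪⟫-cong p q = sum₃-cong λ i → cong₂ _*_ (p i) (cong conj (q i))

record SU : Set where
  field
    mat     : Matrix
    unitary : ∀ x y → ⟪ mat *ᵛ x , mat *ᵛ y ⟫ ≡ ⟪ x , y ⟫
    det≡1   : det mat ≡ 1#

open SU

mulˢ : SU → SU → SU
mulˢ A B = record
  { mat = mat A *ᴹ mat B
  ; unitary = λ x y → trans
      (⟪⟫-cong (*ᵛ-*ᴹ (mat A) (mat B) x) (*ᵛ-*ᴹ (mat A) (mat B) y))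
      (trans (unitary A (mat B *ᵛ x) (mat B *ᵛ y)) (unitary B x y))
  ; det≡1 = trans (det-*ᴹ (mat A) (mat B)) (cong₂ _*_ (det≡1 A) (det≡1 B))
  }

oneˢ : SU
oneˢ = record
  { mat = 1ᴹ
  ; unitary = λ x y → ⟪⟫-cong (1ᴹ-*ᵛ x) (1ᴹ-*ᵛ y)
  ; det≡1 = refl
  }

invˢ : SU → SU
invˢ A = record
  { mat = adj (mat A)
  ; unitary = λ x y → trans (sym (unitary A (adj (mat A) *ᵛ x) (adj (mat A) *ᵛ y)))
      (⟪⟫-cong (cancel x) (cancel y))
  ; det≡1 = begin
      det (adj (mat A))                ≡⟨ *-identityˡ _ ⟨
      1# * det (adj (mat A))           ≡⟨ cong (_* det (adj (mat A))) (det≡1 A) ⟨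
      det (mat A) * det (adj (mat A))  ≡⟨ det-*ᴹ (mat A) (adj (mat A)) ⟨
      det (mat A *ᴹ adj (mat A))       ≡⟨ det-cong (adj-inverseʳ (mat A) (det≡1 A)) ⟩
      1#                               ∎
  }
  where
  open ≡.≡-Reasoning
  cancel : ∀ v i → (mat A *ᵛ (adj (mat A) *ᵛ v)) i ≡ v i
  cancel v i = trans (sym (*ᵛ-*ᴹ (mat A) (adj (mat A)) v i))
    (trans (*ᵛ-congˡ (adj-inverseʳ (mat A) (det≡1 A)) v i) (1ᴹ-*ᵛ v i))

-- SU₃(3); the inverse of a matrix of determinant 1 is its adjugate.
Γ : Group 0ℓ 0ℓ
Γ = record
  { Carrier = SU
  ; _≈_ = λ A B → mat A ≈ᴹ mat B
  ; _∙_ = mulˢ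
  ; ε   = oneˢ
  ; _⁻¹ = invˢ
  ; isGroup = record
    { isMonoid = record
      { isSemigroup = record
        { isMagma = record
          { isEquivalence = record
            { refl  = λ i j → refl
            ; sym   = λ p i j → sym (p i j)
            ; trans = λ p q i j → trans (p i j) (q i j)
            }
          ; ∙-cong = *ᴹ-cong
          }
        ; assoc = λ A B C → *ᴹ-assoc (mat A) (mat B) (mat C)
        }
      ; identity = (λ A → *ᴹ-identityˡ (mat A)) , (λ A → *ᴹ-identityʳ (mat A))
      }
    ; inverse = (λ A i j → invˡ A i j) , λ A → adj-inverseʳ (mat A) (det≡1 A)
    ; ⁻¹-cong = λ p → adj-cong p
    }
  }
  where
  minor-cong : ∀ {b c d e b′ c′ d′ e′} → b ≡ b′ → c ≡ c′ → d ≡ d′ → e ≡ e′ →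
    b * c + - (d * e) ≡ b′ * c′ + - (d′ * e′)
  minor-cong refl refl refl refl = refl

  adj-cong : ∀ {A B} → A ≈ᴹ B → adj A ≈ᴹ adj B
  adj-cong p 0F 0F = minor-cong (p 1F 1F) (p 2F 2F) (p 1F 2F) (p 2F 1F)
  adj-cong p 0F 1F = minor-cong (p 2F 1F) (p 0F 2F) (p 2F 2F) (p 0F 1F)
  adj-cong p 0F 2F = minor-cong (p 0F 1F) (p 1F 2F) (p 0F 2F) (p 1F 1F)
  adj-cong p 1F 0F = minor-cong (p 1F 2F) (p 2F 0F) (p 1F 0F) (p 2F 2F)
  adj-cong p 1F 1F = minor-cong (p 2F 2F) (p 0F 0F) (p 2F 0F) (p 0F 2F)
  adj-cong p 1F 2F = minor-cong (p 0F 2F) (p 1F 0F) (p 0F 0F) (p 1F 2F)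
  adj-cong p 2F 0F = minor-cong (p 1F 0F) (p 2F 1F) (p 1F 1F) (p 2F 0F)
  adj-cong p 2F 1F = minor-cong (p 2F 0F) (p 0F 1F) (p 2F 1F) (p 0F 0F)
  adj-cong p 2F 2F = minor-cong (p 0F 0F) (p 1F 1F) (p 0F 1F) (p 1F 0F)

  -- With B = adj A and C = adj B: A B = 1 and B C = 1, so A = C.
  invˡ : ∀ A → mat (invˢ A) *ᴹ mat A ≈ᴹ 1ᴹ
  invˡ A i j = begin
    (B *ᴹ mat A) i j               ≡⟨ *ᴹ-cong {B} (λ _ _ → refl) A≈C i j ⟩
    (B *ᴹ C) i j                   ≡⟨ B*C i j ⟩
    1ᴹ i j                         ∎
    where
    open ≡.≡-Reasoning
    B = mat (invˢ A)
    C = mat (invˢ (invˢ A))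
    B*C : B *ᴹ C ≈ᴹ 1ᴹ
    B*C = adj-inverseʳ B (det≡1 (invˢ A))
    A≈C : mat A ≈ᴹ C
    A≈C i j = begin
      mat A i j                  ≡⟨ *ᴹ-identityʳ (mat A) i j ⟨
      (mat A *ᴹ 1ᴹ) i j          ≡⟨ *ᴹ-cong {mat A} (λ _ _ → refl) B*C i j ⟨
      (mat A *ᴹ (B *ᴹ C)) i j    ≡⟨ *ᴹ-assoc (mat A) B C i j ⟨
      ((mat A *ᴹ B) *ᴹ C) i j    ≡⟨ *ᴹ-cong {B = C} (adj-inverseʳ (mat A) (det≡1 A)) (λ _ _ → refl) i j ⟩
      (1ᴹ *ᴹ C) i j              ≡⟨ *ᴹ-identityˡ C i j ⟩
      C i j                      ∎

-- Γ.2 is the full automorphism group; Γ sits in it as the inner automorphisms.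
Γ·2 : Group 0ℓ 0ℓ
Γ·2 = Aut Γ

conj-sum : ∀ v → conj (sum v) ≡ sum {3} (conj ∘ v)
conj-sum v = trans (conj-+ _ _) (cong (conj (v 0F) +_)
  (trans (conj-+ _ _) (cong (conj (v 1F) +_) (conj-+ _ _))))

conjᴹ : Matrix → Matrix
conjᴹ A i j = conj (A i j)

conjᴹ-*ᵛ : ∀ A v i → conj ((A *ᵛ v) i) ≡ (conjᴹ A *ᵛ (conj ∘ v)) i
conjᴹ-*ᵛ A v i = trans (conj-sum (λ k → A i k * v k)) (sum₃-cong λ k → conj-* (A i k) (v k))

conj-⟪⟫ : ∀ x y → conj ⟪ x , y ⟫ ≡ ⟪ conj ∘ x , conj ∘ y ⟫
conj-⟪⟫ x y = trans (conj-sum (λ k → x k * conj (y k))) (sum₃-cong λ k → conj-* (x k) (conj (y k)))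

det-conjᴹ : ∀ A → det (conjᴹ A) ≡ conj (det A)
det-conjᴹ A = sym (trans (conj-+ _ _) (cong₂ _+_ (trans (conj-+ _ _) (cong₂ _+_
  (term (A 0F 0F) (A 1F 1F) (A 2F 2F) (A 1F 2F) (A 2F 1F))
  (term (A 0F 1F) (A 1F 2F) (A 2F 0F) (A 1F 0F) (A 2F 2F))))
  (term (A 0F 2F) (A 1F 0F) (A 2F 1F) (A 1F 1F) (A 2F 0F))))
  where
  term : ∀ a b c d e →
    conj (a * (b * c + - (d * e))) ≡ conj a * (conj b * conj c + - (conj d * conj e))
  term a b c d e = trans (conj-* a _) (cong (conj a *_) (trans (conj-+ _ _)
    (cong₂ _+_ (conj-* b c) (trans (conj-- _) (cong -_ (conj-* d e))))))

frobenius : SU → SU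
frobenius A = record
  { mat = conjᴹ (mat A)
  ; unitary = λ x y → begin
      ⟪ conjᴹ (mat A) *ᵛ x , conjᴹ (mat A) *ᵛ y ⟫
        ≡⟨ ⟪⟫-cong (step x) (step y) ⟩
      ⟪ conj ∘ (mat A *ᵛ (conj ∘ x)) , conj ∘ (mat A *ᵛ (conj ∘ y)) ⟫
        ≡⟨ conj-⟪⟫ (mat A *ᵛ (conj ∘ x)) (mat A *ᵛ (conj ∘ y)) ⟨
      conj ⟪ mat A *ᵛ (conj ∘ x) , mat A *ᵛ (conj ∘ y) ⟫
        ≡⟨ cong conj (unitary A (conj ∘ x) (conj ∘ y)) ⟩
      conj ⟪ conj ∘ x , conj ∘ y ⟫
        ≡⟨ conj-⟪⟫ (conj ∘ x) (conj ∘ y) ⟩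
      ⟪ conj ∘ conj ∘ x , conj ∘ conj ∘ y ⟫
        ≡⟨ ⟪⟫-cong (λ i → conj-involutive (x i)) (λ i → conj-involutive (y i)) ⟩
      ⟪ x , y ⟫ ∎
  ; det≡1 = trans (det-conjᴹ (mat A)) (cong conj (det≡1 A))
  }
  where
  open ≡.≡-Reasoning
  step : ∀ x i → (conjᴹ (mat A) *ᵛ x) i ≡ conj ((mat A *ᵛ (conj ∘ x)) i)
  step x i = sym (trans (conjᴹ-*ᵛ (mat A) (conj ∘ x) i)
    (*ᵛ-congʳ (conjᴹ (mat A)) (λ k → conj-involutive (x k)) i))

-- The outer involution: entrywise Frobenius.
outer : Automorphism Γ
outer = mkAutomorphism Γ frobenius frobenius
  (λ p i j → cong conj (p i j))
  (λ A B i j → conjᴹ-*ᵛ (mat A) (λ k → mat B k j) i)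
  (λ p i j → cong conj (p i j))
  (λ A i j → conj-involutive (mat A i j))
  (λ A i j → conj-involutive (mat A i j))

-- Preimage under the outer involution, which is its own inverse.
twist : Pred SU 0ℓ → Pred SU 0ℓ
twist C A = Automorphism.⟦ outer ⟧ A ∈ C

-- Equality of tuples of classes up to reordering and up to a simultaneous
-- application of the outer involution.
infix 4 _∼_
_∼_ : ∀ {z} → Vector (Pred SU 0ℓ) z → Vector (Pred SU 0ℓ) z → Set
_∼_ {z} C D = Σ[ π ∈ Permutation′ z ]
  ((∀ i → C i ≐ D (π ⟨$⟩ʳ i)) ⊎ (∀ i → C i ≐ twist (D (π ⟨$⟩ʳ i))))

module _ where
  open Group Γ

  2A : Pred SU 0ℓ
  2A A = ¬ (A ≈ ε) × A ∙ A ≈ ε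

-- Transvections x ↦ x + f(x) v, where v and f are non-zero and f(v) = 0.
3A : Pred SU 0ℓ
3A A = ∃₂ λ (v f : Vec₃) →
  ¬ (∀ i → v i ≡ 0#) × ¬ (∀ i → f i ≡ 0#) ×
  (sum λ i → f i * v i) ≡ 0# ×
  mat A ≈ᴹ (λ i j → 1ᴹ i j + v i * f j)

diagonal : (d : Vec₃) → (∀ i → d i * conj (d i) ≡ 1#) → det (diag d) ≡ 1# → SU
diagonal d norm≡1 det≡1 = record
  { mat = diag d
  ; unitary = λ x y → trans
      (⟪⟫-cong (diag-*ᵛ d x) (diag-*ᵛ d y))
      (sum₃-cong λ i → trans (cong (d i * x i *_) (conj-* (d i) (y i)))
        (trans (regroup (d i) (x i) (conj (d i)) (conj (y i)))
        (trans (cong (_* (x i * conj (y i))) (norm≡1 i)) (*-identityˡ _))))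
  ; det≡1 = det≡1
  }
  where
  regroup : ∀ a b c d → (a * b) * (c * d) ≡ (a * c) * (b * d)
  regroup = solve-∀ F₉-ring

4A 4B : Pred SU 0ℓ
4A = Conjugate Γ (diagonal (𝕚 ∷ 𝕚 ∷ - 1# ∷ [])
  (λ { 0F → refl ; 1F → refl ; 2F → refl }) refl)
4B = Conjugate Γ (diagonal (- 𝕚 ∷ - 𝕚 ∷ - 1# ∷ [])
  (λ { 0F → refl ; 1F → refl ; 2F → refl }) refl)

record IsotropicVector : Set where
  field
    vec       : Vec₃
    vec≢0     : ¬ (∀ i → vec i ≡ 0#)
    isotropic : ⟪ vec , vec ⟫ ≡ 0#

open IsotropicVector

infix 4 _∝_
_∝_ : Vec₃ → Vec₃ → Set
u ∝ v = ∃[ c ] c ≢ 0# × (∀ i → v i ≡ c * u i)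

∝-isEquivalence : IsEquivalence _∝_
∝-isEquivalence = record
  { refl  = λ {u} → 1# , (λ ()) , λ i → sym (*-identityˡ (u i))
  ; sym   = λ {u} {v} (c , c≢0 , p) → recip c , recip≢0 c c≢0 , λ i → sym (begin
      recip c * v i        ≡⟨ cong (recip c *_) (p i) ⟩
      recip c * (c * u i)  ≡⟨ cancel c c≢0 (u i) ⟩
      u i                  ∎)
  ; trans = λ {u} (c , c≢0 , p) (d , d≢0 , q) →
      d * c ,
      (λ dc≡0 → c≢0 (trans (sym (cancel d d≢0 c)) (trans (cong (recip d *_) dc≡0) (zeroʳ (recip d))))) ,
      λ i → trans (q i) (trans (cong (d *_) (p i)) (sym (*-assoc d c (u i))))
  }
  where
  open ≡.≡-Reasoning
  cancel : ∀ c → c ≢ 0# → ∀ x → recip c * (c * x) ≡ x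
  cancel c c≢0 x = trans (sym (*-assoc (recip c) c x))
    (trans (cong (_* x) (recip-inverseˡ c c≢0)) (*-identityˡ x))
  recip≢0 : ∀ c → c ≢ 0# → recip c ≢ 0#
  recip≢0 = from-yes (all₉? λ c → ¬? (c ≟₉ 0#) →-dec ¬? (recip c ≟₉ 0#))

-- Points of P²(F₉): vectors are identified when proportional.
IsotropicPoints : Setoid 0ℓ 0ℓ
IsotropicPoints = record
  { Carrier = IsotropicVector
  ; _≈_ = λ u v → vec u ∝ vec v
  ; isEquivalence = On.isEquivalence vec ∝-isEquivalence
  }

-- The cycles of A on the isotropic points: classes of the equivalence
-- relation generated by relating a point to its image under A.
Cycles : SU → Setoid 0ℓ 0ℓ
Cycles A = EqClosure.setoid λ (u v : IsotropicVector) → mat A *ᵛ vec u ∝ vec v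

-- The degree n cover with local monodromies g has genus γ, by Riemann–Hurwitz.
-- Meaningful for g in Σ(C), Γ being transitive on the points.
HasGenus : ∀ {z} → ℕ → Vector SU z → ℕ → Set
HasGenus {z} n g γ = IsotropicPoints HasSize n × ∃[ l ]
  (∀ i → Cycles (g i) HasSize l i) ×
  ℤ.+ ℕsum l ≡ (ℤ.+ z ℤ.- ℤ.+ 2) ℤ.* ℤ.+ n ℤ.+ ℤ.+ 2 ℤ.- ℤ.+ 2 ℤ.* ℤ.+ γ
  where
  ℕsum : ∀ {z} → Vector ℕ z → ℕ
  ℕsum = Vector.foldr ℕ._+_ 0

quadruple : Fin 5 → Vector (Pred SU 0ℓ) 4
quadruple 0F = 3A ∷ 3A ∷ 3A ∷ 4B ∷ []
quadruple 1F = 4A ∷ 4A ∷ 4A ∷ 4B ∷ []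
quadruple 2F = 2A ∷ 2A ∷ 3A ∷ 4A ∷ []
quadruple 3F = 4A ∷ 4A ∷ 4A ∷ 2A ∷ []
quadruple 4F = 4A ∷ 4A ∷ 3A ∷ 3A ∷ []

genus : Fin 5 → ℕ
genus 0F = 9
genus 1F = 9
genus 2F = 3
genus 3F = 6
genus 4F = 9

module Submission where

-- Both groups are small enough for the type checker to compute with all their
-- elements. A matrix in Γ is determined by two orthonormal columns, and an
-- automorphism of Γ by its values on two generators σ and τ; as these satisfy
-- relations that determine them up to a semilinear unitary map, Γ.2 consists of
-- the conjugations by such maps.
--
-- Up to a braid move and a rotation, a quadruple is sorted. Grouping the tuples
-- of Σ̄(a,b,c,d) by u = g₁ g₂ shows that their number is the sum over u of
-- |{g₁ g₂ = u}| · |{g₃ g₄ = u⁻¹}|, which mostly exceeds 4 |G|. For the other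
-- quadruples let g₄ be a fixed representative. Then either every tuple
-- normalises a small set that is not normal, so that none generates G; or there
-- are two generating tuples that are not conjugate, and since G has no centre
-- each of them contributes 1 to μ; or all tuples are conjugate to a single
-- generating one, which happens exactly for the quadruples listed.

open import Algebra.Bundles using (Group)
import Algebra.Definitions.RawMonoid as RawMonoidSum
import Algebra.Properties.CommutativeMonoid.Sum as NatSum
import Algebra.Properties.Group as GroupProperties
open import Algebra.Structures using (module IsCommutativeRing)
open import Data.Bool.Base using (Bool; true; false; if_then_else_; T; _∧_; _∨_; _xor_)
open import Data.Bool.Properties as Bool using (T-∧)
open import Data.Empty using (⊥)
open import Data.Fin.Base as Fin using (Fin)
open import Data.Fin.Patterns using (0F; 1F; 2F; 3F; 4F)
open import Data.Fin.Permutation as Permutation using (Permutation′; _⟨$⟩ʳ_; _∘ₚ_)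
import Data.Fin.Properties as Fin
open import Data.Integer.Base as ℤ using (ℤ)
import Data.Integer.Properties as ℤ
open import Data.List.Base using (List; []; _∷_; _++_; map; concatMap; cartesianProduct; filter; length; lookup; upTo; applyUpTo; allFin)
open import Data.List.Membership.Propositional using (find; lose) renaming (_∈_ to _∈ˡ_)
open import Data.List.Membership.Propositional.Properties
open import Data.List.Properties using (length-++; length-map)
open import Data.List.Relation.Unary.All as All using (All; []; _∷_)
import Data.List.Relation.Unary.All.Properties as All
open import Data.List.Relation.Unary.AllPairs using ([]; _∷_)
open import Data.List.Relation.Unary.Any as Any using (Any; here; there)
open import Data.List.Relation.Unary.Any.Properties using (lookup-index)
open import Data.List.Relation.Unary.Unique.DecPropositional using (unique?)
open import Data.List.Relation.Unary.Unique.Propositional using (Unique)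
import Data.List.Relation.Unary.Unique.Propositional.Properties as Unique
open import Data.Nat.Base as ℕ using (ℕ; zero; suc)
import Data.Nat.Properties as ℕ
open import Data.Product.Base using (_×_; _,_; proj₁; proj₂; ∃-syntax; ∃₂; Σ-syntax)
open import Data.Product.Properties using (≡-dec)
open import Data.Rational.Base as ℚ using (ℚ; 1ℚ; _/_)
import Data.Rational.Properties as ℚ
open import Data.Rational.Unnormalised.Base using (mkℚᵘ; *≡*; *<*)
import Data.Rational.Unnormalised.Properties as ℚᵘ
open import Data.Sum.Base using (_⊎_; inj₁; inj₂)
open import Data.Unit.Base using (tt)
open import Data.Vec.Functional as Vector using (Vector)
import Data.Vec.Functional.Relation.Binary.Equality.Setoid as VectorEquality
open import Function.Base using (_∘_; id)
open import Function.Bundles using (Equivalence; Inverse)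
import Function.Construct.Composition as Composition
open import Level using (0ℓ)
open import Relation.Binary.Bundles using (Setoid)
import Relation.Binary.Construct.Closure.Equivalence as EqClosure
open import Relation.Binary.Definitions using (DecidableEquality)
open import Relation.Binary.PropositionalEquality hiding (setoid; resp; J)
import Relation.Binary.Reasoning.Setoid as SetoidReasoning
open import Relation.Binary.Structures using (IsEquivalence)
open import Relation.Nullary using (¬_; contradiction)
open import Relation.Nullary.Decidable using (Dec; yes; no; does; map′; T?; from-yes; toWitness; ¬?; _×-dec_; _⊎-dec_; _→-dec_)
open import Relation.Unary using (Pred; _∈_; _≐_)
open import Relation.Unary.Properties using (≐-sym; ≐-trans)
open import Tactic.RingSolver using (solve-∀)
open import Defs

open IsCommutativeRing F₉-isCommutativeRing using (+-identityʳ; -‿inverseʳ; *-assoc; zeroʳ)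
open SU

-- The obstacle is evaluation: the group elements of the statement are functions packed with proofs,
-- a poor basis for computing with thousands of them. Each element is therefore coded by a
-- first-order term, `lin m` or `semi m`, standing for the map x ↦ m x or x ↦ m x̄. Finite checks
-- run on codes, and `Coding` carries their results back. Class numbers, conjugators and paths to
-- the generators come from a search about which nothing is proved. Every value read from its tables
-- is verified for every element, so a faulty table could only make a check fail. The size of Σ̄ is
-- only bounded from below, which is enough to show μ̄ ≥ 4; exact values are required for the five
-- listed quadruples alone, where a bijection with G supplies them. In Γ.2, parity with respect to Γ
-- removes the quadruples with an odd number of classes outside Γ, or with none. Lists and tables
-- are `opaque` except where a check evaluates them, so that they do not unfold inside later types.

every : {A : Set} → (A → Bool) → List A → Bool
every p []       = true
every p (x ∷ xs) = p x ∧ every p xs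

-- Same as All.all?, but its boolean part is a plain recursion on booleans,
-- which the type checker evaluates much faster.
every? : {A : Set} {P : Pred A 0ℓ} → (∀ x → Dec (P x)) → ∀ xs → Dec (All P xs)
every? {P = P} P? xs = map′ (sound xs) (complete xs) (T? (every (does ∘ P?) xs))
  where
  sound : ∀ xs → T (every (does ∘ P?) xs) → All P xs
  sound []       _ = []
  sound (x ∷ xs) t with P? x
  ... | yes px = px ∷ sound xs t
  complete : ∀ xs → All P xs → T (every (does ∘ P?) xs)
  complete []       _          = tt
  complete (x ∷ xs) (px ∷ pxs) with P? x
  ... | yes _  = complete xs pxs
  ... | no ¬px = contradiction px ¬px

some : {A : Set} → (A → Bool) → List A → Bool
some p []       = false
some p (x ∷ xs) = p x ∨ some p xs

some? : {A : Set} {P : Pred A 0ℓ} → (∀ x → Dec (P x)) → ∀ xs → Dec (Any P xs)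
some? {P = P} P? xs = map′ (sound xs) (complete xs) (T? (some (does ∘ P?) xs))
  where
  sound : ∀ xs → T (some (does ∘ P?) xs) → Any P xs
  sound (x ∷ xs) t with P? x
  ... | yes px = here px
  ... | no  _  = there (sound xs t)
  complete : ∀ xs → Any P xs → T (some (does ∘ P?) xs)
  complete (x ∷ xs) (here px) with P? x
  ... | yes _  = tt
  ... | no ¬px = contradiction px ¬px
  complete (x ∷ xs) (there pxs) with P? x
  ... | yes _ = tt
  ... | no  _ = complete xs pxs

-- `π` recovers the index of a block from any of its members, so blocks with different indices are
-- disjoint.
Unique-concatMap : ∀ {A B : Set} (f : A → List B) (π : B → A) →
  (∀ a → Unique (f a)) → (∀ a {b} → b ∈ˡ f a → π b ≡ a) →
  ∀ {xs} → Unique xs → Unique (concatMap f xs)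
Unique-concatMap f π f-unique π-f {[]}     []          = []
Unique-concatMap f π f-unique π-f {x ∷ xs} (x∉ ∷ xs-unique) = Unique.++⁺ (f-unique x)
  (Unique-concatMap f π f-unique π-f xs-unique) λ {b} (b∈fx , b∈rest) →
    let a , a∈xs , b∈fa = find (∈-concatMap⁻ f {xs = xs} b∈rest)
    in All.lookup x∉ a∈xs (trans (sym (π-f x b∈fx)) (π-f a b∈fa))

-- Arithmetic of F₉ on a nine-element type.

-- k(a + 3b) stands for a + b i.
data K : Set where
  k0 k1 k2 k3 k4 k5 k6 k7 k8 : K

-- Building blocks that replace tables of 81 entries. Sums are iterated steps by 1 and i; for
-- products, every nonzero element is 1, i, 1+i or i(1+i) up to sign.
1+_ i+_ opposite conjugate i·_ [1+i]·_ : K → K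
1+ k0 = k1
1+ k1 = k2
1+ k2 = k0
1+ k3 = k4
1+ k4 = k5
1+ k5 = k3
1+ k6 = k7
1+ k7 = k8
1+ k8 = k6

i+ k0 = k3
i+ k1 = k4
i+ k2 = k5
i+ k3 = k6
i+ k4 = k7
i+ k5 = k8
i+ k6 = k0
i+ k7 = k1
i+ k8 = k2

opposite k0 = k0
opposite k1 = k2
opposite k2 = k1
opposite k3 = k6
opposite k4 = k8
opposite k5 = k7
opposite k6 = k3
opposite k7 = k5
opposite k8 = k4

conjugate k0 = k0
conjugate k1 = k1
conjugate k2 = k2
conjugate k3 = k6
conjugate k4 = k7
conjugate k5 = k8
conjugate k6 = k3
conjugate k7 = k4
conjugate k8 = k5

i· k0 = k0
i· k1 = k3
i· k2 = k6
i· k3 = k2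
i· k4 = k5
i· k5 = k8
i· k6 = k1
i· k7 = k4
i· k8 = k7

[1+i]· k0 = k0
[1+i]· k1 = k4
[1+i]· k2 = k8
[1+i]· k3 = k5
[1+i]· k4 = k6
[1+i]· k5 = k1
[1+i]· k6 = k7
[1+i]· k7 = k2
[1+i]· k8 = k3

infixl 6 _⊕_
infixl 7 _⊙_
_⊕_ _⊙_ : K → K → K
k0 ⊕ y = y
k1 ⊕ y = 1+ y
k2 ⊕ y = 1+ 1+ y
k3 ⊕ y = i+ y
k4 ⊕ y = 1+ i+ y
k5 ⊕ y = 1+ 1+ i+ y
k6 ⊕ y = i+ i+ y
k7 ⊕ y = 1+ i+ i+ y
k8 ⊕ y = 1+ 1+ i+ i+ y

k0 ⊙ y = k0
k1 ⊙ y = y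
k2 ⊙ y = opposite y
k3 ⊙ y = i· y
k4 ⊙ y = [1+i]· y
k5 ⊙ y = i· [1+i]· y
k6 ⊙ y = opposite (i· y)
k7 ⊙ y = opposite (i· [1+i]· y)
k8 ⊙ y = opposite ([1+i]· y)

index : K → ℕ
index k0 = 0
index k1 = 1
index k2 = 2
index k3 = 3
index k4 = 4
index k5 = 5
index k6 = 6
index k7 = 7
index k8 = 8

toF₉ : K → F₉
toF₉ k0 = 0F +i 0F
toF₉ k1 = 1F +i 0F
toF₉ k2 = 2F +i 0F
toF₉ k3 = 0F +i 1F
toF₉ k4 = 1F +i 1F
toF₉ k5 = 2F +i 1F
toF₉ k6 = 0F +i 2F
toF₉ k7 = 1F +i 2F
toF₉ k8 = 2F +i 2F

fromF₉ : F₉ → K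
fromF₉ (0F +i 0F) = k0
fromF₉ (1F +i 0F) = k1
fromF₉ (2F +i 0F) = k2
fromF₉ (0F +i 1F) = k3
fromF₉ (1F +i 1F) = k4
fromF₉ (2F +i 1F) = k5
fromF₉ (0F +i 2F) = k6
fromF₉ (1F +i 2F) = k7
fromF₉ (2F +i 2F) = k8

fromF₉-toF₉ : ∀ x → fromF₉ (toF₉ x) ≡ x
fromF₉-toF₉ k0 = refl
fromF₉-toF₉ k1 = refl
fromF₉-toF₉ k2 = refl
fromF₉-toF₉ k3 = refl
fromF₉-toF₉ k4 = refl
fromF₉-toF₉ k5 = refl
fromF₉-toF₉ k6 = refl
fromF₉-toF₉ k7 = refl
fromF₉-toF₉ k8 = refl

toF₉-fromF₉ : ∀ x → toF₉ (fromF₉ x) ≡ x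
toF₉-fromF₉ (0F +i 0F) = refl
toF₉-fromF₉ (1F +i 0F) = refl
toF₉-fromF₉ (2F +i 0F) = refl
toF₉-fromF₉ (0F +i 1F) = refl
toF₉-fromF₉ (1F +i 1F) = refl
toF₉-fromF₉ (2F +i 1F) = refl
toF₉-fromF₉ (0F +i 2F) = refl
toF₉-fromF₉ (1F +i 2F) = refl
toF₉-fromF₉ (2F +i 2F) = refl

fromIndex : ℕ → K
fromIndex 0 = k0
fromIndex 1 = k1
fromIndex 2 = k2
fromIndex 3 = k3
fromIndex 4 = k4
fromIndex 5 = k5
fromIndex 6 = k6
fromIndex 7 = k7
fromIndex _ = k8

index-injective : ∀ {x y} → index x ≡ index y → x ≡ y
index-injective {x} {y} p = trans (sym (left-inverse x)) (trans (cong fromIndex p) (left-inverse y))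
  where
  left-inverse : ∀ x → fromIndex (index x) ≡ x
  left-inverse k0 = refl
  left-inverse k1 = refl
  left-inverse k2 = refl
  left-inverse k3 = refl
  left-inverse k4 = refl
  left-inverse k5 = refl
  left-inverse k6 = refl
  left-inverse k7 = refl
  left-inverse k8 = refl

_≟ᴷ_ : DecidableEquality K
x ≟ᴷ y = map′ index-injective (cong index) (index x ℕ.≟ index y)

fromF₉-+ : ∀ x y → fromF₉ (x + y) ≡ fromF₉ x ⊕ fromF₉ y
fromF₉-+ = from-yes (all₉? λ x → all₉? λ y → fromF₉ (x + y) ≟ᴷ (fromF₉ x ⊕ fromF₉ y))

fromF₉-* : ∀ x y → fromF₉ (x * y) ≡ fromF₉ x ⊙ fromF₉ y
fromF₉-* = from-yes (all₉? λ x → all₉? λ y → fromF₉ (x * y) ≟ᴷ (fromF₉ x ⊙ fromF₉ y))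

fromF₉-- : ∀ x → fromF₉ (- x) ≡ opposite (fromF₉ x)
fromF₉-- = from-yes (all₉? λ x → fromF₉ (- x) ≟ᴷ opposite (fromF₉ x))

fromF₉-conj : ∀ x → fromF₉ (conj x) ≡ conjugate (fromF₉ x)
fromF₉-conj = from-yes (all₉? λ x → fromF₉ (conj x) ≟ᴷ conjugate (fromF₉ x))

fromF₉-injective : ∀ {x y} → fromF₉ x ≡ fromF₉ y → x ≡ y
fromF₉-injective {x} {y} p = trans (sym (toF₉-fromF₉ x)) (trans (cong toF₉ p) (toF₉-fromF₉ y))

conjugate-involutive : ∀ x → conjugate (conjugate x) ≡ x
conjugate-involutive x = begin
  conjugate (conjugate x)  ≡⟨ cong (conjugate ∘ conjugate) (fromF₉-toF₉ x) ⟨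
  conjugate (conjugate (fromF₉ (toF₉ x)))  ≡⟨ cong conjugate (fromF₉-conj (toF₉ x)) ⟨
  conjugate (fromF₉ (conj (toF₉ x)))  ≡⟨ fromF₉-conj (conj (toF₉ x)) ⟨
  fromF₉ (conj (conj (toF₉ x)))  ≡⟨ cong fromF₉ (conj-involutive (toF₉ x)) ⟩
  fromF₉ (toF₉ x)  ≡⟨ fromF₉-toF₉ x ⟩
  x  ∎
  where open ≡-Reasoning

-- Matrices over F₉ as first-order data.

dot : (a b c x y z : K) → K
dot a b c x y z = a ⊙ x ⊕ (b ⊙ y ⊕ c ⊙ z)

fromF₉-dot : ∀ a b c x y z → fromF₉ (a * x + (b * y + (c * z + 0#))) ≡
             dot (fromF₉ a) (fromF₉ b) (fromF₉ c) (fromF₉ x) (fromF₉ y) (fromF₉ z)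
fromF₉-dot a b c x y z = trans (fromF₉-+ (a * x) _) (cong₂ _⊕_ (fromF₉-* a x)
  (trans (fromF₉-+ (b * y) _) (cong₂ _⊕_ (fromF₉-* b y)
    (trans (cong fromF₉ (+-identityʳ (c * z))) (fromF₉-* c z)))))

-- Nine constructor fields rather than a function of two indices: a product then has a normal form
-- that can be compared, stored and used as a key.
data M : Set where
  mk : (a b c d e f g h i : K) → M

mk-cong : ∀ {a b c d e f g h i a′ b′ c′ d′ e′ f′ g′ h′ i′} →
  a ≡ a′ → b ≡ b′ → c ≡ c′ → d ≡ d′ → e ≡ e′ → f ≡ f′ → g ≡ g′ → h ≡ h′ → i ≡ i′ →
  mk a b c d e f g h i ≡ mk a′ b′ c′ d′ e′ f′ g′ h′ i′
mk-cong refl refl refl refl refl refl refl refl refl = refl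

infixl 7 _⊗_
_⊗_ : M → M → M
mk a b c d e f g h i ⊗ mk a′ b′ c′ d′ e′ f′ g′ h′ i′ = mk
  (dot a b c a′ d′ g′) (dot a b c b′ e′ h′) (dot a b c c′ f′ i′)
  (dot d e f a′ d′ g′) (dot d e f b′ e′ h′) (dot d e f c′ f′ i′)
  (dot g h i a′ d′ g′) (dot g h i b′ e′ h′) (dot g h i c′ f′ i′)

𝟙 : M
𝟙 = mk k1 k0 k0 k0 k1 k0 k0 k0 k1

conjugateᴹ transpose : M → M
conjugateᴹ (mk a b c d e f g h i) = mk (conjugate a) (conjugate b) (conjugate c)
  (conjugate d) (conjugate e) (conjugate f) (conjugate g) (conjugate h) (conjugate i)
transpose (mk a b c d e f g h i) = mk a d g b e h c f i

infix 9 _†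
_† : M → M
m † = conjugateᴹ (transpose m)

infixl 6 _⊖_
_⊖_ : K → K → K
x ⊖ y = x ⊕ opposite y

determinant : M → K
determinant (mk a b c d e f g h i) = a ⊙ (e ⊙ i ⊖ f ⊙ h) ⊕ b ⊙ (f ⊙ g ⊖ d ⊙ i) ⊕ c ⊙ (d ⊙ h ⊖ e ⊙ g)

-- Comparing indices uses the built-in equality of natural numbers in place of a match with 81
-- cases.
_==ᴷ_ : K → K → Bool
x ==ᴷ y = index x ℕ.≡ᵇ index y

_==ᴹ_ : M → M → Bool
mk a b c d e f g h i ==ᴹ mk a′ b′ c′ d′ e′ f′ g′ h′ i′ =
  (a ==ᴷ a′) ∧ (b ==ᴷ b′) ∧ (c ==ᴷ c′) ∧ (d ==ᴷ d′) ∧ (e ==ᴷ e′) ∧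
  (f ==ᴷ f′) ∧ (g ==ᴷ g′) ∧ (h ==ᴷ h′) ∧ (i ==ᴷ i′)

==ᴹ⇒≡ : ∀ {m n} → T (m ==ᴹ n) → m ≡ n
==ᴹ⇒≡ {mk a b c d e f g h i} {mk a′ b′ c′ d′ e′ f′ g′ h′ i′} t =
  let p , t = ∧⇒× t ; q , t = ∧⇒× t ; r , t = ∧⇒× t ; u , t = ∧⇒× t ; v , t = ∧⇒× t
      w , t = ∧⇒× t ; x , t = ∧⇒× t ; y , z = ∧⇒× t
  in mk-cong (==ᴷ⇒≡ p) (==ᴷ⇒≡ q) (==ᴷ⇒≡ r) (==ᴷ⇒≡ u) (==ᴷ⇒≡ v) (==ᴷ⇒≡ w) (==ᴷ⇒≡ x) (==ᴷ⇒≡ y) (==ᴷ⇒≡ z)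
  where
  ∧⇒× : ∀ {b c} → T (b ∧ c) → T b × T c
  ∧⇒× = Equivalence.to T-∧
  ==ᴷ⇒≡ : ∀ {x y} → T (x ==ᴷ y) → x ≡ y
  ==ᴷ⇒≡ t = index-injective (ℕ.≡ᵇ⇒≡ _ _ t)

≡⇒==ᴹ : ∀ {m n} → m ≡ n → T (m ==ᴹ n)
≡⇒==ᴹ {mk a b c d e f g h i} refl = r a (r b (r c (r d (r e (r f (r g (r h
  (ℕ.≡⇒≡ᵇ (index i) (index i) refl))))))))
  where
  r : ∀ x {b} → T b → T ((x ==ᴷ x) ∧ b)
  r x t = Equivalence.from T-∧ (ℕ.≡⇒≡ᵇ (index x) (index x) refl , t)

_≟ᴹ_ : DecidableEquality M
m ≟ᴹ n = map′ ==ᴹ⇒≡ ≡⇒==ᴹ (T? (m ==ᴹ n))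

fromMatrix : Matrix → M
fromMatrix A = mk
  (fromF₉ (A 0F 0F)) (fromF₉ (A 0F 1F)) (fromF₉ (A 0F 2F))
  (fromF₉ (A 1F 0F)) (fromF₉ (A 1F 1F)) (fromF₉ (A 1F 2F))
  (fromF₉ (A 2F 0F)) (fromF₉ (A 2F 1F)) (fromF₉ (A 2F 2F))

entry : M → Fin 3 → Fin 3 → K
entry (mk a b c d e f g h i) 0F 0F = a
entry (mk a b c d e f g h i) 0F 1F = b
entry (mk a b c d e f g h i) 0F 2F = c
entry (mk a b c d e f g h i) 1F 0F = d
entry (mk a b c d e f g h i) 1F 1F = e
entry (mk a b c d e f g h i) 1F 2F = f
entry (mk a b c d e f g h i) 2F 0F = g
entry (mk a b c d e f g h i) 2F 1F = h
entry (mk a b c d e f g h i) 2F 2F = i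

toMatrix : M → Matrix
toMatrix m i j = toF₉ (entry m i j)

fromMatrix-toMatrix : ∀ m → fromMatrix (toMatrix m) ≡ m
fromMatrix-toMatrix (mk a b c d e f g h i) = mk-cong
  (fromF₉-toF₉ a) (fromF₉-toF₉ b) (fromF₉-toF₉ c) (fromF₉-toF₉ d) (fromF₉-toF₉ e)
  (fromF₉-toF₉ f) (fromF₉-toF₉ g) (fromF₉-toF₉ h) (fromF₉-toF₉ i)

entry-fromMatrix : ∀ A i j → entry (fromMatrix A) i j ≡ fromF₉ (A i j)
entry-fromMatrix A 0F 0F = refl
entry-fromMatrix A 0F 1F = refl
entry-fromMatrix A 0F 2F = refl
entry-fromMatrix A 1F 0F = refl
entry-fromMatrix A 1F 1F = refl
entry-fromMatrix A 1F 2F = refl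
entry-fromMatrix A 2F 0F = refl
entry-fromMatrix A 2F 1F = refl
entry-fromMatrix A 2F 2F = refl

fromMatrix-injective : ∀ {A B} → fromMatrix A ≡ fromMatrix B → A ≈ᴹ B
fromMatrix-injective {A} {B} p i j = fromF₉-injective (begin
  fromF₉ (A i j)  ≡⟨ entry-fromMatrix A i j ⟨
  entry (fromMatrix A) i j  ≡⟨ cong (λ m → entry m i j) p ⟩
  entry (fromMatrix B) i j  ≡⟨ entry-fromMatrix B i j ⟩
  fromF₉ (B i j)  ∎)
  where open ≡-Reasoning

fromMatrix-cong : ∀ {A B} → A ≈ᴹ B → fromMatrix A ≡ fromMatrix B
fromMatrix-cong p = mk-cong (q 0F 0F) (q 0F 1F) (q 0F 2F)
  (q 1F 0F) (q 1F 1F) (q 1F 2F) (q 2F 0F) (q 2F 1F) (q 2F 2F)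
  where
  q : ∀ i j → _
  q i j = cong fromF₉ (p i j)

fromMatrix-* : ∀ A B → fromMatrix (A *ᴹ B) ≡ fromMatrix A ⊗ fromMatrix B
fromMatrix-* A B = mk-cong (q 0F 0F) (q 0F 1F) (q 0F 2F)
  (q 1F 0F) (q 1F 1F) (q 1F 2F) (q 2F 0F) (q 2F 1F) (q 2F 2F)
  where
  q : ∀ i j → _
  q i j = fromF₉-dot (A i 0F) (A i 1F) (A i 2F) (B 0F j) (B 1F j) (B 2F j)

fromMatrix-conj : ∀ A → fromMatrix (conjᴹ A) ≡ conjugateᴹ (fromMatrix A)
fromMatrix-conj A = mk-cong (q 0F 0F) (q 0F 1F) (q 0F 2F)
  (q 1F 0F) (q 1F 1F) (q 1F 2F) (q 2F 0F) (q 2F 1F) (q 2F 2F)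
  where
  q : ∀ i j → _
  q i j = fromF₉-conj (A i j)

fromF₉-minor : ∀ a b c d →
  fromF₉ (a * b + - (c * d)) ≡ fromF₉ a ⊙ fromF₉ b ⊖ fromF₉ c ⊙ fromF₉ d
fromF₉-minor a b c d = trans (fromF₉-+ (a * b) _)
  (cong₂ _⊕_ (fromF₉-* a b) (trans (fromF₉-- (c * d)) (cong opposite (fromF₉-* c d))))

fromF₉-det : ∀ A → fromF₉ (det A) ≡ determinant (fromMatrix A)
fromF₉-det A = trans
  (fromF₉-+ (A 0F 0F * (A 1F 1F * A 2F 2F + - (A 1F 2F * A 2F 1F)) +
             A 0F 1F * (A 1F 2F * A 2F 0F + - (A 1F 0F * A 2F 2F))) _)
  (cong₂ _⊕_ (trans
    (fromF₉-+ (A 0F 0F * (A 1F 1F * A 2F 2F + - (A 1F 2F * A 2F 1F))) _)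
    (cong₂ _⊕_
      (term (A 0F 0F) (A 1F 1F) (A 2F 2F) (A 1F 2F) (A 2F 1F))
      (term (A 0F 1F) (A 1F 2F) (A 2F 0F) (A 1F 0F) (A 2F 2F))))
    (term (A 0F 2F) (A 1F 0F) (A 2F 1F) (A 1F 1F) (A 2F 0F)))
  where
  term : ∀ x a b c d → fromF₉ (x * (a * b + - (c * d))) ≡
         fromF₉ x ⊙ (fromF₉ a ⊙ fromF₉ b ⊖ fromF₉ c ⊙ fromF₉ d)
  term x a b c d = trans (fromF₉-* x _) (cong (fromF₉ x ⊙_) (fromF₉-minor a b c d))

⊗-lift : ∀ A B → fromMatrix (toMatrix A *ᴹ toMatrix B) ≡ A ⊗ B
⊗-lift A B = trans (fromMatrix-* (toMatrix A) (toMatrix B))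
  (cong₂ _⊗_ (fromMatrix-toMatrix A) (fromMatrix-toMatrix B))

-- Transported along `toMatrix` from matrices over `F₉`, where the law is known from the ring
-- solver.
⊗-assoc : ∀ a b c → (a ⊗ b) ⊗ c ≡ a ⊗ (b ⊗ c)
⊗-assoc a b c = begin
  (a ⊗ b) ⊗ c  ≡⟨ cong₂ _⊗_ (⊗-lift a b) (fromMatrix-toMatrix c) ⟨
  fromMatrix (A *ᴹ B) ⊗ fromMatrix C  ≡⟨ fromMatrix-* (A *ᴹ B) C ⟨
  fromMatrix ((A *ᴹ B) *ᴹ C)  ≡⟨ fromMatrix-cong (*ᴹ-assoc A B C) ⟩
  fromMatrix (A *ᴹ (B *ᴹ C))  ≡⟨ fromMatrix-* A (B *ᴹ C) ⟩
  fromMatrix A ⊗ fromMatrix (B *ᴹ C)  ≡⟨ cong₂ _⊗_ (fromMatrix-toMatrix a) (⊗-lift b c) ⟩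
  a ⊗ (b ⊗ c)  ∎
  where
  open ≡-Reasoning
  A = toMatrix a
  B = toMatrix b
  C = toMatrix c

conjugateᴹ-⊗ : ∀ a b → conjugateᴹ (a ⊗ b) ≡ conjugateᴹ a ⊗ conjugateᴹ b
conjugateᴹ-⊗ a b = begin
  conjugateᴹ (a ⊗ b)  ≡⟨ cong conjugateᴹ (⊗-lift a b) ⟨
  conjugateᴹ (fromMatrix (A *ᴹ B))  ≡⟨ fromMatrix-conj (A *ᴹ B) ⟨
  fromMatrix (conjᴹ (A *ᴹ B))  ≡⟨ fromMatrix-cong (λ i j → conjᴹ-*ᵛ A (λ k → B k j) i) ⟩
  fromMatrix (conjᴹ A *ᴹ conjᴹ B)  ≡⟨ fromMatrix-* (conjᴹ A) (conjᴹ B) ⟩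
  fromMatrix (conjᴹ A) ⊗ fromMatrix (conjᴹ B)  ≡⟨ cong₂ _⊗_ (lift a) (lift b) ⟩
  conjugateᴹ a ⊗ conjugateᴹ b  ∎
  where
  open ≡-Reasoning
  A = toMatrix a
  B = toMatrix b
  lift : ∀ m → fromMatrix (conjᴹ (toMatrix m)) ≡ conjugateᴹ m
  lift m = trans (fromMatrix-conj (toMatrix m)) (cong conjugateᴹ (fromMatrix-toMatrix m))

conjugateᴹ-involutive : ∀ m → conjugateᴹ (conjugateᴹ m) ≡ m
conjugateᴹ-involutive (mk a b c d e f g h i) = mk-cong
  (conjugate-involutive a) (conjugate-involutive b) (conjugate-involutive c)
  (conjugate-involutive d) (conjugate-involutive e) (conjugate-involutive f)
  (conjugate-involutive g) (conjugate-involutive h) (conjugate-involutive i)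

⊗-identityˡ : ∀ m → 𝟙 ⊗ m ≡ m
⊗-identityˡ m = begin
  𝟙 ⊗ m  ≡⟨ cong (𝟙 ⊗_) (fromMatrix-toMatrix m) ⟨
  fromMatrix 1ᴹ ⊗ fromMatrix A  ≡⟨ fromMatrix-* 1ᴹ A ⟨
  fromMatrix (1ᴹ *ᴹ A)  ≡⟨ fromMatrix-cong (*ᴹ-identityˡ A) ⟩
  fromMatrix A  ≡⟨ fromMatrix-toMatrix m ⟩
  m  ∎
  where
  open ≡-Reasoning
  A = toMatrix m

⊗-identityʳ : ∀ m → m ⊗ 𝟙 ≡ m
⊗-identityʳ m = begin
  m ⊗ 𝟙  ≡⟨ cong (_⊗ 𝟙) (fromMatrix-toMatrix m) ⟨
  fromMatrix A ⊗ fromMatrix 1ᴹ  ≡⟨ fromMatrix-* A 1ᴹ ⟨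
  fromMatrix (A *ᴹ 1ᴹ)  ≡⟨ fromMatrix-cong (*ᴹ-identityʳ A) ⟩
  fromMatrix A  ≡⟨ fromMatrix-toMatrix m ⟩
  m  ∎
  where
  open ≡-Reasoning
  A = toMatrix m

-- Semilinear maps of F₉³.

data X : Set where
  lin semi : M → X

infixl 7 _·_
-- Composition of maps, with `lin m` read as x ↦ m x and `semi m` as x ↦ m x̄: a matrix that is
-- moved across the conjugation gets conjugated.
_·_ : X → X → X
lin a  · lin b  = lin (a ⊗ b)
lin a  · semi b = semi (a ⊗ b)
semi a · lin b  = semi (a ⊗ conjugateᴹ b)
semi a · semi b = lin (a ⊗ conjugateᴹ b)

one : X
one = lin 𝟙

-- The inverse when m is unitary. For x ↦ m x̄ it is y ↦ n ȳ with n the entrywise conjugate of m†,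
-- which is the transpose of m.
invˣ : X → X
invˣ (lin m)  = lin (m †)
invˣ (semi m) = semi (transpose m)

_≟ˣ_ : DecidableEquality X
lin a  ≟ˣ lin b  = map′ (cong lin) (λ { refl → refl }) (a ≟ᴹ b)
semi a ≟ˣ semi b = map′ (cong semi) (λ { refl → refl }) (a ≟ᴹ b)
lin a  ≟ˣ semi b = no λ ()
semi a ≟ˣ lin b  = no λ ()

⊗-conjugate-assoc : ∀ a b c → (a ⊗ conjugateᴹ b) ⊗ conjugateᴹ c ≡ a ⊗ conjugateᴹ (b ⊗ c)
⊗-conjugate-assoc a b c = trans (⊗-assoc a _ _) (cong (a ⊗_) (sym (conjugateᴹ-⊗ b c)))

⊗-conjugate-assoc′ : ∀ a b c → (a ⊗ conjugateᴹ b) ⊗ c ≡ a ⊗ conjugateᴹ (b ⊗ conjugateᴹ c)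
⊗-conjugate-assoc′ a b c = trans
  (cong ((a ⊗ conjugateᴹ b) ⊗_) (sym (conjugateᴹ-involutive c)))
  (⊗-conjugate-assoc a b (conjugateᴹ c))

·-assoc : ∀ x y z → (x · y) · z ≡ x · (y · z)
·-assoc (lin a)  (lin b)  (lin c)  = cong lin (⊗-assoc a b c)
·-assoc (lin a)  (lin b)  (semi c) = cong semi (⊗-assoc a b c)
·-assoc (lin a)  (semi b) (lin c)  = cong semi (⊗-assoc a b (conjugateᴹ c))
·-assoc (lin a)  (semi b) (semi c) = cong lin (⊗-assoc a b (conjugateᴹ c))
·-assoc (semi a) (lin b)  (lin c)  = cong semi (⊗-conjugate-assoc a b c)
·-assoc (semi a) (lin b)  (semi c) = cong lin (⊗-conjugate-assoc a b c)
·-assoc (semi a) (semi b) (lin c)  = cong lin (⊗-conjugate-assoc′ a b c)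
·-assoc (semi a) (semi b) (semi c) = cong semi (⊗-conjugate-assoc′ a b c)

·-identityˡ : ∀ x → one · x ≡ x
·-identityˡ (lin m)  = cong lin (⊗-identityˡ m)
·-identityˡ (semi m) = cong semi (⊗-identityˡ m)

·-identityʳ : ∀ x → x · one ≡ x
·-identityʳ (lin m)  = cong lin (⊗-identityʳ m)
·-identityʳ (semi m) = cong semi (⊗-identityʳ m)

-- Unitary matrices and the enumeration of Γ.

infix 9 _*ᵀ
_*ᵀ : Matrix → Matrix
(A *ᵀ) i j = conj (A j i)

fromMatrix-*ᵀ : ∀ A → fromMatrix (A *ᵀ) ≡ fromMatrix A †
fromMatrix-*ᵀ A = mk-cong (q 0F 0F) (q 0F 1F) (q 0F 2F)
  (q 1F 0F) (q 1F 1F) (q 1F 2F) (q 2F 0F) (q 2F 1F) (q 2F 2F)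
  where
  q : ∀ i j → _
  q i j = fromF₉-conj (A j i)

adjoint : ∀ A x z → ⟪ A *ᵛ x , z ⟫ ≡ ⟪ x , A *ᵀ *ᵛ z ⟫
adjoint A x z = trans
  (regroup (A 0F 0F) (A 0F 1F) (A 0F 2F) (A 1F 0F) (A 1F 1F) (A 1F 2F) (A 2F 0F) (A 2F 1F) (A 2F 2F)
    (x 0F) (x 1F) (x 2F) (conj (z 0F)) (conj (z 1F)) (conj (z 2F)))
  (sum₃-cong λ k → cong (x k *_) (sym (trans (conj-sum (λ i → conj (A i k) * z i))
    (sum₃-cong λ i → trans (conj-* (conj (A i k)) (z i))
      (cong (_* conj (z i)) (conj-involutive (A i k)))))))
  where
  regroup : ∀ a b c d e f g h k x y z p q r →
    (a * x + (b * y + (c * z + 0#))) * p + ((d * x + (e * y + (f * z + 0#))) * q +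
      ((g * x + (h * y + (k * z + 0#))) * r + 0#)) ≡
    x * (a * p + (d * q + (g * r + 0#))) + (y * (b * p + (e * q + (h * r + 0#))) +
      (z * (c * p + (f * q + (k * r + 0#))) + 0#))
  regroup = solve-∀ F₉-ring

Unitary : Pred M 0ℓ
Unitary m = (m † ⊗ m ≡ 𝟙) × (determinant m ≡ k1)

unitary? : ∀ m → Dec (Unitary m)
unitary? m = (m † ⊗ m) ≟ᴹ 𝟙 ×-dec determinant m ≟ᴷ k1

fromSU : SU → M
fromSU A = fromMatrix (mat A)

-- On pairs of standard basis vectors, preservation of the form is the Gram identity m† m = 1.
fromSU-unitary : ∀ A → Unitary (fromSU A)
fromSU-unitary A =
  (begin
    fromSU A † ⊗ fromSU A  ≡⟨ cong (_⊗ fromSU A) (fromMatrix-*ᵀ (mat A)) ⟨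
    fromMatrix (mat A *ᵀ) ⊗ fromSU A  ≡⟨ fromMatrix-* (mat A *ᵀ) (mat A) ⟨
    fromMatrix (mat A *ᵀ *ᴹ mat A)  ≡⟨ fromMatrix-cong gram ⟩
    𝟙  ∎) ,
  trans (sym (fromF₉-det (mat A))) (cong fromF₉ (det≡1 A))
  where
  open ≡-Reasoning
  e : Fin 3 → Vec₃
  e j k = 1ᴹ k j
  orthonormal : ∀ i j → ⟪ e j , e i ⟫ ≡ 1ᴹ i j
  orthonormal = from-yes (Fin.all? λ i → Fin.all? λ j → ⟪ e j , e i ⟫ ≟₉ 1ᴹ i j)
  gram : mat A *ᵀ *ᴹ mat A ≈ᴹ 1ᴹ
  gram i j = begin
    (mat A *ᵀ *ᴹ mat A) i j  ≡⟨ sum₃-cong (λ k → *-comm (conj (mat A k i)) (mat A k j)) ⟩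
    ⟪ (λ k → mat A k j) , (λ k → mat A k i) ⟫ ≡⟨ ⟪⟫-cong (λ k → *ᴹ-identityʳ (mat A) k j) (λ k → *ᴹ-identityʳ (mat A) k i) ⟨
    ⟪ mat A *ᵛ e j , mat A *ᵛ e i ⟫  ≡⟨ unitary A (e j) (e i) ⟩
    ⟪ e j , e i ⟫  ≡⟨ orthonormal i j ⟩
    1ᴹ i j  ∎

-- m† is a left inverse and the adjugate a right inverse of the same matrix, so they coincide.
fromSU-inv : ∀ A → fromSU (invˢ A) ≡ fromSU A †
fromSU-inv A = begin
  n  ≡⟨ ⊗-identityˡ n ⟨
  𝟙 ⊗ n  ≡⟨ cong (_⊗ n) (proj₁ (fromSU-unitary A)) ⟨
  m † ⊗ m ⊗ n  ≡⟨ ⊗-assoc (m †) m n ⟩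
  m † ⊗ (m ⊗ n)  ≡⟨ cong (m † ⊗_) (fromMatrix-* (mat A) (adj (mat A))) ⟨
  m † ⊗ fromMatrix (mat A *ᴹ adj (mat A)) ≡⟨ cong (m † ⊗_) (fromMatrix-cong (adj-inverseʳ (mat A) (det≡1 A))) ⟩
  m † ⊗ 𝟙  ≡⟨ ⊗-identityʳ (m †) ⟩
  m †  ∎
  where
  open ≡-Reasoning
  m = fromSU A
  n = fromSU (invˢ A)

toSU : ∀ m → Unitary m → SU
toSU m (m†m≡1 , det≡1) = record
  { mat = A
  ; unitary = λ x y → begin
      ⟪ A *ᵛ x , A *ᵛ y ⟫  ≡⟨ adjoint A x (A *ᵛ y) ⟩
      ⟪ x , A *ᵀ *ᵛ A *ᵛ y ⟫  ≡⟨ ⟪⟫-cong {x} (λ _ → refl) (λ i → trans (sym (*ᵛ-*ᴹ (A *ᵀ) A y i))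
                                       (trans (*ᵛ-congˡ gram y i) (1ᴹ-*ᵛ y i))) ⟩
      ⟪ x , y ⟫  ∎
  ; det≡1 = fromF₉-injective (trans (fromF₉-det A) (trans (cong determinant (fromMatrix-toMatrix m)) det≡1))
  }
  where
  open ≡-Reasoning
  A = toMatrix m
  gram : A *ᵀ *ᴹ A ≈ᴹ 1ᴹ
  gram = fromMatrix-injective (begin
    fromMatrix (A *ᵀ *ᴹ A)  ≡⟨ fromMatrix-* (A *ᵀ) A ⟩
    fromMatrix (A *ᵀ) ⊗ fromMatrix A  ≡⟨ cong (_⊗ fromMatrix A) (fromMatrix-*ᵀ A) ⟩
    fromMatrix A † ⊗ fromMatrix A  ≡⟨ cong (λ n → n † ⊗ n) (fromMatrix-toMatrix m) ⟩
    m † ⊗ m  ≡⟨ m†m≡1 ⟩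
    𝟙  ∎)

fromSU-toSU : ∀ m (u : Unitary m) → fromSU (toSU m u) ≡ m
fromSU-toSU m _ = fromMatrix-toMatrix m

Column : Set
Column = K × K × K

allK : List K
allK = k0 ∷ k1 ∷ k2 ∷ k3 ∷ k4 ∷ k5 ∷ k6 ∷ k7 ∷ k8 ∷ []

∈-allK : ∀ x → x ∈ˡ allK
∈-allK = λ where
  k0 → here refl
  k1 → there (here refl)
  k2 → there (there (here refl))
  k3 → there (there (there (here refl)))
  k4 → there (there (there (there (here refl))))
  k5 → there (there (there (there (there (here refl)))))
  k6 → there (there (there (there (there (there (here refl))))))
  k7 → there (there (there (there (there (there (there (here refl)))))))
  k8 → there (there (there (there (there (there (there (there (here refl))))))))

columns : List Column
columns = cartesianProduct allK (cartesianProduct allK allK)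

∈-columns : ∀ u → u ∈ˡ columns
∈-columns (a , b , c) =
  ∈-cartesianProduct⁺ (∈-allK a) (∈-cartesianProduct⁺ (∈-allK b) (∈-allK c))

columns-unique : Unique columns
columns-unique = Unique.cartesianProduct⁺ allK-unique (Unique.cartesianProduct⁺ allK-unique allK-unique)
  where
  allK-unique : Unique allK
  allK-unique = from-yes (unique? _≟ᴷ_ allK)

hermitian : Column → Column → K
hermitian (a , b , c) (x , y , z) = dot (conjugate a) (conjugate b) (conjugate c) x y z

-- The third column of a special unitary matrix is the conjugate of the cross
-- product of the other two.
fromColumns : Column → Column → M
fromColumns (a , d , g) (b , e , h) = mk
  a b (conjugate (d ⊙ h ⊖ e ⊙ g))
  d e (conjugate (g ⊙ b ⊖ h ⊙ a))
  g h (conjugate (a ⊙ e ⊖ b ⊙ d))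

unit? : ∀ u → Dec (hermitian u u ≡ k1)
unit? u = hermitian u u ≟ᴷ k1

orthogonal? : ∀ u v → Dec (hermitian u v ≡ k0)
orthogonal? u v = hermitian u v ≟ᴷ k0

framesIn : List Column → List M
framesIn us = concatMap (λ u → map (fromColumns u) (filter (orthogonal? u) us)) us

-- The first column tells the blocks apart, the second the members of one block.
framesIn-unique : ∀ {us} → Unique us → Unique (framesIn us)
framesIn-unique us-unique = Unique-concatMap _ column₀
  (λ u → Unique.map⁺ {f = fromColumns u} (cong column₁) (Unique.filter⁺ (orthogonal? u) us-unique))
  (λ u b∈ → let _ , _ , eq = ∈-map⁻ (fromColumns u) b∈ in trans (cong column₀ eq) refl)
  us-unique
  where
  column₀ column₁ : M → Column
  column₀ (mk a b c d e f g h i) = a , d , g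
  column₁ (mk a b c d e f g h i) = b , e , h

∈-framesIn : ∀ {us} u v → u ∈ˡ us → v ∈ˡ us → hermitian u v ≡ k0 → fromColumns u v ∈ˡ framesIn us
∈-framesIn {us} u v u∈ v∈ u⟂v =
  ∈-concatMap⁺ (λ u → map (fromColumns u) (filter (orthogonal? u) us))
    (lose u∈ (∈-map⁺ (fromColumns u) (∈-filter⁺ (orthogonal? u) v∈ u⟂v)))

-- The first two columns are unit vectors and orthogonal by m† m = 1. The third is forced because m†
-- is the adjugate, whose last row consists of the 2×2 minors of the first two columns.
unitary-columns : ∀ us → (∀ u → hermitian u u ≡ k1 → u ∈ˡ us) → ∀ m → Unitary m → m ∈ˡ framesIn us
unitary-columns us unit∈ m@(mk a b c d e f g h i) um@(m†m≡1 , _) = subst (_∈ˡ framesIn us) third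
  (∈-framesIn (a , d , g) (b , e , h)
    (unit∈ _ (cong (λ n → entry n 0F 0F) m†m≡1))
    (unit∈ _ (cong (λ n → entry n 1F 1F) m†m≡1))
    (cong (λ n → entry n 0F 1F) m†m≡1))
  where
  A = toSU m um
  minor : ∀ x y z w → fromF₉ (toF₉ x * toF₉ y + - (toF₉ z * toF₉ w)) ≡ x ⊙ y ⊖ z ⊙ w
  minor x y z w = trans (fromF₉-minor (toF₉ x) (toF₉ y) (toF₉ z) (toF₉ w))
    (cong₂ _⊖_ (cong₂ _⊙_ (fromF₉-toF₉ x) (fromF₉-toF₉ y)) (cong₂ _⊙_ (fromF₉-toF₉ z) (fromF₉-toF₉ w)))
  adj≡† : fromMatrix (adj (toMatrix m)) ≡ m †
  adj≡† = trans (fromSU-inv A) (cong _† (fromSU-toSU m um))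
  flip-conjugate : ∀ {x y} → x ≡ conjugate y → conjugate x ≡ y
  flip-conjugate p = trans (cong conjugate p) (conjugate-involutive _)
  third : fromColumns (a , d , g) (b , e , h) ≡ m
  third = mk-cong refl refl
    (flip-conjugate (trans (sym (minor d h e g)) (cong (λ n → entry n 2F 0F) adj≡†)))
    refl refl
    (flip-conjugate (trans (sym (minor g b h a)) (cong (λ n → entry n 2F 1F) adj≡†)))
    refl refl
    (flip-conjugate (trans (sym (minor a e b d)) (cong (λ n → entry n 2F 2F) adj≡†)))

opaque
  -- List, uniqueness and completeness form one opaque package. `enumerate` takes the unit columns
  -- as an argument so that the filter over all 729 columns is evaluated once.
  enumeration : Σ[ ms ∈ List M ] Unique ms × (∀ m → Unitary m → m ∈ˡ ms)
  enumeration =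
    enumerate (filter unit? columns)
      (Unique.filter⁺ unit? {xs = columns} columns-unique)
      (λ u → ∈-filter⁺ unit? {xs = columns} (∈-columns u))
    where
    enumerate : ∀ us → Unique us → (∀ u → hermitian u u ≡ k1 → u ∈ˡ us) →
                Σ[ ms ∈ List M ] Unique ms × (∀ m → Unitary m → m ∈ˡ ms)
    enumerate us us-unique unit∈ = framesIn us , framesIn-unique us-unique , unitary-columns us unit∈

frames : List M
frames = proj₁ enumeration

frames-unique : Unique frames
frames-unique = proj₁ (proj₂ enumeration)

∈-frames : ∀ m → Unitary m → m ∈ˡ frames
∈-frames = proj₂ (proj₂ enumeration)

opaque
  unfolding enumeration

  -- `framesIn` constrains two columns only; that each completed matrix is unitary of determinant 1
  -- is found by evaluation.
  frames-unitary : All Unitary frames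
  frames-unitary = toWitness {a? = every? unitary? frames} _

-- `code` is an injective homomorphism into `X` with image `elements`. `IsElement` is a decidable
-- criterion from which `decode` builds a group element directly, without searching the list.
record Coding (G : Group 0ℓ 0ℓ) : Set₁ where
  open Group G
  field
    elements        : List X
    elements-unique : Unique elements
    code            : Carrier → X
    code-cong       : ∀ {x y} → x ≈ y → code x ≡ code y
    code-injective  : ∀ {x y} → code x ≡ code y → x ≈ y
    code-∙          : ∀ x y → code (x ∙ y) ≡ code x · code y
    code-ε          : code ε ≡ one
    code-⁻¹         : ∀ x → code (x ⁻¹) ≡ invˣ (code x)
    code∈           : ∀ x → code x ∈ˡ elements
    IsElement       : Pred X 0ℓ
    isElement?      : ∀ x → Dec (IsElement x)
    elements-valid  : All IsElement elements
    decode          : ∀ {x} → IsElement x → ∃[ A ] code A ≡ x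

lin-injective : ∀ {a b} → lin a ≡ lin b → a ≡ b
lin-injective refl = refl

IsLinear : Pred X 0ℓ
IsLinear (lin m)  = Unitary m
IsLinear (semi m) = ⊥

Γ-coding : Coding Γ
Γ-coding = record
  { elements = map lin frames
  ; elements-unique = Unique.map⁺ lin-injective frames-unique
  ; code = λ A → lin (fromSU A)
  ; code-cong = λ p → cong lin (fromMatrix-cong p)
  ; code-injective = λ p → fromMatrix-injective (lin-injective p)
  ; code-∙ = λ A B → cong lin (fromMatrix-* (mat A) (mat B))
  ; code-ε = refl
  ; code-⁻¹ = λ A → cong lin (fromSU-inv A)
  ; code∈ = λ A → ∈-map⁺ lin (∈-frames (fromSU A) (fromSU-unitary A))
  ; IsElement = IsLinear
  ; isElement? = λ { (lin m) → unitary? m ; (semi m) → no λ () }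
  ; elements-valid = All.map⁺ frames-unitary
  ; decode = λ { {lin m} u → toSU m u , cong lin (fromSU-toSU m u) }
  }

-- Sizes of setoids and their ratios.

module _ {a ℓ} {S : Setoid a ℓ} where
  private module S = Setoid S

  fromSize : ∀ {m} → S HasSize m → S.Carrier → Fin m
  fromSize = Inverse.from

  fromSize-injective : ∀ {m} (s : S HasSize m) {x y} → fromSize s x ≡ fromSize s y → x S.≈ y
  fromSize-injective s {x} {y} eq = S.trans (S.sym (Inverse.strictlyInverseˡ s x))
    (S.trans (Inverse.to-cong s eq) (Inverse.strictlyInverseˡ s y))

  toSize-injective : ∀ {m} (s : S HasSize m) {i j} → Inverse.to s i S.≈ Inverse.to s j → i ≡ j
  toSize-injective s {i} {j} eq = trans (sym (Inverse.strictlyInverseʳ s i))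
    (trans (Inverse.from-cong s eq) (Inverse.strictlyInverseʳ s j))

HasSize-unique : ∀ {a ℓ} {S : Setoid a ℓ} {m n} → S HasSize m → S HasSize n → m ≡ n
HasSize-unique s s′ = ℕ.≤-antisym
  (Fin.injective⇒≤ {f = λ i → fromSize s′ (Inverse.to s i)} (toSize-injective s ∘ fromSize-injective s′))
  (Fin.injective⇒≤ {f = λ i → fromSize s (Inverse.to s′ i)} (toSize-injective s′ ∘ fromSize-injective s))

HasSize-resp : ∀ {a ℓ b ℓ′} {S : Setoid a ℓ} {S′ : Setoid b ℓ′} {n} → Inverse S S′ → S HasSize n → S′ HasSize n
HasSize-resp i s = Composition.inverse s i

lookup-injective : ∀ {A : Set} {xs : List A} → Unique xs → ∀ {i j} → lookup xs i ≡ lookup xs j → i ≡ j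
lookup-injective (_ ∷ _)         {Fin.zero}  {Fin.zero}  _  = refl
lookup-injective (x∉ ∷ _)        {Fin.zero}  {Fin.suc j} eq = contradiction eq (All.lookup x∉ (∈-lookup j))
lookup-injective (x∉ ∷ _)        {Fin.suc i} {Fin.zero}  eq = contradiction (sym eq) (All.lookup x∉ (∈-lookup i))
lookup-injective (_ ∷ xs-unique) {Fin.suc i} {Fin.suc j} eq = cong Fin.suc (lookup-injective xs-unique eq)

list-HasSize : ∀ {a ℓ} {S : Setoid a ℓ} {Y : Set} (f : Setoid.Carrier S → Y) →
  (∀ {x y} → Setoid._≈_ S x y → f x ≡ f y) →
  (∀ {x y} → f x ≡ f y → Setoid._≈_ S x y) →
  {ys : List Y} → Unique ys → (∀ x → f x ∈ˡ ys) → (∀ {y} → y ∈ˡ ys → ∃[ x ] f x ≡ y) →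
  S HasSize length ys
list-HasSize {S = S} f f-cong f-injective {ys} ys-unique f∈ f⁻ = record
  { to        = to
  ; from      = λ x → Any.index (f∈ x)
  ; to-cong   = λ { refl → S.refl }
  ; from-cong = λ x≈y → lookup-injective ys-unique
      (trans (sym (lookup-f∈ _)) (trans (f-cong x≈y) (lookup-f∈ _)))
  ; inverse   = (λ { refl → f-injective (trans (f-to _) (sym (lookup-f∈ _))) }) ,
      λ {i} {x} x≈ → lookup-injective ys-unique
        (trans (sym (lookup-f∈ _)) (trans (f-cong x≈) (f-to i)))
  }
  where
  module S = Setoid S
  to : Fin (length ys) → S.Carrier
  to i = proj₁ (f⁻ (∈-lookup i))
  f-to : ∀ i → f (to i) ≡ lookup ys i
  f-to i = proj₂ (f⁻ (∈-lookup i))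
  lookup-f∈ : ∀ x → f x ≡ lookup ys (Any.index (f∈ x))
  lookup-f∈ x = lookup-index (f∈ x)

length-≤-size : ∀ {a ℓ} {S : Setoid a ℓ} {m} {Y : Set} {ys : List Y} → S HasSize m → Unique ys →
  (f : ∀ {y} → y ∈ˡ ys → Setoid.Carrier S) →
  (∀ {y y′} (p : y ∈ˡ ys) (q : y′ ∈ˡ ys) → Setoid._≈_ S (f p) (f q) → y ≡ y′) →
  length ys ℕ.≤ m
length-≤-size s ys-unique f f-injective =
  Fin.injective⇒≤ {f = λ i → fromSize s (f (∈-lookup i))} λ eq →
    lookup-injective ys-unique (f-injective _ _ (fromSize-injective s eq))

-- Meant for free group actions: each orbit in S is a copy of the group T.
copies-≤-size : ∀ {a ℓ b ℓ′} {S : Setoid a ℓ} {T : Setoid b ℓ′} {m n} → S HasSize m → T HasSize n → ∀ k →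
  (f : Fin k → Setoid.Carrier T → Setoid.Carrier S) →
  (∀ {i j x y} → Setoid._≈_ S (f i x) (f j y) → i ≡ j × Setoid._≈_ T x y) →
  k ℕ.* n ℕ.≤ m
copies-≤-size {n = n} s t k f f-injective =
  Fin.injective⇒≤ {f = λ p → fromSize s (g (Fin.remQuot n p))} λ {p} {q} eq →
    let i≡j , x≈y = f-injective (fromSize-injective s eq)
    in trans (sym (Fin.combine-remQuot {k} n p))
      (trans (cong₂ Fin.combine i≡j (toSize-injective t x≈y)) (Fin.combine-remQuot {k} n q))
  where
  g : Fin k × Fin n → _
  g (i , j) = f i (Inverse.to t j)

module _ {a ℓ} (S : Setoid a ℓ) where
  open Setoid S using (Carrier; _≈_)

  subset-inverse : ∀ {p q} {P : Pred Carrier p} {Q : Pred Carrier q} (f f⁻ : Carrier → Carrier) →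
    (∀ {x y} → x ≈ y → f x ≈ f y) → (∀ {x y} → x ≈ y → f⁻ x ≈ f⁻ y) →
    (∀ {x} → P x → Q (f x)) → (∀ {x} → Q x → P (f⁻ x)) →
    (∀ x → f (f⁻ x) ≈ x) → (∀ x → f⁻ (f x) ≈ x) → Inverse (subset S P) (subset S Q)
  subset-inverse f f⁻ f-cong f⁻-cong P⇒Q Q⇒P ff⁻ f⁻f = record
    { to = λ (x , px) → f x , P⇒Q px
    ; from = λ (x , qx) → f⁻ x , Q⇒P qx
    ; to-cong = f-cong
    ; from-cong = f⁻-cong
    ; inverse = (λ eq → Setoid.trans S (f-cong eq) (ff⁻ _)) , λ eq → Setoid.trans S (f⁻-cong eq) (f⁻f _)
    }

SizeRatio-resp : ∀ {S S′ T : Setoid 0ℓ 0ℓ} {q} → Inverse S S′ → SizeRatio S T q → SizeRatio S′ T q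
SizeRatio-resp {S} {S′} i (m , n , n≢0 , s , t , eq) = m , n , n≢0 , HasSize-resp {S = S} {S′ = S′} i s , t , eq

-- The ratio equates the sizes of one pair of enumerations; as sizes are unique, it equates those of
-- any other pair.
SizeRatio-1 : ∀ {S T : Setoid 0ℓ 0ℓ} {m n} → S HasSize m → T HasSize n → SizeRatio S T 1ℚ → m ≡ n
SizeRatio-1 {S} {T} s t (m , suc n , _ , s′ , t′ , eq) =
  trans (HasSize-unique {S = S} s s′) (trans (ℤ.+-injective m≡n) (HasSize-unique {S = T} t′ t))
  where
  m≡n : ℤ.+ m ≡ ℤ.+ suc n
  m≡n with ℚ./-injective-≃ (mkℚᵘ (ℤ.+ m) n) (mkℚᵘ (ℤ.+ 1) 0) (sym eq)
  ... | *≡* p = trans (sym (ℤ.*-identityʳ (ℤ.+ m))) (trans p (ℤ.*-identityˡ (ℤ.+ suc n)))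

SizeRatio-≡1 : ∀ {S T : Setoid 0ℓ 0ℓ} {n} → S HasSize n → T HasSize n → ℕ.NonZero n → SizeRatio S T 1ℚ
SizeRatio-≡1 {n = suc n} s t n≢0 = suc n , suc n , n≢0 , s , t ,
  trans (sym (ℚ.fromℚᵘ-toℚᵘ 1ℚ)) (ℚ.fromℚᵘ-cong {mkℚᵘ (ℤ.+ 1) 0} {mkℚᵘ (ℤ.+ suc n) n}
    (*≡* (trans (ℤ.*-identityˡ (ℤ.+ suc n)) (sym (ℤ.*-identityʳ (ℤ.+ suc n))))))

-- `m / n` is reduced to lowest terms, which hides m and n. The comparison therefore moves to
-- unnormalised fractions, where it is a cross multiplication.
SizeRatio-<4 : ∀ {S T : Setoid 0ℓ 0ℓ} {q} → SizeRatio S T q → q ℚ.< ℤ.+ 4 / 1 →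
  ∃₂ λ m n → S HasSize m × T HasSize n × m ℕ.< 4 ℕ.* n
SizeRatio-<4 (m , suc n , _ , s , t , refl) q<4
  with ℚᵘ.<-respˡ-≃ (ℚ.toℚᵘ-fromℚᵘ (mkℚᵘ (ℤ.+ m) n)) (ℚ.toℚᵘ-mono-< q<4)
... | *<* p = m , suc n , s , t , ℤ.drop‿+<+ (subst (ℤ._< _) (ℤ.*-identityʳ (ℤ.+ m)) p)

-- Quadruples: conjugation, braid moves and rotation.

quad : ∀ {a} {A : Set a} → A → A → A → A → Vector A 4
quad a b c d = a Vector.∷ b Vector.∷ c Vector.∷ d Vector.∷ Vector.[]

four : {P : Fin 4 → Set} → P 0F → P 1F → P 2F → P 3F → ∀ i → P i
four a b c d 0F = a
four a b c d 1F = b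
four a b c d 2F = c
four a b c d 3F = d

module Tuples (G : Group 0ℓ 0ℓ) where
  open Group G hiding (refl; sym; trans)
  private module G = Group G
  open GroupProperties G using (\\-leftDividesˡ; \\-leftDividesʳ; //-rightDividesˡ; //-rightDividesʳ; ⁻¹-anti-homo-∙; ⁻¹-involutive)
  open RawMonoidSum rawMonoid using () renaming (sum to product)
  open VectorEquality setoid using (_≋_; ≋-setoid)
  open SetoidReasoning setoid

  Tuple : Set
  Tuple = Vector Carrier 4

  Classes : Set₁
  Classes = Vector (Pred Carrier 0ℓ) 4

  infixr 8 _▷_
  _▷_ : Carrier → Carrier → Carrier
  k ▷ x = k ∙ x ∙ k ⁻¹

  ▷-cong : ∀ {k l x y} → k ≈ l → x ≈ y → k ▷ x ≈ l ▷ y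
  ▷-cong p q = ∙-cong (∙-cong p q) (⁻¹-cong p)

  ▷-∙ : ∀ k x → (k ▷ x) ∙ k ≈ k ∙ x
  ▷-∙ k x = //-rightDividesˡ k (k ∙ x)

  ≈▷⇒∙ : ∀ {k x y} → y ≈ k ▷ x → y ∙ k ≈ k ∙ x
  ≈▷⇒∙ y≈ = G.trans (∙-congʳ y≈) (▷-∙ _ _)

  ▷-homo : ∀ k x y → k ▷ (x ∙ y) ≈ (k ▷ x) ∙ (k ▷ y)
  ▷-homo k x y = begin
    k ∙ (x ∙ y) ∙ k ⁻¹  ≈⟨ ∙-congʳ (G.sym (assoc k x y)) ⟩
    k ∙ x ∙ y ∙ k ⁻¹  ≈⟨ ∙-congʳ (∙-congʳ (▷-∙ k x)) ⟨
    (k ▷ x) ∙ k ∙ y ∙ k ⁻¹  ≈⟨ ∙-congʳ (assoc (k ▷ x) k y) ⟩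
    (k ▷ x) ∙ (k ∙ y) ∙ k ⁻¹  ≈⟨ assoc (k ▷ x) (k ∙ y) (k ⁻¹) ⟩
    (k ▷ x) ∙ (k ▷ y)  ∎

  ▷-▷ : ∀ k l x → k ▷ (l ▷ x) ≈ (k ∙ l) ▷ x
  ▷-▷ k l x = begin
    k ∙ (l ∙ x ∙ l ⁻¹) ∙ k ⁻¹  ≈⟨ ∙-congʳ (assoc k (l ∙ x) (l ⁻¹)) ⟨
    k ∙ (l ∙ x) ∙ l ⁻¹ ∙ k ⁻¹  ≈⟨ assoc (k ∙ (l ∙ x)) (l ⁻¹) (k ⁻¹) ⟩
    k ∙ (l ∙ x) ∙ (l ⁻¹ ∙ k ⁻¹)  ≈⟨ ∙-cong (assoc k l x) (⁻¹-anti-homo-∙ k l) ⟨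
    (k ∙ l) ∙ x ∙ (k ∙ l) ⁻¹  ∎

  ▷-ε : ∀ k → k ▷ ε ≈ ε
  ▷-ε k = G.trans (∙-congʳ (identityʳ k)) (inverseʳ k)

  ε-▷ : ∀ x → ε ▷ x ≈ x
  ε-▷ x = G.trans (∙-congʳ (identityˡ x)) (//-rightDividesʳ′ x)
    where
    //-rightDividesʳ′ : ∀ x → x ∙ ε ⁻¹ ≈ x
    //-rightDividesʳ′ x = G.trans (∙-congʳ (G.sym (identityʳ x))) (//-rightDividesʳ ε x)

  ⁻¹▷▷ : ∀ k x → (k ⁻¹) ▷ (k ▷ x) ≈ x
  ⁻¹▷▷ k x = G.trans (▷-▷ (k ⁻¹) k x) (G.trans (▷-cong (inverseˡ k) G.refl) (ε-▷ x))

  ▷⁻¹▷ : ∀ k x → k ▷ ((k ⁻¹) ▷ x) ≈ x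
  ▷⁻¹▷ k x = G.trans (▷-▷ k (k ⁻¹) x) (G.trans (▷-cong (inverseʳ k) G.refl) (ε-▷ x))

  ∙-⁻¹▷ : ∀ b a → b ∙ ((b ⁻¹) ▷ a) ≈ a ∙ b
  ∙-⁻¹▷ b a = begin
    b ∙ ((b ⁻¹) ▷ a)  ≈⟨ ▷-∙ b _ ⟨
    (b ▷ ((b ⁻¹) ▷ a)) ∙ b  ≈⟨ ∙-congʳ (▷⁻¹▷ b a) ⟩
    a ∙ b  ∎

  ▷-⁻¹ : ∀ k x → k ▷ (x ⁻¹) ≈ (k ▷ x) ⁻¹
  ▷-⁻¹ k x = GroupProperties.inverseˡ-unique G (k ▷ (x ⁻¹)) (k ▷ x)
    (G.trans (G.sym (▷-homo k (x ⁻¹) x)) (G.trans (▷-cong G.refl (inverseˡ x)) (▷-ε k)))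

  Generates : ∀ {z} → Vector Carrier z → Set
  Generates g = ∀ x → x ∈ Generated G g

  Generated-⊆ : ∀ {z z′} {g : Vector Carrier z} {h : Vector Carrier z′} →
    (∀ i → g i ∈ Generated G h) → ∀ {x} → x ∈ Generated G g → x ∈ Generated G h
  Generated-⊆ p (gen i)    = p i
  Generated-⊆ p unit       = unit
  Generated-⊆ p (mul x y)  = mul (Generated-⊆ p x) (Generated-⊆ p y)
  Generated-⊆ p (inv x)    = inv (Generated-⊆ p x)
  Generated-⊆ p (resp e x) = resp e (Generated-⊆ p x)

  record IsInvariant (P : Pred Carrier 0ℓ) : Set where
    field
      respects : ∀ {x y} → x ≈ y → P x → P y
      closed   : ∀ k {x} → P x → P (k ▷ x)

  open IsInvariant public

  Tuple-setoid : Setoid 0ℓ 0ℓ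
  Tuple-setoid = ≋-setoid 4

  infixr 8 _▶_
  _▶_ : Carrier → Tuple → Tuple
  (k ▶ g) i = k ▷ g i

  product-▶ : ∀ k g → product (k ▶ g) ≈ k ▷ product g
  product-▶ k g = G.sym (begin
    k ▷ product g  ≈⟨ ▷-homo k _ _ ⟩
    _  ≈⟨ ∙-congˡ (▷-homo k _ _) ⟩
    _  ≈⟨ ∙-congˡ (∙-congˡ (▷-homo k _ _)) ⟩
    _  ≈⟨ ∙-congˡ (∙-congˡ (∙-congˡ (▷-homo k _ _))) ⟩
    _  ≈⟨ ∙-congˡ (∙-congˡ (∙-congˡ (∙-congˡ (▷-ε k)))) ⟩
    product (k ▶ g) ∎)

  ▶-InΣ̄ : ∀ {C} → (∀ i → IsInvariant (C i)) → ∀ k {g} → InΣ̄ G C g → InΣ̄ G C (k ▶ g)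
  ▶-InΣ̄ C-inv k {g} (g∈C , Πg≈ε) = (λ i → closed (C-inv i) k (g∈C i)) ,
    G.trans (product-▶ k g) (G.trans (▷-cong G.refl Πg≈ε) (▷-ε k))

  ▶-Generates : ∀ k {g} → Generates g → Generates (k ▶ g)
  ▶-Generates k {g} gg x = resp (▷⁻¹▷ k x) (go (gg ((k ⁻¹) ▷ x)))
    where
    go : ∀ {y} → y ∈ Generated G g → (k ▷ y) ∈ Generated G (k ▶ g)
    go (gen i)    = gen i
    go unit       = resp (G.sym (▷-ε k)) unit
    go (mul p q)  = resp (G.sym (▷-homo k _ _)) (mul (go p) (go q))
    go (inv p)    = resp (G.sym (▷-⁻¹ k _)) (inv (go p))
    go (resp e p) = resp (▷-cong G.refl e) (go p)

  ▶-InΣ : ∀ {C} → (∀ i → IsInvariant (C i)) → ∀ k {g} → InΣ G C g → InΣ G C (k ▶ g)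
  ▶-InΣ C-inv k (g∈ , gg) = ▶-InΣ̄ C-inv k g∈ , ▶-Generates k gg

  centralizes-Generated : ∀ {z} {g : Vector Carrier z} k → (∀ i → k ▷ g i ≈ g i) → ∀ {x} → x ∈ Generated G g → k ▷ x ≈ x
  centralizes-Generated k p (gen i)    = p i
  centralizes-Generated k p unit       = ▷-ε k
  centralizes-Generated k p (mul x y)  = G.trans (▷-homo k _ _)
    (∙-cong (centralizes-Generated k p x) (centralizes-Generated k p y))
  centralizes-Generated k p (inv x)    = G.trans (▷-⁻¹ k _) (⁻¹-cong (centralizes-Generated k p x))
  centralizes-Generated k p (resp e x) = G.trans (▷-cong G.refl (G.sym e)) (G.trans (centralizes-Generated k p x) e)

  μ̄-resp : ∀ {C D q} → Inverse (subset Tuple-setoid (InΣ̄ G C)) (subset Tuple-setoid (InΣ̄ G D)) →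
           (μ̄[_]≐_ G C q) → (μ̄[_]≐_ G D q)
  μ̄-resp {C} {D} = SizeRatio-resp {subset Tuple-setoid (InΣ̄ G C)} {subset Tuple-setoid (InΣ̄ G D)} {setoid}

  record _≃_ (C D : Classes) : Set where
    field
      Σ̄-inverse : Inverse (subset Tuple-setoid (InΣ̄ G C)) (subset Tuple-setoid (InΣ̄ G D))
      Σ-inverse : Inverse (subset Tuple-setoid (InΣ G C)) (subset Tuple-setoid (InΣ G D))

    μ̄-resp′ : ∀ {q} → (μ̄[_]≐_ G C q) → (μ̄[_]≐_ G D q)
    μ̄-resp′ = μ̄-resp {C} {D} Σ̄-inverse

    rigid-resp : Rigid G C → Rigid G D
    rigid-resp = SizeRatio-resp {subset Tuple-setoid (InΣ G C)} {subset Tuple-setoid (InΣ G D)} {setoid} Σ-inverse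

    μ̄<4-resp : μ̄<4 G C → μ̄<4 G D
    μ̄<4-resp (q , r , q<4) = q , μ̄-resp′ r , q<4

  open _≃_ public

  -- The last two hypotheses say that each map is given by words in the entries; since the maps are
  -- mutually inverse, a tuple and its image generate the same subgroup.
  rearrange : ∀ {C D} (f f⁻ : Tuple → Tuple) →
    (∀ {g h} → g ≋ h → f g ≋ f h) → (∀ {g h} → g ≋ h → f⁻ g ≋ f⁻ h) →
    (∀ {g} → InΣ̄ G C g → InΣ̄ G D (f g)) → (∀ {g} → InΣ̄ G D g → InΣ̄ G C (f⁻ g)) →
    (∀ g → f (f⁻ g) ≋ g) → (∀ g → f⁻ (f g) ≋ g) →
    (∀ g i → f g i ∈ Generated G g) → (∀ g i → f⁻ g i ∈ Generated G g) → C ≃ D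
  rearrange f f⁻ f-cong f⁻-cong f-Σ̄ f⁻-Σ̄ ff⁻ f⁻f f-gen f⁻-gen = record
    { Σ̄-inverse = subset-inverse Tuple-setoid f f⁻ f-cong f⁻-cong f-Σ̄ f⁻-Σ̄ ff⁻ f⁻f
    ; Σ-inverse = subset-inverse Tuple-setoid f f⁻ f-cong f⁻-cong
        (λ (g∈ , gg) → f-Σ̄ g∈ , generates f f⁻ f⁻f f⁻-gen gg)
        (λ (g∈ , gg) → f⁻-Σ̄ g∈ , generates f⁻ f ff⁻ f-gen gg)
        ff⁻ f⁻f
    }
    where
    -- g is recovered from f g, so f g generates whatever g generates.
    generates : ∀ (f f⁻ : Tuple → Tuple) → (∀ g → f⁻ (f g) ≋ g) → (∀ g i → f⁻ g i ∈ Generated G g) →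
                ∀ {g} → Generates g → Generates (f g)
    generates f f⁻ f⁻f f⁻-gen {g} gg x = Generated-⊆ (λ i → resp (f⁻f g i) (f⁻-gen (f g) i)) (gg x)

  ≐⇒≃ : ∀ {C D : Classes} → (∀ i → C i ≐ D i) → C ≃ D
  ≐⇒≃ C≐D = record
    { Σ̄-inverse = subset-inverse Tuple-setoid id id id id
        (λ (g∈ , p) → (λ i → proj₁ (C≐D i) (g∈ i)) , p) (λ (g∈ , p) → (λ i → proj₂ (C≐D i) (g∈ i)) , p)
        (λ _ _ → G.refl) (λ _ _ → G.refl)
    ; Σ-inverse = subset-inverse Tuple-setoid id id id id
        (λ ((g∈ , p) , gg) → ((λ i → proj₁ (C≐D i) (g∈ i)) , p) , gg)
        (λ ((g∈ , p) , gg) → ((λ i → proj₂ (C≐D i) (g∈ i)) , p) , gg)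
        (λ _ _ → G.refl) (λ _ _ → G.refl)
    }

  -- The braid move (x, y) ↦ (y, y⁻¹ x y) keeps the product, and conjugation invariance keeps y⁻¹ x
  -- y in the class of x.
  swap : ∀ {a b c d} → IsInvariant a → IsInvariant b → quad a b c d ≃ quad b a c d
  swap {a} {b} {c} {d} a-inv b-inv = rearrange f f⁻
    (λ p → four (p 1F) (▷-cong (⁻¹-cong (p 1F)) (p 0F)) (p 2F) (p 3F))
    (λ p → four (▷-cong (p 0F) (p 1F)) (p 0F) (p 2F) (p 3F))
    (λ {g} (g∈ , Πg≈ε) →
      four (g∈ 1F) (closed a-inv _ (g∈ 0F)) (g∈ 2F) (g∈ 3F) , G.trans (product-f g) Πg≈ε)
    (λ {g} (g∈ , Πg≈ε) →
      four (closed a-inv _ (g∈ 1F)) (g∈ 0F) (g∈ 2F) (g∈ 3F) , G.trans (product-f⁻ g) Πg≈ε)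
    (λ g → four G.refl (⁻¹▷▷ (g 0F) (g 1F)) G.refl G.refl)
    (λ g → four (▷⁻¹▷ (g 1F) (g 0F)) G.refl G.refl G.refl)
    (λ g → four (gen 1F) (mul (mul (inv (gen 1F)) (gen 0F)) (inv (inv (gen 1F)))) (gen 2F) (gen 3F))
    (λ g → four (mul (mul (gen 0F) (gen 1F)) (inv (gen 0F))) (gen 0F) (gen 2F) (gen 3F))
    where
    f f⁻ : Tuple → Tuple
    f  g = quad (g 1F) ((g 1F ⁻¹) ▷ g 0F) (g 2F) (g 3F)
    f⁻ g = quad (g 0F ▷ g 1F) (g 0F) (g 2F) (g 3F)
    product-f : ∀ g → product (f g) ≈ product g
    product-f g = G.trans (G.sym (assoc _ _ _)) (G.trans (∙-congʳ (∙-⁻¹▷ (g 1F) (g 0F))) (assoc _ _ _))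
    product-f⁻ : ∀ g → product (f⁻ g) ≈ product g
    product-f⁻ g = G.trans (G.sym (assoc _ _ _)) (G.trans (∙-congʳ (▷-∙ (g 0F) (g 1F))) (assoc _ _ _))

  -- A rotated product is conjugate to the original one, so it stays equal to 1.
  rotate : ∀ {a b c d} → quad a b c d ≃ quad b c d a
  rotate {a} {b} {c} {d} = rearrange f f⁻
    (λ p → four (p 1F) (p 2F) (p 3F) (p 0F))
    (λ p → four (p 3F) (p 0F) (p 1F) (p 2F))
    (λ {g} (g∈ , Πg≈ε) → four (g∈ 1F) (g∈ 2F) (g∈ 3F) (g∈ 0F) , product-f g Πg≈ε)
    (λ {g} (g∈ , Πg≈ε) → four (g∈ 3F) (g∈ 0F) (g∈ 1F) (g∈ 2F) , product-f⁻ g Πg≈ε)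
    (λ g → four G.refl G.refl G.refl G.refl)
    (λ g → four G.refl G.refl G.refl G.refl)
    (λ g → four (gen 1F) (gen 2F) (gen 3F) (gen 0F))
    (λ g → four (gen 3F) (gen 0F) (gen 1F) (gen 2F))
    where
    f f⁻ : Tuple → Tuple
    f  g = quad (g 1F) (g 2F) (g 3F) (g 0F)
    f⁻ g = quad (g 3F) (g 0F) (g 1F) (g 2F)
    commute : ∀ x y → x ∙ y ≈ ε → y ∙ x ≈ ε
    commute x y xy≈ε = G.trans (∙-congˡ (GroupProperties.inverseˡ-unique G x y xy≈ε)) (inverseʳ y)
    last : ∀ x y z w → x ∙ (y ∙ (z ∙ (w ∙ ε))) ≈ x ∙ (y ∙ z) ∙ w
    last x y z w = begin
      x ∙ (y ∙ (z ∙ (w ∙ ε)))  ≈⟨ ∙-congˡ (∙-congˡ (∙-congˡ (identityʳ w))) ⟩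
      x ∙ (y ∙ (z ∙ w))  ≈⟨ ∙-congˡ (assoc y z w) ⟨
      x ∙ ((y ∙ z) ∙ w)  ≈⟨ assoc x (y ∙ z) w ⟨
      x ∙ (y ∙ z) ∙ w  ∎
    first : ∀ x y z w → w ∙ (x ∙ (y ∙ (z ∙ ε))) ≈ w ∙ (x ∙ (y ∙ z))
    first x y z w = ∙-congˡ (∙-congˡ (∙-congˡ (identityʳ z)))
    product-f : ∀ g → product g ≈ ε → product (f g) ≈ ε
    product-f g p = begin
      product (f g)  ≈⟨ last (g 1F) (g 2F) (g 3F) (g 0F) ⟩
      g 1F ∙ (g 2F ∙ g 3F) ∙ g 0F  ≈⟨ commute (g 0F) _ (G.trans (G.sym (first (g 1F) (g 2F) (g 3F) (g 0F))) p) ⟩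
      ε  ∎
    product-f⁻ : ∀ g → product g ≈ ε → product (f⁻ g) ≈ ε
    product-f⁻ g p = begin
      product (f⁻ g)  ≈⟨ first (g 0F) (g 1F) (g 2F) (g 3F) ⟩
      g 3F ∙ (g 0F ∙ (g 1F ∙ g 2F))  ≈⟨ commute _ (g 3F) (G.trans (G.sym (last (g 0F) (g 1F) (g 2F) (g 3F))) p) ⟩
      ε  ∎

-- Search tables: tries keyed by matrix entries.

Entry : Set
Entry = ℕ × X

data Tree : Set where
  leaf : Tree
  tip  : Entry → Tree
  node : (t0 t1 t2 t3 t4 t5 t6 t7 t8 : Tree) → Tree

-- Two columns determine an element.
key : X → List K
key (lin  (mk a b _ d e _ g h _)) = k0 ∷ a ∷ b ∷ d ∷ e ∷ g ∷ h ∷ []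
key (semi (mk a b _ d e _ g h _)) = k1 ∷ a ∷ b ∷ d ∷ e ∷ g ∷ h ∷ []

child : K → Tree → Tree
child k0 (node t _ _ _ _ _ _ _ _) = t
child k1 (node _ t _ _ _ _ _ _ _) = t
child k2 (node _ _ t _ _ _ _ _ _) = t
child k3 (node _ _ _ t _ _ _ _ _) = t
child k4 (node _ _ _ _ t _ _ _ _) = t
child k5 (node _ _ _ _ _ t _ _ _) = t
child k6 (node _ _ _ _ _ _ t _ _) = t
child k7 (node _ _ _ _ _ _ _ t _) = t
child k8 (node _ _ _ _ _ _ _ _ t) = t
child _  _ = leaf

setChild : K → Tree → Tree → Tree
setChild k0 t (node _ t1 t2 t3 t4 t5 t6 t7 t8) = node t t1 t2 t3 t4 t5 t6 t7 t8
setChild k1 t (node t0 _ t2 t3 t4 t5 t6 t7 t8) = node t0 t t2 t3 t4 t5 t6 t7 t8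
setChild k2 t (node t0 t1 _ t3 t4 t5 t6 t7 t8) = node t0 t1 t t3 t4 t5 t6 t7 t8
setChild k3 t (node t0 t1 t2 _ t4 t5 t6 t7 t8) = node t0 t1 t2 t t4 t5 t6 t7 t8
setChild k4 t (node t0 t1 t2 t3 _ t5 t6 t7 t8) = node t0 t1 t2 t3 t t5 t6 t7 t8
setChild k5 t (node t0 t1 t2 t3 t4 _ t6 t7 t8) = node t0 t1 t2 t3 t4 t t6 t7 t8
setChild k6 t (node t0 t1 t2 t3 t4 t5 _ t7 t8) = node t0 t1 t2 t3 t4 t5 t t7 t8
setChild k7 t (node t0 t1 t2 t3 t4 t5 t6 _ t8) = node t0 t1 t2 t3 t4 t5 t6 t t8
setChild k8 t (node t0 t1 t2 t3 t4 t5 t6 t7 _) = node t0 t1 t2 t3 t4 t5 t6 t7 t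
setChild k0 t _ = node t leaf leaf leaf leaf leaf leaf leaf leaf
setChild k1 t _ = node leaf t leaf leaf leaf leaf leaf leaf leaf
setChild k2 t _ = node leaf leaf t leaf leaf leaf leaf leaf leaf
setChild k3 t _ = node leaf leaf leaf t leaf leaf leaf leaf leaf
setChild k4 t _ = node leaf leaf leaf leaf t leaf leaf leaf leaf
setChild k5 t _ = node leaf leaf leaf leaf leaf t leaf leaf leaf
setChild k6 t _ = node leaf leaf leaf leaf leaf leaf t leaf leaf
setChild k7 t _ = node leaf leaf leaf leaf leaf leaf leaf t leaf
setChild k8 t _ = node leaf leaf leaf leaf leaf leaf leaf leaf t

member : List K → Tree → Bool
member (x ∷ xs) t       = member xs (child x t)
member []       (tip _) = true
member []       _       = false

-- The default is safe. In the class table it assigns class 0, which `cls-0` rejects for any element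
-- but the identity; in the Cayley table it assigns depth 0, which `reached` rejects likewise.
entryAt : List K → Tree → Entry
entryAt (x ∷ xs) t       = entryAt xs (child x t)
entryAt []       (tip e) = e
entryAt []       _       = 0 , one

insert : List K → Entry → Tree → Tree
insert []       e t = tip e
insert (x ∷ xs) e t = setChild x (insert xs e (child x t)) t

-- Depth-first search with the number as fuel. Each new element adds one entry per generator, so
-- with two generators and at most 12096 elements no more than 24193 entries are ever taken from the
-- queue; the callers supply 40000.
explore : ℕ → (X → Entry → List (X × Entry)) → List (X × Entry) → Tree → Tree
explore zero    next queue         t = t
explore (suc n) next []            t = t
explore (suc n) next ((x , e) ∷ q) t =
  if member (key x) t then explore n next q t
  else explore n next (next x e ++ q) (insert (key x) e t)

-- Sends every element x of the group generated by gens to (j , k) with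
-- x = k r k⁻¹, where r is the j-th representative.
classTree : List X → List X → Tree
classTree gens reps = go 0 reps leaf
  where
  go : ℕ → List X → Tree → Tree
  go j []       t = t
  go j (r ∷ rs) t = go (suc j) rs
    (explore 40000 (λ x (i , k) → map (λ g → g · x · invˣ g , (i , g · k)) gens) ((r , (j , one)) ∷ []) t)

-- Sends every x ≠ 1 to (n , y) with x = g y for a generator g, where the
-- number attached to y is smaller than n.
cayleyTree : List X → Tree
cayleyTree gens = explore 40000 (λ x (n , _) → map (λ g → g · x , (suc n , x)) gens) ((one , (0 , one)) ∷ []) leaf

infixl 9 _‼_
_‼_ : List X → ℕ → X
[]       ‼ _     = one
(x ∷ _)  ‼ zero  = x
(_ ∷ xs) ‼ suc n = xs ‼ n

record Lookup : Set where
  constructor lookups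
  field
    classes cayley : Tree

  cls : X → ℕ
  cls x = proj₁ (entryAt (key x) classes)

  conjugator : X → X
  conjugator x = proj₂ (entryAt (key x) classes)

  depth : X → ℕ
  depth x = proj₁ (entryAt (key x) cayley)

  parent : X → X
  parent x = proj₂ (entryAt (key x) cayley)

-- Verification of the tables, and the class theory it yields.

module Checks {G : Group 0ℓ 0ℓ} (𝒞 : Coding G) (gens reps : List X) (tables : Lookup) where
  open Coding 𝒞
  open Lookup tables

  rep : ℕ → X
  rep j = reps ‼ j

  -- `cls-gens` makes the class number a conjugation invariant and `conjugates` ties it to a
  -- representative, so equal numbers mean conjugate elements. `reached` makes x a product of
  -- generators; `central`, over all x, says that the centre is trivial.
  record Checked (x : X) : Set where
    field
      cls-bound      : cls x ℕ.< length reps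
      conjugator-elt : IsElement (conjugator x)
      conjugates     : x · conjugator x ≡ conjugator x · rep (cls x)
      cls-gens       : All (λ g → cls (g · x · invˣ g) ≡ cls x) gens
      reached        : x ≡ one ⊎ (depth (parent x) ℕ.< depth x × Any (λ g → parent x ≡ invˣ g · x) gens)
      cls-0          : cls x ≡ 0 → x ≡ one
      central        : All (λ g → x · g ≡ g · x) gens → x ≡ one

  checked? : ∀ x → Dec (Checked x)
  checked? x = map′
    (λ (a , b , c , d , e , f , g) → record
      { cls-bound = a ; conjugator-elt = b ; conjugates = c ; cls-gens = d ; reached = e ; cls-0 = f ; central = g })
    (λ r → let open Checked r in cls-bound , conjugator-elt , conjugates , cls-gens , reached , cls-0 , central)
    (cls x ℕ.<? length reps
     ×-dec isElement? (conjugator x)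
     ×-dec (x · conjugator x) ≟ˣ (conjugator x · rep (cls x))
     ×-dec every? (λ g → cls (g · x · invˣ g) ℕ.≟ cls x) gens
     ×-dec (x ≟ˣ one ⊎-dec (depth (parent x) ℕ.<? depth x ×-dec some? (λ g → parent x ≟ˣ (invˣ g · x)) gens))
     ×-dec (cls x ℕ.≟ 0 →-dec x ≟ˣ one)
     ×-dec (every? (λ g → (x · g) ≟ˣ (g · x)) gens →-dec x ≟ˣ one))

  record AllChecked : Set where
    field
      elements-checked : All Checked elements
      gens-valid       : All IsElement gens
      reps-valid       : All IsElement reps
      cls-one          : cls one ≡ 0

  allChecked? : Dec AllChecked
  allChecked? = map′
    (λ (a , b , c , d) → record { elements-checked = a ; gens-valid = b ; reps-valid = c ; cls-one = d })
    (λ r → let open AllChecked r in elements-checked , gens-valid , reps-valid , cls-one)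
    (every? checked? elements ×-dec every? isElement? gens ×-dec every? isElement? reps ×-dec cls one ℕ.≟ 0)

module ClassTheory {G : Group 0ℓ 0ℓ} (𝒞 : Coding G) (gens reps : List X) (tables : Lookup)
  (checked : Checks.AllChecked 𝒞 gens reps tables) where

  open Group G hiding (refl; sym; trans)
  private module G = Group G
  open Coding 𝒞
  open Lookup tables
  open Checks 𝒞 gens reps tables using (rep)
  open Checks.AllChecked checked
  open Tuples G
  open RawMonoidSum rawMonoid using () renaming (sum to product)
  open VectorEquality setoid using (_≋_)

  private
    at : ∀ A → Checks.Checked 𝒞 gens reps tables (code A)
    at A = All.lookup elements-checked (code∈ A)
    module At A = Checks.Checked (at A)

  code-▷ : ∀ B A → code (B ▷ A) ≡ code B · code A · invˣ (code B)
  code-▷ B A = trans (code-∙ (B ∙ A) (B ⁻¹)) (cong₂ _·_ (code-∙ B A) (code-⁻¹ B))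

  invˣ-inverseˡ : ∀ A → invˣ (code A) · code A ≡ one
  invˣ-inverseˡ A = trans (cong (_· code A) (sym (code-⁻¹ A)))
    (trans (sym (code-∙ (A ⁻¹) A)) (trans (code-cong (inverseˡ A)) code-ε))

  -- Induction on the depth of A in the Cayley table: the parent S⁻¹ A has smaller depth. Every
  -- element is thus a positive word in the generators, and no step for inverses occurs.
  gens-induction : (P : Pred Carrier 0ℓ) → (∀ {x y} → x ≈ y → P x → P y) → P ε →
    (∀ {s} S → s ∈ˡ gens → code S ≡ s → ∀ A → P A → P (S ∙ A)) → ∀ A → P A
  gens-induction P P-resp Pε P-step A = go (suc (depth (code A))) A (ℕ.n<1+n _)
    where
    go : ∀ n A → depth (code A) ℕ.< n → P A
    go (suc n) A d<n with At.reached A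
    ... | inj₁ A≡one = P-resp (G.sym (code-injective (trans A≡one (sym code-ε)))) Pε
    ... | inj₂ (d<d , any) =
      let s , s∈ , parent≡ = find any
          S , S≡s = decode (All.lookup gens-valid s∈)
          B = S ⁻¹ ∙ A
          B≡ : code B ≡ parent (code A)
          B≡ = trans (code-∙ (S ⁻¹) A) (trans (cong (_· code A) (trans (code-⁻¹ S) (cong invˣ S≡s))) (sym parent≡))
      in P-resp (\\-leftDividesˡ S A) (P-step S s∈ S≡s B
           (go n B (ℕ.<-≤-trans (subst (λ x → depth x ℕ.< depth (code A)) (sym B≡) d<d) (ℕ.s≤s⁻¹ d<n))))
      where open GroupProperties G using (\\-leftDividesˡ)

  generates : ∀ {z} {g : Vector Carrier z} →
    (∀ {s} S → s ∈ˡ gens → code S ≡ s → S ∈ Generated G g) → Generates g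
  generates {g = g} p = gens-induction (Generated G g) resp unit λ S s∈ S≡s A A∈ → mul (p S s∈ S≡s) A∈

  cls-▷ : ∀ B A → cls (code (B ▷ A)) ≡ cls (code A)
  cls-▷ B A = gens-induction (λ B → ∀ A → cls (code (B ▷ A)) ≡ cls (code A))
    (λ x≈y p A → trans (cong cls (code-cong (▷-cong (G.sym x≈y) G.refl))) (p A))
    (λ A → cong cls (code-cong (ε-▷ A)))
    (λ {s} S s∈ S≡s B p A → begin
      cls (code ((S ∙ B) ▷ A))  ≡⟨ cong cls (code-cong (▷-▷ S B A)) ⟨
      cls (code (S ▷ (B ▷ A)))  ≡⟨ cong cls (code-▷ S (B ▷ A)) ⟩
      cls (code S · code (B ▷ A) · invˣ (code S))  ≡⟨ cong (λ s → cls (s · code (B ▷ A) · invˣ s)) S≡s ⟩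
      cls (s · code (B ▷ A) · invˣ s)  ≡⟨ All.lookup (At.cls-gens (B ▷ A)) s∈ ⟩
      cls (code (B ▷ A))  ≡⟨ p A ⟩
      cls (code A)  ∎)
    B A
    where open ≡-Reasoning

  Cl : ℕ → Pred Carrier 0ℓ
  Cl j A = cls (code A) ≡ j

  Cl-invariant : ∀ j → IsInvariant (Cl j)
  Cl-invariant j = record
    { respects = λ x≈y p → trans (cong cls (code-cong (G.sym x≈y))) p
    ; closed   = λ k {x} p → trans (cls-▷ k x) p
    }

  Cls : (a b c d : ℕ) → Classes
  Cls a b c d = quad (Cl a) (Cl b) (Cl c) (Cl d)

  Cls-invariant : ∀ {a b c d} i → IsInvariant (Cls a b c d i)
  Cls-invariant = four (Cl-invariant _) (Cl-invariant _) (Cl-invariant _) (Cl-invariant _)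

  rep-valid : ∀ j → IsElement (rep j)
  rep-valid = go reps-valid
    where
    go : ∀ {rs} → All IsElement rs → ∀ j → IsElement (rs ‼ j)
    go []       j       = subst IsElement code-ε (All.lookup elements-valid (code∈ ε))
    go (v ∷ _)  zero    = v
    go (_ ∷ vs) (suc j) = go vs j

  cls-bound : ∀ A → cls (code A) ℕ.< length reps
  cls-bound = At.cls-bound

  ·-cancelˡ : ∀ K {x y} → code K · x ≡ code K · y → x ≡ y
  ·-cancelˡ K {x} {y} eq = begin
    x  ≡⟨ ·-identityˡ x ⟨
    one · x  ≡⟨ cong (_· x) (invˣ-inverseˡ K) ⟨
    invˣ (code K) · code K · x  ≡⟨ ·-assoc (invˣ (code K)) (code K) x ⟩
    invˣ (code K) · (code K · x)  ≡⟨ cong (invˣ (code K) ·_) eq ⟩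
    invˣ (code K) · (code K · y)  ≡⟨ ·-assoc (invˣ (code K)) (code K) y ⟨
    invˣ (code K) · code K · y  ≡⟨ cong (_· y) (invˣ-inverseˡ K) ⟩
    one · y  ≡⟨ ·-identityˡ y ⟩
    y  ∎
    where open ≡-Reasoning

  conjugatorᴳ : ∀ A → ∃[ K ] code K ≡ conjugator (code A)
  conjugatorᴳ A = decode (At.conjugator-elt A)

  conjugator-▷ : ∀ A K → code K ≡ conjugator (code A) → code ((K ⁻¹) ▷ A) ≡ rep (cls (code A))
  conjugator-▷ A K K≡ = begin
    code (K ⁻¹ ∙ A ∙ K ⁻¹ ⁻¹)  ≡⟨ code-cong (G.trans (∙-congˡ (⁻¹-involutive K)) (assoc (K ⁻¹) A K)) ⟩
    code (K ⁻¹ ∙ (A ∙ K))  ≡⟨ code-∙ (K ⁻¹) (A ∙ K) ⟩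
    code (K ⁻¹) · code (A ∙ K)  ≡⟨ cong₂ _·_ (code-⁻¹ K) (code-∙ A K) ⟩
    invˣ (code K) · (code A · code K)  ≡⟨ cong (λ k → invˣ (code K) · (code A · k)) K≡ ⟩
    invˣ (code K) · (code A · conjugator (code A)) ≡⟨ cong (invˣ (code K) ·_) (At.conjugates A) ⟩
    invˣ (code K) · (conjugator (code A) · r) ≡⟨ cong (λ k → invˣ (code K) · (k · r)) K≡ ⟨
    invˣ (code K) · (code K · r)  ≡⟨ ·-assoc (invˣ (code K)) (code K) r ⟨
    invˣ (code K) · code K · r  ≡⟨ cong (_· r) (invˣ-inverseˡ K) ⟩
    one · r  ≡⟨ ·-identityˡ r ⟩
    r  ∎
    where
    open ≡-Reasoning
    open GroupProperties G using (⁻¹-involutive)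
    r = rep (cls (code A))

  normalise : ∀ A → ∃[ K ] code (K ▷ A) ≡ rep (cls (code A))
  normalise A = let K , K≡ = conjugatorᴳ A in K ⁻¹ , conjugator-▷ A K K≡

  -- Both elements are conjugate to the same representative.
  conjugate-in-class : ∀ A B → cls (code A) ≡ cls (code B) → Conjugate G A B
  conjugate-in-class A B eq =
    let K , KA≡r = normalise A
        L , LB≡r = normalise B
    in L ⁻¹ ∙ K , (begin
      B  ≈⟨ ⁻¹▷▷ L B ⟨
      (L ⁻¹) ▷ (L ▷ B)  ≈⟨ ▷-cong G.refl (code-injective (trans LB≡r (trans (cong rep (sym eq)) (sym KA≡r)))) ⟩
      (L ⁻¹) ▷ (K ▷ A)  ≈⟨ ▷-▷ (L ⁻¹) K A ⟩
      (L ⁻¹ ∙ K) ▷ A  ∎)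
    where open SetoidReasoning G.setoid

  Conjugate≐Cl : ∀ A → Conjugate G A ≐ Cl (cls (code A))
  Conjugate≐Cl A =
    (λ (K , y≈) → trans (cong cls (code-cong y≈)) (cls-▷ K A)) ,
    (λ {B} eq → conjugate-in-class A B (sym eq))

  class-index : ∀ {C} → IsConjugacyClass G C → ¬ (ε ∈ C) → ∃[ j ] 0 ℕ.< j × j ℕ.< length reps × C ≐ Cl j
  class-index {C} (A , C⊆ , ⊆C) ε∉C = cls (code A) , ℕ.n≢0⇒n>0 nontrivial , At.cls-bound A ,
    (λ x∈C → proj₁ (Conjugate≐Cl A) (C⊆ x∈C)) , (λ x∈Cl → ⊆C (proj₂ (Conjugate≐Cl A) x∈Cl))
    where
    nontrivial : cls (code A) ≢ 0
    nontrivial c≡0 = ε∉C (⊆C (ε , G.trans (G.sym A≈ε) (G.sym (ε-▷ A))))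
      where
      A≈ε : A ≈ ε
      A≈ε = code-injective (trans (At.cls-0 A c≡0) (sym code-ε))

  Cl-nonidentity : ∀ {C j} A → cls (code A) ≡ j → j ≢ 0 → C ≐ Cl j → IsConjugacyClass G C × ¬ (ε ∈ C)
  Cl-nonidentity A refl j≢0 (C⊆ , ⊆C) =
    (A , (λ x∈ → proj₂ (Conjugate≐Cl A) (C⊆ x∈)) , (λ x∈ → ⊆C (proj₁ (Conjugate≐Cl A) x∈))) ,
    λ ε∈C → j≢0 (trans (sym (C⊆ ε∈C)) (trans (cong cls code-ε) cls-one))

  classes-indices : ∀ {C} → NonIdentityClasses G C → Σ[ J ∈ Vector ℕ 4 ]
    ((∀ i → 0 ℕ.< J i × J i ℕ.< length reps) × C ≃ Cls (J 0F) (J 1F) (J 2F) (J 3F) × (∀ i → C i ≐ Cl (J i)))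
  classes-indices {C} nonid = J , (λ i → proj₁ (proj₂ (ix i)) , proj₁ (proj₂ (proj₂ (ix i)))) ,
    ≐⇒≃ (four (eq 0F) (eq 1F) (eq 2F) (eq 3F)) , eq
    where
    ix : ∀ i → ∃[ j ] 0 ℕ.< j × j ℕ.< length reps × C i ≐ Cl j
    ix i = class-index (proj₁ (nonid i)) (proj₂ (nonid i))
    J : Vector ℕ 4
    J i = proj₁ (ix i)
    eq : ∀ i → C i ≐ Cl (J i)
    eq i = proj₂ (proj₂ (proj₂ (ix i)))

  -- A central element commutes with the generators, and the table check leaves only the identity.
  centreless : ∀ K → (∀ B → K ▷ B ≈ B) → K ≈ ε
  centreless K K-central = code-injective (trans
    (At.central K (All.tabulate λ {s} s∈ → let S , S≡s = decode (All.lookup gens-valid s∈) in begin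
      code K · s  ≡⟨ cong (code K ·_) S≡s ⟨
      code K · code S  ≡⟨ code-∙ K S ⟨
      code (K ∙ S)  ≡⟨ code-cong (▷-∙ K S) ⟨
      code ((K ▷ S) ∙ K)  ≡⟨ code-cong (∙-congʳ (K-central S)) ⟩
      code (S ∙ K)  ≡⟨ code-∙ S K ⟩
      code S · code K  ≡⟨ cong (_· code K) S≡s ⟩
      s · code K  ∎))
    (sym code-ε))
    where open ≡-Reasoning

  order : ℕ
  order = length elements

  G-HasSize : setoid HasSize order
  G-HasSize = list-HasSize {S = setoid} code code-cong code-injective elements-unique code∈
    (λ x∈ → decode (All.lookup elements-valid x∈))

  order≢0 : ℕ.NonZero order
  order≢0 with elements | code∈ ε
  ... | _ ∷ _ | _ = _

  Σ-setoid Σ̄-setoid : Classes → Setoid 0ℓ 0ℓ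
  Σ-setoid C = subset Tuple-setoid (InΣ G C)
  Σ̄-setoid C = subset Tuple-setoid (InΣ̄ G C)

  transporter : ∀ {g h : Tuple} {k l} → k ▶ g ≋ l ▶ h → (l ⁻¹ ∙ k) ▶ g ≋ h
  transporter {g} {h} {k} {l} eq i = begin
    (l ⁻¹ ∙ k) ▷ g i  ≈⟨ ▷-▷ (l ⁻¹) k (g i) ⟨
    (l ⁻¹) ▷ (k ▷ g i)  ≈⟨ ▷-cong G.refl (eq i) ⟩
    (l ⁻¹) ▷ (l ▷ h i)  ≈⟨ ⁻¹▷▷ l (h i) ⟩
    h i  ∎
    where open SetoidReasoning G.setoid

  -- If k and l act alike on g, then l⁻¹ k centralizes a generating tuple, so it is central and
  -- therefore trivial.
  ▶-free : ∀ {g : Tuple} → Generates g → ∀ {k l} → k ▶ g ≋ l ▶ g → k ≈ l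
  ▶-free {g} gg {k} {l} eq = begin
    k  ≈⟨ \\-leftDividesˡ l k ⟨
    l ∙ (l ⁻¹ ∙ k)  ≈⟨ ∙-congˡ (centreless _ λ B → centralizes-Generated _ (transporter eq) (gg B)) ⟩
    l ∙ ε  ≈⟨ identityʳ l ⟩
    l  ∎
    where
    open GroupProperties G using (\\-leftDividesˡ)
    open SetoidReasoning G.setoid

  two-orbits⇒¬rigid : ∀ {C} → (∀ i → IsInvariant (C i)) → ∀ {g h} → InΣ G C g → InΣ G C h →
    (∀ k → ¬ (k ▶ g ≋ h)) → ¬ Rigid G C
  two-orbits⇒¬rigid {C} C-inv {g} {h} g∈Σ h∈Σ g≁h (m , n , n≢0 , s , t , q) =
    absurd n n≢0 (SizeRatio-1 {Σ-setoid C} {setoid} s t (m , n , n≢0 , s , t , q)) 2n≤m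
    where
    orbit : Fin 2 → Carrier → Setoid.Carrier (Σ-setoid C)
    orbit 0F k = k ▶ g , ▶-InΣ C-inv k g∈Σ
    orbit 1F k = k ▶ h , ▶-InΣ C-inv k h∈Σ
    injective : ∀ {i j x y} → proj₁ (orbit i x) ≋ proj₁ (orbit j y) → i ≡ j × x ≈ y
    injective {0F} {0F} eq = refl , ▶-free (proj₂ g∈Σ) eq
    injective {0F} {1F} eq = contradiction (transporter eq) (g≁h _)
    injective {1F} {0F} eq = contradiction (transporter (λ i → G.sym (eq i))) (g≁h _)
    injective {1F} {1F} eq = refl , ▶-free (proj₂ h∈Σ) eq
    2n≤m : 2 ℕ.* n ℕ.≤ m
    2n≤m = copies-≤-size {S = Σ-setoid C} {T = setoid} s t 2 orbit
      (λ {i} {j} → injective {i} {j})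
    absurd : ∀ n → ℕ.NonZero n → m ≡ n → ¬ (2 ℕ.* n ℕ.≤ m)
    absurd (suc n) _ refl = ℕ.m+1+n≰m (suc n)

  empty⇒¬rigid : ∀ {C} → (∀ {g} → ¬ InΣ G C g) → ¬ Rigid G C
  empty⇒¬rigid {C} empty r@(m , n , n≢0 , s , t , _) =
    empty (proj₂ (Inverse.to s (first n n≢0 (SizeRatio-1 {Σ-setoid C} {setoid} s t r))))
    where
    first : ∀ n → ℕ.NonZero n → m ≡ n → Fin m
    first (suc n) _ refl = Fin.zero

  -- The orbit map k ↦ k ▶ t is a bijection from G onto Σ and onto Σ̄ alike; `ratio` is stated for a
  -- predicate P so as to serve both.
  single-orbit⇒strictlyRigid : ∀ {C} → (∀ i → IsInvariant (C i)) → ∀ {t} → InΣ G C t →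
    (∀ {g} → InΣ̄ G C g → ∃[ k ] (k ▶ t ≋ g)) → StrictlyRigid G C
  single-orbit⇒strictlyRigid {C} C-inv {t} t∈Σ single =
    ratio (InΣ G C) (λ k → ▶-InΣ C-inv k t∈Σ) (λ g∈ → single (proj₁ g∈)) ,
    ratio (InΣ̄ G C) (λ k → ▶-InΣ̄ C-inv k (proj₁ t∈Σ)) single
    where
    free : ∀ {k l} → k ▶ t ≋ l ▶ t → k ≈ l
    free = ▶-free (proj₂ t∈Σ)
    ratio : ∀ (P : Pred Tuple 0ℓ) → (∀ k → P (k ▶ t)) → (∀ {g} → P g → ∃[ k ] (k ▶ t ≋ g)) →
      SizeRatio (subset Tuple-setoid P) setoid 1ℚ
    ratio P P-orbit reach = SizeRatio-≡1 {subset Tuple-setoid P} {setoid}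
      (HasSize-resp {S = setoid} {S′ = subset Tuple-setoid P} orbit G-HasSize) G-HasSize order≢0
      where
      orbit : Inverse setoid (subset Tuple-setoid P)
      orbit = record
        { to = λ k → k ▶ t , P-orbit k
        ; from = λ (g , g∈) → proj₁ (reach g∈)
        ; to-cong = λ k≈l i → ▷-cong k≈l G.refl
        ; from-cong = λ {(g , g∈)} {(h , h∈)} g≋h → free λ i →
            G.trans (proj₂ (reach g∈) i) (G.trans (g≋h i) (G.sym (proj₂ (reach h∈) i)))
        ; inverse = (λ {(g , g∈)} k≈ i → G.trans (▷-cong k≈ G.refl) (proj₂ (reach g∈) i)) ,
                    (λ {k} {(g , g∈)} g≋ → free λ i → G.trans (proj₂ (reach g∈) i) (g≋ i))
        }

-- Counting in lists, and finite certificates.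

nth : {A : Set} → A → List A → ℕ → A
nth d []       _       = d
nth d (x ∷ _)  zero    = x
nth d (_ ∷ xs) (suc n) = nth d xs n

nth-applyUpTo : {A : Set} {d : A} (f : ℕ → A) {n i : ℕ} → i ℕ.< n → nth d (applyUpTo f n) i ≡ f i
nth-applyUpTo f {suc n} {zero}  _         = refl
nth-applyUpTo f {suc n} {suc i} (ℕ.s<s i<n) = nth-applyUpTo (f ∘ suc) i<n

count : ℕ → List ℕ → ℕ
count b xs = length (filter (ℕ._≟ b) xs)

count-map : {A : Set} (f : A → ℕ) (b : ℕ) (xs : List A) → count b (map f xs) ≡ length (filter (λ x → f x ℕ.≟ b) xs)
count-map f b []       = refl
count-map f b (x ∷ xs) with does (f x ℕ.≟ b)
... | true  = cong suc (count-map f b xs)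
... | false = count-map f b xs

sumOver : List ℕ → (ℕ → ℕ) → ℕ
sumOver []       f = 0
sumOver (j ∷ js) f = f j ℕ.+ sumOver js f

sumOver-cong : ∀ {js f g} → All (λ j → f j ≡ g j) js → sumOver js f ≡ sumOver js g
sumOver-cong []       = refl
sumOver-cong (p ∷ ps) = cong₂ ℕ._+_ p (sumOver-cong ps)

length-cartesianProduct : {A B : Set} (xs : List A) (ys : List B) →
  length (cartesianProduct xs ys) ≡ length xs ℕ.* length ys
length-cartesianProduct []       ys = refl
length-cartesianProduct (x ∷ xs) ys = trans (length-++ (map (x ,_) ys))
  (cong₂ ℕ._+_ (length-map (x ,_) ys) (length-cartesianProduct xs ys))

length-concatMap : {A : Set} (f : ℕ → List A) (js : List ℕ) → length (concatMap f js) ≡ sumOver js (length ∘ f)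
length-concatMap f []       = refl
length-concatMap f (j ∷ js) = trans (length-++ (f j)) (cong (length (f j) ℕ.+_) (length-concatMap f js))

-- Words use the first, second and fourth entries of a tuple; the third is determined by the product
-- relation.
letter : {A : Set} → A → A → A → ℕ → A
letter x y w 0 = x
letter x y w 1 = y
letter x y w _ = w

Word : Set
Word = List ℕ

evaluate : X → X → X → Word → X
evaluate x y w []       = one
evaluate x y w (i ∷ is) = letter x y w i · evaluate x y w is

-- A tuple (x , y , z , w) of product 1 in the classes a, b, c, d, where w is
-- the representative of d; the words express the generators of the group.
record Solution : Set where
  constructor solution
  field
    a b c d : ℕ
    x y     : X
    words   : List Word

module Certificates {G : Group 0ℓ 0ℓ} (𝒞 : Coding G) (gens reps : List X) (tables : Lookup) where
  open Coding 𝒞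
  open Lookup tables
  open Checks 𝒞 gens reps tables using (rep)

  O : ℕ → List X
  O j = filter (λ x → cls x ℕ.≟ j) elements

  -- The factorisations x y of the j-th representative with x in class a and y in class b, recorded
  -- by x. Their number is a class structure constant.
  F : (j a b : ℕ) → List X
  F j a b = filter (λ x → cls (invˣ x · rep j) ℕ.≟ b) (O a)

  inverseClass : ℕ → ℕ
  inverseClass j = cls (invˣ (rep j))

  -- The inverse is the third entry: x y z w = 1 gives z = (w x y)⁻¹.
  Valid : Solution → Set
  Valid s = IsElement x × IsElement y × IsElement (rep d) ×
    cls x ≡ a × cls y ≡ b × cls (invˣ (rep d · x · y)) ≡ c × cls (rep d) ≡ d ×
    All (λ g → Any (λ v → evaluate x y (rep d) v ≡ g) words) gens
    where open Solution s

  valid? : ∀ s → Dec (Valid s)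
  valid? s = isElement? x ×-dec isElement? y ×-dec isElement? (rep d) ×-dec
    cls x ℕ.≟ a ×-dec cls y ℕ.≟ b ×-dec cls (invˣ (rep d · x · y)) ℕ.≟ c ×-dec cls (rep d) ℕ.≟ d ×-dec
    every? (λ g → some? (λ v → evaluate x y (rep d) v ≟ˣ g) words) gens
    where open Solution s

  Exhausted : (xs ys : List X) (c : ℕ) (w : X) → (X → X → Set) → Set
  Exhausted xs ys c w P = All (λ x → All (λ y → cls (invˣ (w · x · y)) ≡ c → P x y) ys) xs

  exhausted? : ∀ xs ys c w {P : X → X → Set} → (∀ x y → Dec (P x y)) → Dec (Exhausted xs ys c w P)
  exhausted? xs ys c w {P} P? = every? (λ x → row? x (w · x)) xs
    where
    -- `wx` is an argument so that the product `w · x` is shared by the whole row.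
    row? : ∀ x wx → Dec (All (λ y → cls (invˣ (wx · y)) ≡ c → P x y) ys)
    row? x wx = every? (λ y → cls (invˣ (wx · y)) ℕ.≟ c →-dec P? x y) ys

  Preserves : List X → X → Set
  Preserves Ω x = All (λ ω → (x · ω · invˣ x) ∈ˡ Ω) Ω

  -- Asking for x and for its inverse makes closure under inverses immediate, with no counting on
  -- the finite set.
  Normalises : List X → X → Set
  Normalises Ω x = Preserves Ω x × Preserves Ω (invˣ x)

  normalises? : ∀ Ω x → Dec (Normalises Ω x)
  normalises? Ω x = preserves? x ×-dec preserves? (invˣ x)
    where
    preserves? : ∀ x → Dec (Preserves Ω x)
    preserves? x = every? (λ ω → some? (λ ω′ → (x · ω · invˣ x) ≟ˣ ω′) Ω) Ω

  NotNormal : List X → Set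
  NotNormal Ω = Any (λ g → ¬ Normalises Ω g) gens

  notNormal? : ∀ Ω → Dec (NotNormal Ω)
  notNormal? Ω = some? (λ g → ¬? (normalises? Ω g)) gens

  -- Different solutions may normalise different sets, so Ω is chosen anew for each pair.
  Contained : List (List X) → X → X → Set
  Contained Ωs x y = Any (λ Ω → Normalises Ω x × Normalises Ω y) Ωs

  contained? : ∀ Ωs x y → Dec (Contained Ωs x y)
  contained? Ωs x y = some? (λ Ω → normalises? Ω x ×-dec normalises? Ω y) Ωs

  -- In the application `ks` is the centralizer of the last entry: a conjugation between tuples with
  -- the same last entry has to centralize it.
  Conjugated : (xs : List X) (x₀ y₀ : X) → X → X → Set
  Conjugated ks x₀ y₀ x y = Any (λ k → k · x₀ ≡ x · k × k · y₀ ≡ y · k) ks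

  centralizer : X → List X
  centralizer w = filter (λ k → (k · w) ≟ˣ (w · k)) elements

  -- The third component: letters i and j for which the products of the i-th and
  -- the j-th element of the two tuples are in different classes.
  Distinct : Solution × Solution × ℕ × ℕ → Set
  Distinct (s , s′ , i , j) = Valid s × Valid s′ × (a , b , c , d) ≡ (a′ , b′ , c′ , d′) ×
    cls (l i · l j) ≢ cls (l′ i · l′ j)
    where
    open Solution s
    open Solution s′ using () renaming (a to a′; b to b′; c to c′; d to d′; x to x′; y to y′)
    l l′ : ℕ → X
    l  = letter x y (rep d)
    l′ = letter x′ y′ (rep d)

  _≟⁴_ : DecidableEquality (ℕ × ℕ × ℕ × ℕ)
  _≟⁴_ = ≡-dec ℕ._≟_ (≡-dec ℕ._≟_ (≡-dec ℕ._≟_ ℕ._≟_))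

  distinct? : ∀ p → Dec (Distinct p)
  distinct? (s , s′ , i , j) = valid? s ×-dec valid? s′ ×-dec _ ≟⁴ _ ×-dec ¬? (_ ℕ.≟ _)

-- What the certificates prove.

module CertificateTheory {G : Group 0ℓ 0ℓ} (𝒞 : Coding G) (gens reps : List X) (tables : Lookup)
  (checked : Checks.AllChecked 𝒞 gens reps tables) where

  open Group G hiding (refl; sym; trans)
  private module G = Group G
  open Coding 𝒞
  open Lookup tables
  open Checks 𝒞 gens reps tables using (rep)
  open Checks.AllChecked checked
  open Tuples G
  open ClassTheory 𝒞 gens reps tables checked
  open Certificates 𝒞 gens reps tables
  open RawMonoidSum rawMonoid using () renaming (sum to product)
  open VectorEquality setoid using (_≋_)

  ∈-O : ∀ {j} A → cls (code A) ≡ j → code A ∈ˡ O j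
  ∈-O A eq = ∈-filter⁺ _ (code∈ A) eq

  product⇒third : ∀ (h : Tuple) → product h ≈ ε → h 2F ≈ (h 3F ∙ h 0F ∙ h 1F) ⁻¹
  product⇒third h p = inverseʳ-unique (h 3F ∙ h 0F ∙ h 1F) (h 2F) (begin
    h 3F ∙ h 0F ∙ h 1F ∙ h 2F  ≈⟨ ∙-congʳ (assoc _ _ _) ⟩
    h 3F ∙ (h 0F ∙ h 1F) ∙ h 2F  ≈⟨ assoc _ _ _ ⟩
    h 3F ∙ (h 0F ∙ h 1F ∙ h 2F)  ≈⟨ ∙-congˡ (inverseˡ-unique _ (h 3F) (begin
      h 0F ∙ h 1F ∙ h 2F ∙ h 3F  ≈⟨ ∙-congˡ (identityʳ (h 3F)) ⟨
      h 0F ∙ h 1F ∙ h 2F ∙ (h 3F ∙ ε)  ≈⟨ assoc _ _ _ ⟩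
      h 0F ∙ h 1F ∙ (h 2F ∙ (h 3F ∙ ε))  ≈⟨ assoc _ _ _ ⟩
      product h  ≈⟨ p ⟩
      ε  ∎)) ⟩
    h 3F ∙ h 3F ⁻¹  ≈⟨ inverseʳ (h 3F) ⟩
    ε  ∎)
    where
    open GroupProperties G using (inverseˡ-unique; inverseʳ-unique)
    open SetoidReasoning G.setoid

  third⇒product : ∀ x y w → product (quad x y ((w ∙ x ∙ y) ⁻¹) w) ≈ ε
  third⇒product x y w = begin
    x ∙ (y ∙ ((w ∙ x ∙ y) ⁻¹ ∙ (w ∙ ε)))  ≈⟨ ∙-congˡ (∙-congˡ (∙-cong (⁻¹-cong (assoc w x y)) (identityʳ w))) ⟩
    x ∙ (y ∙ ((w ∙ (x ∙ y)) ⁻¹ ∙ w))  ≈⟨ ∙-congˡ (∙-congˡ (∙-congʳ (⁻¹-anti-homo-∙ w (x ∙ y)))) ⟩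
    x ∙ (y ∙ ((x ∙ y) ⁻¹ ∙ w ⁻¹ ∙ w))  ≈⟨ ∙-congˡ (∙-congˡ (//-rightDividesˡ w _)) ⟩
    x ∙ (y ∙ (x ∙ y) ⁻¹)  ≈⟨ assoc x y _ ⟨
    x ∙ y ∙ (x ∙ y) ⁻¹  ≈⟨ inverseʳ (x ∙ y) ⟩
    ε  ∎
    where
    open GroupProperties G using (⁻¹-anti-homo-∙; //-rightDividesˡ)
    open SetoidReasoning G.setoid

  code-third : ∀ x y w → code ((w ∙ x ∙ y) ⁻¹) ≡ invˣ (code w · code x · code y)
  code-third x y w = trans (code-⁻¹ _) (cong invˣ (trans (code-∙ (w ∙ x) y) (cong (_· code y) (code-∙ w x))))

  -- Once the last entry is conjugated to its representative, the first two run through finite lists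
  -- and the third follows from them, so the exhaustive check applies to the conjugate.
  normalise-tuple : ∀ {a b c d P g} → Exhausted (O a) (O b) c (rep d) P → InΣ̄ G (Cls a b c d) g →
    ∃[ k ] code (k ▷ g 3F) ≡ rep d × P (code (k ▷ g 0F)) (code (k ▷ g 1F))
  normalise-tuple {a} {b} {c} {d} {P} {g} exhausted (g∈ , Πg≈ε) =
    k , w≡ , All.lookup (All.lookup exhausted (∈-O _ (trans (cls-▷ k (g 0F)) (g∈ 0F))))
      (∈-O _ (trans (cls-▷ k (g 1F)) (g∈ 1F))) (begin
        cls (invˣ (rep d · code (h 0F) · code (h 1F)))  ≡⟨ cong (λ w → cls (invˣ (w · code (h 0F) · code (h 1F)))) w≡ ⟨
        cls (invˣ (code (h 3F) · code (h 0F) · code (h 1F))) ≡⟨ cong cls (code-third (h 0F) (h 1F) (h 3F)) ⟨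
        cls (code ((h 3F ∙ h 0F ∙ h 1F) ⁻¹))  ≡⟨ cong cls (code-cong (product⇒third h Πh≈ε)) ⟨
        cls (code (h 2F))  ≡⟨ trans (cls-▷ k (g 2F)) (g∈ 2F) ⟩
        c  ∎)
    where
    open ≡-Reasoning
    k : Carrier
    k = proj₁ (normalise (g 3F))
    h : Tuple
    h = k ▶ g
    w≡ : code (h 3F) ≡ rep d
    w≡ = trans (proj₂ (normalise (g 3F))) (cong rep (g∈ 3F))
    Πh≈ε : product h ≈ ε
    Πh≈ε = proj₂ (▶-InΣ̄ (Cls-invariant {a} {b} {c} {d}) k {g} (g∈ , Πg≈ε))

  third-generated : ∀ {g : Tuple} → product g ≈ ε → {P : Pred Carrier 0ℓ} →
    (∀ {x y} → x ≈ y → P x → P y) → (∀ {x y} → P x → P y → P (x ∙ y)) → (∀ {x} → P x → P (x ⁻¹)) →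
    P (g 0F) → P (g 1F) → P (g 3F) → ∀ i → P (g i)
  third-generated {g} p P-resp P-∙ P-⁻¹ p₀ p₁ p₃ = four p₀ p₁
    (P-resp (G.sym (product⇒third g p)) (P-⁻¹ (P-∙ (P-∙ p₃ p₀) p₁))) p₃

  module _ {Ω : List X} where
    N : Pred Carrier 0ℓ
    N A = Normalises Ω (code A)

    private
      preserves-∙ : ∀ A B → Preserves Ω (code A) → Preserves Ω (code B) → Preserves Ω (code (A ∙ B))
      preserves-∙ A B pA pB = All.tabulate λ {ω} ω∈ → subst (_∈ˡ Ω) (lemma ω) (All.lookup pA (All.lookup pB ω∈))
        where
        open ≡-Reasoning
        a = code A
        b = code B
        lemma : ∀ ω → a · (b · ω · invˣ b) · invˣ a ≡ code (A ∙ B) · ω · invˣ (code (A ∙ B))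
        lemma ω = begin
          a · (b · ω · invˣ b) · invˣ a  ≡⟨ cong (_· invˣ a) (·-assoc a (b · ω) (invˣ b)) ⟨
          a · (b · ω) · invˣ b · invˣ a  ≡⟨ ·-assoc (a · (b · ω)) (invˣ b) (invˣ a) ⟩
          a · (b · ω) · (invˣ b · invˣ a)  ≡⟨ cong (_· (invˣ b · invˣ a)) (·-assoc a b ω) ⟨
          a · b · ω · (invˣ b · invˣ a)  ≡⟨ cong₂ (λ x y → x · ω · y) (code-∙ A B) inverse-∙ ⟨
          code (A ∙ B) · ω · invˣ (code (A ∙ B)) ∎
          where
          inverse-∙ : invˣ (code (A ∙ B)) ≡ invˣ b · invˣ a
          inverse-∙ = begin
            invˣ (code (A ∙ B))  ≡⟨ code-⁻¹ (A ∙ B) ⟨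
            code ((A ∙ B) ⁻¹)  ≡⟨ code-cong (GroupProperties.⁻¹-anti-homo-∙ G A B) ⟩
            code (B ⁻¹ ∙ A ⁻¹)  ≡⟨ code-∙ (B ⁻¹) (A ⁻¹) ⟩
            code (B ⁻¹) · code (A ⁻¹)  ≡⟨ cong₂ _·_ (code-⁻¹ B) (code-⁻¹ A) ⟩
            invˣ b · invˣ a  ∎

    N-resp : ∀ {x y} → x ≈ y → N x → N y
    N-resp x≈y = subst (Normalises Ω) (code-cong x≈y)

    N-∙ : ∀ {x y} → N x → N y → N (x ∙ y)
    N-∙ {x} {y} (px , px⁻) (py , py⁻) = preserves-∙ x y px py ,
      subst (Preserves Ω) (trans (sym (code-cong (GroupProperties.⁻¹-anti-homo-∙ G x y))) (code-⁻¹ _))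
        (preserves-∙ (y ⁻¹) (x ⁻¹) (subst (Preserves Ω) (sym (code-⁻¹ y)) py⁻) (subst (Preserves Ω) (sym (code-⁻¹ x)) px⁻))

    N-⁻¹ : ∀ {x} → N x → N (x ⁻¹)
    N-⁻¹ {x} (p , p⁻) = subst (Preserves Ω) (sym (code-⁻¹ x)) p⁻ ,
      subst (Preserves Ω) (trans (code-cong (G.sym (GroupProperties.⁻¹-involutive G x))) (code-⁻¹ (x ⁻¹))) p

    N-Generated : ∀ {z} {g : Vector Carrier z} → (∀ i → N (g i)) → N ε → ∀ {x} → x ∈ Generated G g → N x
    N-Generated p Nε (gen i)    = p i
    N-Generated p Nε unit       = Nε
    N-Generated p Nε (mul x y)  = N-∙ (N-Generated p Nε x) (N-Generated p Nε y)
    N-Generated p Nε (inv x)    = N-⁻¹ (N-Generated p Nε x)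
    N-Generated p Nε (resp e x) = N-resp e (N-Generated p Nε x)

  -- A tuple that normalises a set which is not normal does not generate.
  contained⇒empty : ∀ {a b c d} Ωs → All NotNormal Ωs → All (λ Ω → Normalises Ω (rep d)) Ωs →
    Exhausted (O a) (O b) c (rep d) (Contained Ωs) → ∀ {g} → ¬ InΣ G (Cls a b c d) g
  contained⇒empty {a} {b} {c} {d} Ωs notNormal normal exhausted {g} g∈Σ@(g∈Σ̄ , _) =
    let k , w≡ , contained = normalise-tuple {a} {b} {c} {d} exhausted g∈Σ̄
        Ω , Ω∈ , nx , ny = find contained
        h∈Σ̄ , hg = ▶-InΣ (Cls-invariant {a} {b} {c} {d}) k {g} g∈Σ
        n₃ = subst (Normalises Ω) (sym w≡) (All.lookup normal Ω∈)
        all-N = third-generated (proj₂ h∈Σ̄) {N {Ω}} N-resp N-∙ N-⁻¹ nx ny n₃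
        s , s∈ , ¬n = find (All.lookup notNormal Ω∈)
        S , S≡s = decode (All.lookup gens-valid s∈)
        Nε = N-resp (inverseʳ (k ▷ g 0F)) (N-∙ nx (N-⁻¹ {x = k ▷ g 0F} nx))
    in ¬n (subst (Normalises Ω) S≡s (N-Generated all-N Nε (hg S)))

  module _ (s : Solution) (v : Valid s) where
    open Solution s

    -- The words evaluate to the generators of G, hence the tuple generates G.
    solution-tuple : Σ[ g ∈ Tuple ] InΣ G (Cls a b c d) g × code (g 0F) ≡ x × code (g 1F) ≡ y × code (g 3F) ≡ rep d
    solution-tuple =
      let vx , vy , vw , clsx , clsy , clsz , clsw , expressed = v
          A , A≡ = decode vx
          B , B≡ = decode vy
          D , D≡ = decode vw
          g : Tuple
          g = quad A B ((D ∙ A ∙ B) ⁻¹) D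
          third≡ : code ((D ∙ A ∙ B) ⁻¹) ≡ invˣ (rep d · x · y)
          third≡ = trans (code-third A B D) (cong invˣ (cong₂ _·_ (cong₂ _·_ D≡ A≡) B≡))
      in g , ((four (trans (cong cls A≡) clsx) (trans (cong cls B≡) clsy)
                    (trans (cong cls third≡) clsz) (trans (cong cls D≡) clsw) ,
               third⇒product A B D) ,
              generates λ S s∈ S≡s →
                let w , w∈ , w≡ = find (All.lookup expressed s∈)
                    E , E∈ , E≡ = value g A≡ B≡ D≡ w
                in resp (code-injective (trans E≡ (trans w≡ (sym S≡s)))) E∈) ,
         A≡ , B≡ , D≡
      where
      value : ∀ (g : Tuple) → code (g 0F) ≡ x → code (g 1F) ≡ y → code (g 3F) ≡ rep d →
        ∀ w → ∃[ E ] E ∈ Generated G g × code E ≡ evaluate x y (rep d) w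
      value g A≡ B≡ D≡ []       = ε , unit , code-ε
      value g A≡ B≡ D≡ (i ∷ is) =
        let L , L∈ , L≡ = first i
            E , E∈ , E≡ = value g A≡ B≡ D≡ is
        in L ∙ E , mul L∈ E∈ , trans (code-∙ L E) (cong₂ _·_ L≡ E≡)
        where
        first : ∀ i → ∃[ L ] L ∈ Generated G g × code L ≡ letter x y (rep d) i
        first 0             = g 0F , gen 0F , A≡
        first 1             = g 1F , gen 1F , B≡
        first (suc (suc _)) = g 3F , gen 3F , D≡

  solutionClasses : Solution → Classes
  solutionClasses s = Cls a b c d where open Solution s

  -- The class of the product of two chosen entries is unchanged by simultaneous conjugation, and it
  -- differs between the two tuples.
  distinct⇒¬rigid : ∀ p → Distinct p → ¬ Rigid G (solutionClasses (proj₁ p))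
  distinct⇒¬rigid p@(s , s′ , i , j) (v , v′ , refl , differ) =
    let g , g∈Σ , g₀ , g₁ , g₃ = solution-tuple s v
        h , h∈Σ , h₀ , h₁ , h₃ = solution-tuple s′ v′
    in two-orbits⇒¬rigid (Cls-invariant {a} {b} {c} {d}) g∈Σ h∈Σ λ k kg≋h →
         differ (begin
           cls (letter x y (rep d) i · letter x y (rep d) j)
             ≡⟨ cong cls (cong₂ _·_ (lt g i g₀ g₁ g₃) (lt g j g₀ g₁ g₃)) ⟨
           cls (code (letter (g 0F) (g 1F) (g 3F) i) · code (letter (g 0F) (g 1F) (g 3F) j))
             ≡⟨ cong cls (code-∙ (letter (g 0F) (g 1F) (g 3F) i) (letter (g 0F) (g 1F) (g 3F) j)) ⟨
           cls (code (letter (g 0F) (g 1F) (g 3F) i ∙ letter (g 0F) (g 1F) (g 3F) j))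
             ≡⟨ cls-▷ k _ ⟨
           cls (code (k ▷ (letter (g 0F) (g 1F) (g 3F) i ∙ letter (g 0F) (g 1F) (g 3F) j)))
             ≡⟨ cong cls (code-cong (G.trans (▷-homo k _ _) (∙-cong (lt-≋ kg≋h i) (lt-≋ kg≋h j)))) ⟩
           cls (code (letter (h 0F) (h 1F) (h 3F) i ∙ letter (h 0F) (h 1F) (h 3F) j))
             ≡⟨ cong cls (code-∙ (letter (h 0F) (h 1F) (h 3F) i) (letter (h 0F) (h 1F) (h 3F) j)) ⟩
           cls (code (letter (h 0F) (h 1F) (h 3F) i) · code (letter (h 0F) (h 1F) (h 3F) j))
             ≡⟨ cong cls (cong₂ _·_ (lt h i h₀ h₁ h₃) (lt h j h₀ h₁ h₃)) ⟩
           cls (letter x′ y′ (rep d) i · letter x′ y′ (rep d) j) ∎)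
    where
    open Solution s
    open Solution s′ using () renaming (x to x′; y to y′)
    open ≡-Reasoning
    lt : ∀ (g : Tuple) {x y w} i → code (g 0F) ≡ x → code (g 1F) ≡ y → code (g 3F) ≡ w →
         code (letter (g 0F) (g 1F) (g 3F) i) ≡ letter x y w i
    lt g 0             p q r = p
    lt g 1             p q r = q
    lt g (suc (suc _)) p q r = r
    lt-≋ : ∀ {k} {g h : Tuple} → k ▶ g ≋ h → ∀ i → k ▷ letter (g 0F) (g 1F) (g 3F) i ≈ letter (h 0F) (h 1F) (h 3F) i
    lt-≋ p 0             = p 0F
    lt-≋ p 1             = p 1F
    lt-≋ p (suc (suc _)) = p 3F

-- Conjugating the swap of the first two places by rotations yields every adjacent swap; the rest is
-- insertion sort, with `D` carried along.
sort-wlog : (D : Pred ℕ 0ℓ) (Q : (a b c d : ℕ) → Set) →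
  (∀ {a b c d} → Q b a c d → Q a b c d) → (∀ {a b c d} → Q b c d a → Q a b c d) →
  (∀ {a b c d} → D a → D b → D c → D d → a ℕ.≤ b → b ℕ.≤ c → c ℕ.≤ d → Q a b c d) →
  ∀ {a b c d} → D a → D b → D c → D d → Q a b c d
sort-wlog D Q swap₀₁ rot sorted = any
  where
  swap₁₂ : ∀ {a b c d} → Q a c b d → Q a b c d
  swap₁₂ q = rot (swap₀₁ (rot (rot (rot q))))
  swap₂₃ : ∀ {a b c d} → Q a b d c → Q a b c d
  swap₂₃ q = rot (rot (swap₀₁ (rot (rot q))))
  insert₄ : ∀ {a b c d} → D a → D b → D c → D d → a ℕ.≤ b → b ℕ.≤ c → Q a b c d
  insert₄ {a} {b} {c} {d} A B C E a≤b b≤c with ℕ.≤-total c d | ℕ.≤-total b d | ℕ.≤-total a d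
  ... | inj₁ c≤d | _        | _        = sorted A B C E a≤b b≤c c≤d
  ... | inj₂ d≤c | inj₁ b≤d | _        = swap₂₃ (sorted A B E C a≤b b≤d d≤c)
  ... | inj₂ _   | inj₂ d≤b | inj₁ a≤d = swap₂₃ (swap₁₂ (sorted A E B C a≤d d≤b b≤c))
  ... | inj₂ _   | inj₂ _   | inj₂ d≤a = swap₂₃ (swap₁₂ (swap₀₁ (sorted E A B C d≤a a≤b b≤c)))
  insert₃ : ∀ {a b c d} → D a → D b → D c → D d → a ℕ.≤ b → Q a b c d
  insert₃ {a} {b} {c} A B C E a≤b with ℕ.≤-total b c | ℕ.≤-total a c
  ... | inj₁ b≤c | _        = insert₄ A B C E a≤b b≤c
  ... | inj₂ c≤b | inj₁ a≤c = swap₁₂ (insert₄ A C B E a≤c c≤b)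
  ... | inj₂ _   | inj₂ c≤a = swap₁₂ (swap₀₁ (insert₄ C A B E c≤a a≤b))
  any : ∀ {a b c d} → D a → D b → D c → D d → Q a b c d
  any {a} {b} A B C E with ℕ.≤-total a b
  ... | inj₁ a≤b = insert₃ A B C E a≤b
  ... | inj₂ b≤a = swap₀₁ (insert₃ B A C E b≤a)

-- Verdicts on the sorted quadruples.

histogram : ℕ → List ℕ → List ℕ
histogram n xs = applyUpTo (λ b → count b xs) n

Quad : Set
Quad = ℕ × ℕ × ℕ × ℕ

module Verdicts {G : Group 0ℓ 0ℓ} (𝒞 : Coding G) (gens reps : List X) (tables : Lookup)
  (size : ℕ) (js : List ℕ) (exceptions : List Quad) (pairs : List (Solution × Solution × ℕ × ℕ))
  {Impossible : (a b c d : ℕ) → Set} (impossible? : ∀ a b c d → Dec (Impossible a b c d)) where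

  open Coding 𝒞
  open Lookup tables
  open Checks 𝒞 gens reps tables using (rep)
  open Certificates 𝒞 gens reps tables

  n : ℕ
  n = length reps

  members : List (List X)
  members = applyUpTo O n

  -- Entry (j, a, b) is to be the length of `F j a b`. One list of class numbers per pair (j, a)
  -- serves all b.
  countsIn : List (List X) → List (List (List ℕ))
  countsIn Os = applyUpTo (λ j → applyUpTo (λ a → histogram n (map (λ x → cls (invˣ x · rep j)) (nth [] Os a))) n) n

  -- Point stabilisers in the form in which the tuples meet them: an
  -- involution, a transvection with its inverse, or three commuting involutions.
  invariantSets : List X → List X → List (List X)
  invariantSets involutions transvections =
    map (λ x → x ∷ []) involutions ++ map (λ x → x ∷ invˣ x ∷ []) transvections ++
    concatMap (λ x → map (λ y → x ∷ y ∷ x · y ∷ []) (filter (λ y → (x · y) ≟ˣ (y · x) ×-dec ¬? (x ≟ˣ y)) involutions)) involutions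

  -- The sum over the classes j of u = g₁ g₂, the number of factorisations depending on u only
  -- through its class. Leaving classes out of `js` keeps it a lower bound for |Σ̄|.
  bound : List ℕ → List (List (List ℕ)) → (a b c d : ℕ) → ℕ
  bound sizes counts a b c d = sumOver js λ j →
    nth 0 sizes j ℕ.* (at j a b ℕ.* at (inverseClass j) c d)
    where
    at : (j a b : ℕ) → ℕ
    at j a b = nth 0 (nth [] (nth [] counts j) a) b

  -- The alternatives are tried in this order, with the exhaustive search over pairs of elements
  -- last.
  data Verdict (Os : List (List X)) (sizes : List ℕ) (counts : List (List (List ℕ))) (sets : List (List X))
               (a b c d : ℕ) : Set where
    impossible  : Impossible a b c d → Verdict Os sizes counts sets a b c d
    large       : 4 ℕ.* size ℕ.≤ bound sizes counts a b c d → Verdict Os sizes counts sets a b c d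
    exceptional : (a , b , c , d) ∈ˡ exceptions → Verdict Os sizes counts sets a b c d
    two-orbits  : Any (λ (s , _) → let open Solution s renaming (a to a′; b to b′; c to c′; d to d′) in
                        (a , b , c , d) ≡ (a′ , b′ , c′ , d′)) pairs → Verdict Os sizes counts sets a b c d
    contained   : Exhausted (nth [] Os a) (nth [] Os b) c (rep d)
                    (Contained (filter (λ Ω → normalises? Ω (rep d)) sets)) → Verdict Os sizes counts sets a b c d

  verdict? : ∀ Os sizes counts sets a b c d → Dec (Verdict Os sizes counts sets a b c d)
  verdict? Os sizes counts sets a b c d = map′
    (λ { (inj₁ p) → impossible p ; (inj₂ (inj₁ p)) → large p ; (inj₂ (inj₂ (inj₁ p))) → exceptional p
       ; (inj₂ (inj₂ (inj₂ (inj₁ p)))) → two-orbits p ; (inj₂ (inj₂ (inj₂ (inj₂ p)))) → contained p })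
    (λ { (impossible p) → inj₁ p ; (large p) → inj₂ (inj₁ p) ; (exceptional p) → inj₂ (inj₂ (inj₁ p))
       ; (two-orbits p) → inj₂ (inj₂ (inj₂ (inj₁ p))) ; (contained p) → inj₂ (inj₂ (inj₂ (inj₂ p))) })
    (impossible? a b c d
     ⊎-dec 4 ℕ.* size ℕ.≤? bound sizes counts a b c d
     ⊎-dec some? (λ q → (a , b , c , d) ≟⁴ q) exceptions
     ⊎-dec some? (λ (s , _) → (a , b , c , d) ≟⁴ _) pairs
     ⊎-dec contained-in? (filter (λ Ω → normalises? Ω (rep d)) sets))
    where
    contained-in? : ∀ Ωs → Dec (Exhausted (nth [] Os a) (nth [] Os b) c (rep d) (Contained Ωs))
    contained-in? Ωs = exhausted? (nth [] Os a) (nth [] Os b) c (rep d) (contained? Ωs)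

  record Settled (Os : List (List X)) (sizes : List ℕ) (counts : List (List (List ℕ))) (sets : List (List X)) : Set where
    field
      verdicts   : All (λ a → 0 ℕ.< a → All (λ b → a ℕ.≤ b → All (λ c → b ℕ.≤ c → All (λ d → c ℕ.≤ d →
                     Verdict Os sizes counts sets a b c d) (upTo n)) (upTo n)) (upTo n)) (upTo n)
      notNormal  : All NotNormal sets
      distinct   : All Distinct pairs
      -- A numeral stands in for the length of the list, so that the comparisons in `large` do not
      -- evaluate it again.
      size-bound : length elements ℕ.≤ size

  settled? : ∀ Os sizes counts sets → Dec (Settled Os sizes counts sets)
  settled? Os sizes counts sets = map′
    (λ (p , q , r , s) → record { verdicts = p ; notNormal = q ; distinct = r ; size-bound = s })
    (λ t → let open Settled t in verdicts , notNormal , distinct , size-bound)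
    (every? (λ a → 0 ℕ.<? a →-dec every? (λ b → a ℕ.≤? b →-dec every? (λ c → b ℕ.≤? c →-dec every? (λ d → c ℕ.≤? d →-dec
       verdict? Os sizes counts sets a b c d) (upTo n)) (upTo n)) (upTo n)) (upTo n)
     ×-dec every? notNormal? sets
     ×-dec every? distinct? pairs
     ×-dec length elements ℕ.≤? size)

  -- Takes the tables one after the other as arguments, so that each of them is
  -- evaluated only once.
  Everything : Set
  Everything = Settled members (map length members) (countsIn members)
    (invariantSets (nth [] members 1) (nth [] members 2))

  everything? : Dec Everything
  everything? = from-elements elements
    where
    from-members : ∀ Os → Dec (Settled Os (map length Os) (countsIn Os) (invariantSets (nth [] Os 1) (nth [] Os 2)))
    from-members Os = settled? Os (map length Os) (countsIn Os) (invariantSets (nth [] Os 1) (nth [] Os 2))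
    from-elements : ∀ xs → let Os = applyUpTo (λ j → filter (λ x → cls x ℕ.≟ j) xs) n in
      Dec (Settled Os (map length Os) (countsIn Os) (invariantSets (nth [] Os 1) (nth [] Os 2)))
    from-elements xs = from-members (applyUpTo (λ j → filter (λ x → cls x ℕ.≟ j) xs) n)

-- Single orbits, and the lower bound for Σ̄.

module VerdictTheory {G : Group 0ℓ 0ℓ} (𝒞 : Coding G) (gens reps : List X) (tables : Lookup)
  (checked : Checks.AllChecked 𝒞 gens reps tables) where

  open Group G hiding (refl; sym; trans)
  private module G = Group G
  open Coding 𝒞
  open Lookup tables
  open Checks 𝒞 gens reps tables using (rep)
  open Tuples G
  open ClassTheory 𝒞 gens reps tables checked
  open Certificates 𝒞 gens reps tables
  open CertificateTheory 𝒞 gens reps tables checked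
  open RawMonoidSum rawMonoid using () renaming (sum to product)
  open VectorEquality setoid using (_≋_)

  intertwines : ∀ T {k A B x y} → code T ≡ k → code A ≡ x → code B ≡ y → k · x ≡ y · k → T ▷ A ≈ B
  intertwines T {A = A} {B} refl refl refl kx≡yk = begin
    T ∙ A ∙ T ⁻¹  ≈⟨ ∙-congʳ (code-injective (trans (code-∙ T A) (trans kx≡yk (sym (code-∙ B T))))) ⟩
    B ∙ T ∙ T ⁻¹  ≈⟨ //-rightDividesʳ T B ⟩
    B  ∎
    where
    open GroupProperties G using (//-rightDividesʳ)
    open SetoidReasoning G.setoid

  match-third : ∀ {t g : Tuple} → product t ≈ ε → product g ≈ ε →
    t 0F ≈ g 0F → t 1F ≈ g 1F → t 3F ≈ g 3F → t ≋ g
  match-third {t} {g} Πt≈ε Πg≈ε p₀ p₁ p₃ = four p₀ p₁ (begin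
    t 2F  ≈⟨ product⇒third t Πt≈ε ⟩
    (t 3F ∙ t 0F ∙ t 1F) ⁻¹  ≈⟨ ⁻¹-cong (∙-cong (∙-cong p₃ p₀) p₁) ⟩
    (g 3F ∙ g 0F ∙ g 1F) ⁻¹  ≈⟨ product⇒third g Πg≈ε ⟨
    g 2F  ∎) p₃
    where open SetoidReasoning G.setoid

  SingleOrbit : Solution → Set
  SingleOrbit s = Exhausted (O a) (O b) c (rep d) (Conjugated (centralizer (rep d)) x y)
    where open Solution s

  -- Some l moves the last entry of a given tuple to `rep d`; the exhaustive check then finds k in
  -- the centralizer of `rep d` that takes t to the moved tuple. Hence l⁻¹ k takes t to the given
  -- one.
  conjugated⇒strictlyRigid : ∀ s → Valid s → SingleOrbit s → StrictlyRigid G (solutionClasses s)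
  conjugated⇒strictlyRigid s v exhausted = single-orbit⇒strictlyRigid C-inv t∈Σ single
    where
    open Solution s
    C-inv : ∀ i → IsInvariant (Cls a b c d i)
    C-inv = Cls-invariant {a} {b} {c} {d}
    t : Tuple
    t = proj₁ (solution-tuple s v)
    t∈Σ : InΣ G (Cls a b c d) t
    t∈Σ = proj₁ (proj₂ (solution-tuple s v))
    t₀ : code (t 0F) ≡ x
    t₀ = proj₁ (proj₂ (proj₂ (solution-tuple s v)))
    t₁ : code (t 1F) ≡ y
    t₁ = proj₁ (proj₂ (proj₂ (proj₂ (solution-tuple s v))))
    t₃ : code (t 3F) ≡ rep d
    t₃ = proj₂ (proj₂ (proj₂ (proj₂ (solution-tuple s v))))
    module _ {g : Tuple} (g∈ : InΣ̄ G (Cls a b c d) g) (l : Carrier) (w≡ : code (l ▷ g 3F) ≡ rep d) where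
      reach : ∀ k → k ∈ˡ centralizer (rep d) → k · x ≡ code (l ▷ g 0F) · k → k · y ≡ code (l ▷ g 1F) · k →
              ∃[ m ] (m ▶ t ≋ g)
      reach k k∈ kx≡ ky≡ = l ⁻¹ ∙ κ , transporter {t} {g} (match-third {κ ▶ t} {l ▶ g}
        (proj₂ (▶-InΣ̄ C-inv κ {t} (proj₁ t∈Σ))) (proj₂ (▶-InΣ̄ C-inv l {g} g∈))
        (intertwines κ κ≡ t₀ refl kx≡) (intertwines κ κ≡ t₁ refl ky≡) (intertwines κ κ≡ t₃ w≡ kw≡))
        where
        k∈′ : k ∈ˡ elements × k · rep d ≡ rep d · k
        k∈′ = ∈-filter⁻ (λ k → (k · rep d) ≟ˣ (rep d · k)) {xs = elements} k∈
        kw≡ : k · rep d ≡ rep d · k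
        kw≡ = proj₂ k∈′
        κ : Carrier
        κ = proj₁ (decode (All.lookup elements-valid (proj₁ k∈′)))
        κ≡ : code κ ≡ k
        κ≡ = proj₂ (decode (All.lookup elements-valid (proj₁ k∈′)))
    single : ∀ {g} → InΣ̄ G (Cls a b c d) g → ∃[ m ] (m ▶ t ≋ g)
    single {g} g∈ with normalise-tuple {a} {b} {c} {d} {Conjugated (centralizer (rep d)) x y} {g} exhausted g∈
    ... | l , w≡ , conjugated with find conjugated
    ...   | k , k∈ , kx≡ , ky≡ = reach {g} g∈ l w≡ k k∈ kx≡ ky≡

  -- A factorisation of the representative r is conjugated by κ, where U = κ r κ⁻¹. The last
  -- component says A = κ x κ⁻¹, from which x can be read off again.
  factor : ∀ {a b} U {x} → x ∈ˡ F (cls (code U)) a b →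
    ∃₂ λ A B → Cl a A × Cl b B × A ∙ B ≈ U × code A · conjugator (code U) ≡ conjugator (code U) · x
  factor {a} {b} U {x} x∈F =
    κ ▷ X′ , (κ ▷ X′) ⁻¹ ∙ U ,
    closed (Cl-invariant a) κ (trans (cong cls X≡) cls-x) ,
    respects (Cl-invariant b) (begin
      κ ▷ (X′ ⁻¹ ∙ ((κ ⁻¹) ▷ U))  ≈⟨ ▷-homo κ _ _ ⟩
      (κ ▷ (X′ ⁻¹)) ∙ (κ ▷ ((κ ⁻¹) ▷ U))  ≈⟨ ∙-cong (▷-⁻¹ κ X′) (▷⁻¹▷ κ U) ⟩
      (κ ▷ X′) ⁻¹ ∙ U  ∎)
      (closed (Cl-invariant b) κ (trans (cong cls (trans (code-∙ _ _)
        (cong₂ _·_ (trans (code-⁻¹ X′) (cong invˣ X≡)) (conjugator-▷ U κ κ≡)))) cls-y)) ,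
    \\-leftDividesˡ (κ ▷ X′) U ,
    trans (cong (code (κ ▷ X′) ·_) (sym κ≡)) (trans (sym (code-∙ (κ ▷ X′) κ)) (trans (code-cong (▷-∙ κ X′))
      (trans (code-∙ κ X′) (cong₂ _·_ κ≡ X≡))))
    where
    open GroupProperties G using (\\-leftDividesˡ)
    open SetoidReasoning G.setoid
    j = cls (code U)
    ∈F = ∈-filter⁻ (λ x → cls (invˣ x · rep j) ℕ.≟ b) {xs = O a} x∈F
    ∈O = ∈-filter⁻ (λ x → cls x ℕ.≟ a) {xs = elements} (proj₁ ∈F)
    cls-x = proj₂ ∈O
    cls-y = proj₂ ∈F
    κ = proj₁ (conjugatorᴳ U)
    κ≡ = proj₂ (conjugatorᴳ U)
    X′ = proj₁ (decode (All.lookup elements-valid (proj₁ ∈O)))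
    X≡ = proj₂ (decode (All.lookup elements-valid (proj₁ ∈O)))

  cls-⁻¹ : ∀ U → cls (code (U ⁻¹)) ≡ inverseClass (cls (code U))
  cls-⁻¹ U = let K , KU≡r = normalise U in begin
    cls (code (U ⁻¹))  ≡⟨ cls-▷ K (U ⁻¹) ⟨
    cls (code (K ▷ (U ⁻¹)))  ≡⟨ cong cls (trans (code-cong (▷-⁻¹ K U)) (code-⁻¹ (K ▷ U))) ⟩
    cls (invˣ (code (K ▷ U)))  ≡⟨ cong (cls ∘ invˣ) KU≡r ⟩
    inverseClass (cls (code U))  ∎
    where open ≡-Reasoning

  module _ (a b c d : ℕ) where
    -- Factorisations are taken at the representatives only, so all u of one class share the same
    -- two lists.
    triples : ℕ → List (X × X × X)
    triples j = cartesianProduct (O j) (cartesianProduct (F j a b) (F (inverseClass j) c d))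

    -- The triple (u , x , z) stands for the tuple whose first two entries
    -- multiply to u, where x and z describe its first and third entry after
    -- u and u⁻¹ are conjugated to representatives.
    Encodes : X × X × X → Tuple → Set
    Encodes (u , x , z) g = code (g 0F ∙ g 1F) ≡ u ×
      code (g 0F) · conjugator u ≡ conjugator u · x ×
      code (g 2F) · conjugator (invˣ u) ≡ conjugator (invˣ u) · z

    -- The tuple determines u, hence both conjugators, and cancelling these in the two equations
    -- determines x and z.
    encoded-injective : ∀ {t t′ g h} → Encodes t g → Encodes t′ h → g ≋ h → t ≡ t′
    encoded-injective {u , x , z} {u′ , x′ , z′} {g} {h} (refl , gx , gz) (hu , hx , hz) g≋h =
      go (trans (sym hu) (code-cong (G.sym (∙-cong (g≋h 0F) (g≋h 1F)))))
      where
      U = g 0F ∙ g 1F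
      cancel : ∀ V v {y y′} → code V ≡ v → conjugator v · y ≡ conjugator v · y′ → y ≡ y′
      cancel V v refl eq = let K , K≡ = conjugatorᴳ V in
        ·-cancelˡ K (trans (cong (_· _) K≡) (trans eq (cong (_· _) (sym K≡))))
      go : u′ ≡ u → (u , x , z) ≡ (u′ , x′ , z′)
      go refl = cong₂ _,_ refl (cong₂ _,_
        (cancel U u refl (trans (sym gx) (trans (cong (_· conjugator u) (code-cong (g≋h 0F))) hx)))
        (cancel (U ⁻¹) (invˣ u) (code-⁻¹ U)
          (trans (sym gz) (trans (cong (_· conjugator (invˣ u)) (code-cong (g≋h 2F))) hz))))

    combine : ∀ U {x z} → x ∈ˡ F (cls (code U)) a b → z ∈ˡ F (cls (code (U ⁻¹))) c d →
      Σ[ g ∈ Tuple ] InΣ̄ G (Cls a b c d) g × Encodes (code U , x , z) g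
    combine U {x} {z} x∈ z∈ with factor {a} {b} U x∈ | factor {c} {d} (U ⁻¹) z∈
    ... | A , B , a∈ , b∈ , AB≈U , Ax | C , D , c∈ , d∈ , CD≈U⁻¹ , Cz =
      quad A B C D ,
      (four a∈ b∈ c∈ d∈ , (begin
         A ∙ (B ∙ (C ∙ (D ∙ ε)))  ≈⟨ assoc A B _ ⟨
         A ∙ B ∙ (C ∙ (D ∙ ε))  ≈⟨ ∙-cong AB≈U (∙-congˡ (identityʳ D)) ⟩
         U ∙ (C ∙ D)  ≈⟨ ∙-congˡ CD≈U⁻¹ ⟩
         U ∙ U ⁻¹  ≈⟨ inverseʳ U ⟩
         ε  ∎)) ,
      code-cong AB≈U , Ax ,
      subst (λ v → code C · conjugator v ≡ conjugator v · z) (code-⁻¹ U) Cz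
      where open SetoidReasoning G.setoid

    decode-triple : ∀ {j t} → t ∈ˡ triples j → Σ[ g ∈ Tuple ] InΣ̄ G (Cls a b c d) g × Encodes t g
    decode-triple {j} {u , x , z} t∈ = go (proj₁ U) (proj₂ U)
      where
      u∈,xz∈ : u ∈ˡ O j × (x , z) ∈ˡ cartesianProduct (F j a b) (F (inverseClass j) c d)
      u∈,xz∈ = ∈-cartesianProduct⁻ (O j) _ t∈
      xz∈ : x ∈ˡ F j a b × z ∈ˡ F (inverseClass j) c d
      xz∈ = ∈-cartesianProduct⁻ (F j a b) _ (proj₂ u∈,xz∈)
      u∈ : u ∈ˡ elements × cls u ≡ j
      u∈ = ∈-filter⁻ (λ x → cls x ℕ.≟ j) {xs = elements} (proj₁ u∈,xz∈)
      U : ∃[ U ] code U ≡ u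
      U = decode (All.lookup elements-valid (proj₁ u∈))
      go : ∀ U → code U ≡ u → Σ[ g ∈ Tuple ] InΣ̄ G (Cls a b c d) g × Encodes (u , x , z) g
      go U refl = combine U
        (subst (λ j → x ∈ˡ F j a b) (sym (proj₂ u∈)) (proj₁ xz∈))
        (subst (λ j → z ∈ˡ F j c d) (sym (trans (cls-⁻¹ U) (cong inverseClass (proj₂ u∈)))) (proj₂ xz∈))

    -- The triples for all j in `js` inject into Σ̄. Triples for different j are distinct since u
    -- has class j.
    large⇒¬μ̄<4 : ∀ {js} → Unique js → 4 ℕ.* order ℕ.≤ sumOver js (length ∘ triples) → ¬ μ̄<4 G (Cls a b c d)
    large⇒¬μ̄<4 {js} js-unique large (q , r , q<4) =
      let m , n , s , t , m<4n = SizeRatio-<4 {Σ̄-setoid (Cls a b c d)} {setoid} r q<4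
          n≡order = HasSize-unique {S = setoid} t G-HasSize
      in ℕ.<⇒≱ m<4n (ℕ.≤-trans (subst (λ k → 4 ℕ.* k ℕ.≤ sumOver js (length ∘ triples)) (sym n≡order) large)
           (subst (ℕ._≤ m) (length-concatMap triples js) (length-≤-size {S = Σ̄-setoid (Cls a b c d)} s all-unique
             (λ t∈ → let g , g∈ , _ = decode′ t∈ in g , g∈)
             (λ p p′ → encoded-injective (proj₂ (proj₂ (decode′ p))) (proj₂ (proj₂ (decode′ p′)))))))
      where
      all-unique : Unique (concatMap triples js)
      all-unique = Unique-concatMap triples (λ (u , _) → cls u)
        (λ j → Unique.cartesianProduct⁺ (O-unique j) (Unique.cartesianProduct⁺ (F-unique j a b) (F-unique (inverseClass j) c d)))
        (λ j {t} t∈ → proj₂ (∈-filter⁻ (λ x → cls x ℕ.≟ j) {xs = elements} (proj₁ (∈-cartesianProduct⁻ (O j) _ t∈))))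
        js-unique
        where
        O-unique : ∀ j → Unique (O j)
        O-unique j = Unique.filter⁺ _ elements-unique
        F-unique : ∀ j a b → Unique (F j a b)
        F-unique j a b = Unique.filter⁺ _ (O-unique a)
      decode′ : ∀ {t} → t ∈ˡ concatMap triples js → Σ[ g ∈ Tuple ] InΣ̄ G (Cls a b c d) g × Encodes t g
      decode′ t∈ = let j , _ , t∈j = find (∈-concatMap⁻ triples {xs = js} t∈) in decode-triple {j} t∈j

nth-map : {A B : Set} (f : A → B) {d : A} (xs : List A) (i : ℕ) → nth (f d) (map f xs) i ≡ f (nth d xs i)
nth-map f []       i       = refl
nth-map f (x ∷ xs) zero    = refl
nth-map f (x ∷ xs) (suc i) = nth-map f xs i

-- From the verdicts to arbitrary quadruples of classes.

module Conclusion {G : Group 0ℓ 0ℓ} (𝒞 : Coding G) (gens reps : List X) (tables : Lookup)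
  (checked : Checks.AllChecked 𝒞 gens reps tables)
  (size : ℕ) (js : List ℕ) (exceptions : List Quad) (pairs : List (Solution × Solution × ℕ × ℕ))
  {Impossible : (a b c d : ℕ) → Set} (impossible? : ∀ a b c d → Dec (Impossible a b c d))
  (js-unique : Unique js) (js-bound : All (ℕ._< length reps) js)
  (impossible⇒empty : ∀ {a b c d} → Impossible a b c d → ∀ {g} →
    ¬ InΣ G (ClassTheory.Cls 𝒞 gens reps tables checked a b c d) g)
  (everything : Verdicts.Everything 𝒞 gens reps tables size js exceptions pairs impossible?) where

  open Tuples G
  open ClassTheory 𝒞 gens reps tables checked
  open Coding 𝒞
  open Lookup tables
  open Checks 𝒞 gens reps tables using (rep)
  open Certificates 𝒞 gens reps tables
  open CertificateTheory 𝒞 gens reps tables checked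
  open VerdictTheory 𝒞 gens reps tables checked
  open Verdicts 𝒞 gens reps tables size js exceptions pairs impossible?
  open Settled everything

  members-O : ∀ {a} → a ℕ.< n → nth [] members a ≡ O a
  members-O = nth-applyUpTo O

  inverseClass-bound : ∀ j → inverseClass j ℕ.< n
  inverseClass-bound j = go (decode (rep-valid j))
    where
    go : (∃[ A ] code A ≡ rep j) → inverseClass j ℕ.< n
    go (A , A≡) = subst (λ x → cls x ℕ.< n) (trans (code-⁻¹ A) (cong invˣ A≡)) (cls-bound (Group._⁻¹ G A))

  counts-F : ∀ {j a b} → j ℕ.< n → a ℕ.< n → b ℕ.< n →
    nth 0 (nth [] (nth [] (countsIn members) j) a) b ≡ length (F j a b)
  counts-F {j} {a} {b} j<n a<n b<n = begin
    nth 0 (nth [] (nth [] (countsIn members) j) a) b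
      ≡⟨ cong (λ l → nth 0 (nth [] l a) b) (nth-applyUpTo _ j<n) ⟩
    nth 0 (nth [] (applyUpTo (λ a → histogram n (map class (nth [] members a))) n) a) b
      ≡⟨ cong (λ l → nth 0 l b) (nth-applyUpTo _ a<n) ⟩
    nth 0 (histogram n (map class (nth [] members a))) b
      ≡⟨ nth-applyUpTo _ b<n ⟩
    count b (map class (nth [] members a))
      ≡⟨ cong (λ l → count b (map class l)) (members-O a<n) ⟩
    count b (map class (O a))
      ≡⟨ count-map class b (O a) ⟩
    length (F j a b) ∎
    where
    open ≡-Reasoning
    class : X → ℕ
    class x = cls (invˣ x · rep j)

  bound-triples : ∀ {a b c d} → a ℕ.< n → b ℕ.< n → c ℕ.< n → d ℕ.< n →
    bound (map length members) (countsIn members) a b c d ≡ sumOver js (length ∘ triples a b c d)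
  bound-triples {a} {b} {c} {d} a<n b<n c<n d<n = sumOver-cong (All.map term js-bound)
    where
    open ≡-Reasoning
    term : ∀ {j} → j ℕ.< n → _ ≡ length (triples a b c d j)
    term {j} j<n = begin
      _ ≡⟨ cong₂ ℕ._*_ (trans (nth-map length members j) (cong length (members-O j<n)))
             (cong₂ ℕ._*_ (counts-F j<n a<n b<n) (counts-F (inverseClass-bound j) c<n d<n)) ⟩
      length (O j) ℕ.* (length (F j a b) ℕ.* length (F (inverseClass j) c d))
        ≡⟨ cong (length (O j) ℕ.*_) (length-cartesianProduct (F j a b) _) ⟨
      length (O j) ℕ.* length (cartesianProduct (F j a b) (F (inverseClass j) c d))
        ≡⟨ length-cartesianProduct (O j) _ ⟨
      length (triples a b c d j) ∎

  sets : List (List X)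
  sets = invariantSets (nth [] members 1) (nth [] members 2)

  refute : ∀ {a b c d} → a ℕ.< n → b ℕ.< n → c ℕ.< n → d ℕ.< n →
    Verdict members (map length members) (countsIn members) sets a b c d →
    Rigid G (Cls a b c d) → μ̄<4 G (Cls a b c d) → (a , b , c , d) ∈ˡ exceptions
  refute {a} {b} {c} {d} _ _ _ _ (impossible i) rigid _ = contradiction rigid
    (empty⇒¬rigid {Cls a b c d} (λ {g} → impossible⇒empty {a} {b} {c} {d} i {g}))
  refute {a} {b} {c} {d} a<n b<n c<n d<n (large l) _ μ̄ = contradiction μ̄
    (large⇒¬μ̄<4 a b c d js-unique (ℕ.≤-trans (ℕ.*-monoʳ-≤ 4 size-bound)
      (subst (4 ℕ.* size ℕ.≤_) (bound-triples {a} {b} {c} {d} a<n b<n c<n d<n) l)))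
  refute _ _ _ _ (exceptional e) _ _ = e
  refute _ _ _ _ (two-orbits two) rigid _ with find two
  ... | p , p∈ , refl = contradiction rigid (distinct⇒¬rigid p (All.lookup distinct p∈))
  refute {a} {b} {c} {d} a<n b<n _ _ (contained e) rigid _ = contradiction rigid
    (empty⇒¬rigid {Cls a b c d} (contained⇒empty {a} {b} {c} {d} (filter (λ Ω → normalises? Ω (rep d)) sets)
      (All.filter⁺ (λ Ω → normalises? Ω (rep d)) notNormal)
      (All.all-filter (λ Ω → normalises? Ω (rep d)) sets)
      (subst₂ (λ xs ys → Exhausted xs ys c (rep d) _) (members-O a<n) (members-O b<n) e)))

  InRange : Pred ℕ 0ℓ
  InRange a = 0 ℕ.< a × a ℕ.< n

  sorted-exceptions : ∀ {a b c d} → InRange a → InRange b → InRange c → InRange d →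
    a ℕ.≤ b → b ℕ.≤ c → c ℕ.≤ d → Rigid G (Cls a b c d) → μ̄<4 G (Cls a b c d) → (a , b , c , d) ∈ˡ exceptions
  sorted-exceptions (0<a , a<n) (_ , b<n) (_ , c<n) (_ , d<n) a≤b b≤c c≤d = refute a<n b<n c<n d<n
    (All.lookup (All.lookup (All.lookup (All.lookup verdicts (∈-upTo⁺ a<n) 0<a)
      (∈-upTo⁺ b<n) a≤b) (∈-upTo⁺ c<n) b≤c) (∈-upTo⁺ d<n) c≤d)

  -- Rigidity and the bound on μ̄ follow a quadruple through the moves that sort it; `Good`, stable
  -- under the same moves, is carried back from the sorted quadruple.
  rigid-quadruples : (Good : (a b c d : ℕ) → Set) →
    (∀ {a b c d} → Good b a c d → Good a b c d) → (∀ {a b c d} → Good b c d a → Good a b c d) →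
    (∀ {a b c d} → (a , b , c , d) ∈ˡ exceptions → Good a b c d) →
    ∀ {C} → NonIdentityClasses G C → Rigid G C → μ̄<4 G C →
    Σ[ J ∈ Vector ℕ 4 ] (∀ i → C i ≐ Cl (J i)) × Good (J 0F) (J 1F) (J 2F) (J 3F)
  rigid-quadruples Good Good-swap Good-rotate Good-exception {C} nonid rigid μ̄ =
    let J , range , C≃ , C≐ = classes-indices {C} nonid
    in J , C≐ , sort-wlog InRange
      (λ a b c d → Rigid G (Cls a b c d) → μ̄<4 G (Cls a b c d) → Good a b c d)
      (λ {a} {b} {c} {d} q r m → Good-swap (q
        (rigid-resp (swap {c = Cl c} {Cl d} (Cl-invariant a) (Cl-invariant b)) r)
        (μ̄<4-resp (swap {c = Cl c} {Cl d} (Cl-invariant a) (Cl-invariant b)) m)))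
      (λ {a} {b} {c} {d} q r m → Good-rotate (q
        (rigid-resp (rotate {Cl a} {Cl b} {Cl c} {Cl d}) r) (μ̄<4-resp (rotate {Cl a} {Cl b} {Cl c} {Cl d}) m)))
      (λ p q r s a≤b b≤c c≤d rigid μ̄ → Good-exception (sorted-exceptions p q r s a≤b b≤c c≤d rigid μ̄))
      (range 0F) (range 1F) (range 2F) (range 3F) (rigid-resp C≃ rigid) (μ̄<4-resp C≃ μ̄)

-- Tables and certificates for Γ.

digits : ℕ → ℕ → List ℕ
digits zero    _ = []
digits (suc n) k = k ℕ.% 10 ∷ digits n (k ℕ./ 10)

-- The nine decimal digits are the indices of the entries.
matrix : ℕ → M
matrix k = go (map fromIndex (digits 9 k))
  where
  go : List K → M
  -- The digits arrive least significant first, hence the reversed order.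
  go (i ∷ h ∷ g ∷ f ∷ e ∷ d ∷ c ∷ b ∷ a ∷ []) = mk a b c d e f g h i
  go _ = 𝟙

-- `σ` and `τ` generate Γ; `υ` is an involution outside Γ, and `σ` and `υ` generate Γ.2.
σ τ υ : X
σ = lin (matrix 045047100)
τ = lin (matrix 020200002)
υ = semi (matrix 001020100)

-- One representative for each of the 14 classes. Places 1 to 4 hold 2A, 3A, 4A and 4B, an order on
-- which `twistIndex` and `quadruple-index` rely.
Γ-gens Γ-reps : List X
Γ-gens = σ ∷ τ ∷ []
Γ-reps =
  lin (matrix 100010001) ∷
  lin (matrix 020200002) ∷
  lin (matrix 100044057) ∷
  lin (matrix 300030002) ∷
  lin (matrix 600060002) ∷
  lin (matrix 001100010) ∷
  lin (matrix 001010200) ∷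
  lin (matrix 100054058) ∷
  lin (matrix 045047100) ∷
  lin (matrix 001770840) ∷
  lin (matrix 001030300) ∷
  lin (matrix 001060600) ∷
  lin (matrix 001450470) ∷
  lin (matrix 001480770) ∷ []

-- The letters 0, 1, 2 of a word are given by the digits 1, 2, 3, the first
-- letter being the last digit.
word : ℕ → Word
word k = go (digits 13 k)
  where
  go : List ℕ → Word
  go (suc i ∷ is) = i ∷ go is
  go _            = []

Γ-pairs : List (Solution × Solution × ℕ × ℕ)
Γ-pairs =
  (solution 1 1 3 7 (lin (matrix 114118750)) (lin (matrix 200001010)) (word 13231323 ∷ word 132331 ∷ []) ,
   solution 1 1 3 7 (lin (matrix 200001010)) (lin (matrix 141705181)) (word 31323132 ∷ word 3323333121 ∷ []) , 0 , 2) ∷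
  (solution 1 1 4 7 (lin (matrix 115117840)) (lin (matrix 200003060)) (word 232132313 ∷ word 12332321 ∷ []) ,
   solution 1 1 4 7 (lin (matrix 200002020)) (lin (matrix 115117840)) (word 1231332321 ∷ word 21313312 ∷ []) , 0 , 2) ∷
  (solution 1 2 3 7 (lin (matrix 115117840)) (lin (matrix 708010704)) (word 23223233333 ∷ word 2333331322 ∷ []) ,
   solution 1 2 3 7 (lin (matrix 146704371)) (lin (matrix 704010504)) (word 23122312123 ∷ word 3233213 ∷ []) , 0 , 1) ∷
  (solution 1 2 3 12 (lin (matrix 002020200)) (lin (matrix 100075044)) (word 2231322 ∷ word 1321232121 ∷ []) ,
   solution 1 2 3 12 (lin (matrix 003020600)) (lin (matrix 100074054)) (word 132213313 ∷ word 1213221321 ∷ []) , 0 , 2) ∷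
  (solution 1 2 4 7 (lin (matrix 114118750)) (lin (matrix 480770001)) (word 13332232332 ∷ word 233322 ∷ []) ,
   solution 1 2 4 7 (lin (matrix 141705181)) (lin (matrix 470870001)) (word 32332322331 ∷ word 223332 ∷ []) , 0 , 1) ∷
  (solution 1 2 4 13 (lin (matrix 002020200)) (lin (matrix 100047087)) (word 231322 ∷ word 12321232 ∷ []) ,
   solution 1 2 4 13 (lin (matrix 006020300)) (lin (matrix 100044057)) (word 23221221 ∷ word 122132313 ∷ []) , 0 , 2) ∷
  (solution 1 3 3 13 (lin (matrix 030600002)) (lin (matrix 218373812)) (word 2331233231 ∷ word 331332212 ∷ []) ,
   solution 1 3 3 13 (lin (matrix 167318450)) (lin (matrix 707030507)) (word 32213321 ∷ word 231312331 ∷ []) , 0 , 2) ∷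
  (solution 1 3 4 6 (lin (matrix 010100002)) (lin (matrix 227671532)) (word 3212132123 ∷ word 33133 ∷ []) ,
   solution 1 3 4 6 (lin (matrix 010100002)) (lin (matrix 273521137)) (word 232232313 ∷ word 33133 ∷ []) , 0 , 1) ∷
  (solution 1 4 4 12 (lin (matrix 020200002)) (lin (matrix 265141562)) (word 2213221 ∷ word 1 ∷ []) ,
   solution 1 4 4 12 (lin (matrix 114118750)) (lin (matrix 404060804)) (word 333231321 ∷ word 322122312 ∷ []) , 0 , 2) ∷
  (solution 2 2 3 5 (lin (matrix 100045047)) (lin (matrix 722176167)) (word 133 ∷ word 123123232211 ∷ []) ,
   solution 2 2 3 5 (lin (matrix 711276267)) (lin (matrix 100075044)) (word 32313131 ∷ word 3123131232211 ∷ []) , 0 , 2) ∷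
  (solution 2 2 3 7 (lin (matrix 100075044)) (lin (matrix 440570001)) (word 23231221 ∷ word 132132 ∷ []) ,
   solution 2 2 3 7 (lin (matrix 440570001)) (lin (matrix 100077084)) (word 1321322311 ∷ word 321321 ∷ []) , 0 , 2) ∷
  (solution 2 2 3 13 (lin (matrix 405010407)) (lin (matrix 100047087)) (word 33312321 ∷ word 33323332 ∷ []) ,
   solution 2 2 3 13 (lin (matrix 705010404)) (lin (matrix 100047087)) (word 3122311 ∷ word 33333312 ∷ []) , 0 , 1) ∷
  (solution 2 2 4 5 (lin (matrix 100048077)) (lin (matrix 423141324)) (word 3112322 ∷ word 2231232312311 ∷ []) ,
   solution 2 2 4 5 (lin (matrix 411243234)) (lin (matrix 100048077)) (word 3122113 ∷ word 3123131232211 ∷ []) , 0 , 2) ∷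
  (solution 2 2 4 7 (lin (matrix 100075044)) (lin (matrix 704010504)) (word 121332112 ∷ word 23121321 ∷ []) ,
   solution 2 2 4 7 (lin (matrix 704010504)) (lin (matrix 100077084)) (word 332132132 ∷ word 21312131 ∷ []) , 0 , 2) ∷
  (solution 2 2 4 12 (lin (matrix 408010707)) (lin (matrix 100075044)) (word 1123112 ∷ word 321233121 ∷ []) ,
   solution 2 2 4 12 (lin (matrix 440570001)) (lin (matrix 408010707)) (word 313312132 ∷ word 33112233 ∷ []) , 0 , 1) ∷
  (solution 2 3 3 5 (lin (matrix 100045047)) (lin (matrix 227671532)) (word 133 ∷ word 1213121121 ∷ []) ,
   solution 2 3 3 5 (lin (matrix 100045047)) (lin (matrix 246423217)) (word 133 ∷ word 113223211311 ∷ []) , 0 , 1) ∷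
  (solution 2 3 3 6 (lin (matrix 404010507)) (lin (matrix 713327152)) (word 3123221 ∷ word 11321132 ∷ []) ,
   solution 2 3 3 6 (lin (matrix 711276267)) (lin (matrix 242421637)) (word 31312223 ∷ word 3312323 ∷ []) , 0 , 2) ∷
  (solution 2 3 4 12 (lin (matrix 100077084)) (lin (matrix 770570003)) (word 113131 ∷ word 31122312 ∷ []) ,
   solution 2 3 4 12 (lin (matrix 407010807)) (lin (matrix 300075077)) (word 323132132 ∷ word 22312233 ∷ []) , 1 , 2) ∷
  (solution 2 3 4 13 (lin (matrix 100045047)) (lin (matrix 704030407)) (word 12313 ∷ word 1223213121 ∷ []) ,
   solution 2 3 4 13 (lin (matrix 404010507)) (lin (matrix 707030507)) (word 1223132 ∷ word 321322 ∷ []) , 1 , 2) ∷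
  (solution 2 4 4 5 (lin (matrix 100048077)) (lin (matrix 227346712)) (word 2213221 ∷ word 3221311311311 ∷ []) ,
   solution 2 4 4 5 (lin (matrix 100048077)) (lin (matrix 271722634)) (word 3223212331 ∷ word 312231211 ∷ []) , 0 , 1) ∷
  (solution 2 4 4 6 (lin (matrix 404010507)) (lin (matrix 242826314)) (word 1123222311 ∷ word 31213121 ∷ []) ,
   solution 2 4 4 6 (lin (matrix 411243234)) (lin (matrix 272721364)) (word 21223233 ∷ word 3312323 ∷ []) , 0 , 2) ∷ []

-- The five quadruples and their images under the outer involution, which exchanges 3 and 4, each of
-- them sorted.
Γ-exceptions : List Quad
Γ-exceptions =
  (1 , 1 , 2 , 3) ∷ (1 , 1 , 2 , 4) ∷ (1 , 3 , 3 , 3) ∷ (1 , 4 , 4 , 4) ∷ (2 , 2 , 2 , 3) ∷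
  (2 , 2 , 2 , 4) ∷ (2 , 2 , 3 , 3) ∷ (2 , 2 , 4 , 4) ∷ (3 , 3 , 3 , 4) ∷ (3 , 4 , 4 , 4) ∷ []

Γ-never? : (a b c d : ℕ) → Dec ⊥
Γ-never? _ _ _ _ = no λ ()

opaque
  Γ-tables : Lookup
  Γ-tables = lookups (classTree Γ-gens Γ-reps) (cayleyTree Γ-gens)

-- The classes stand in the order of `quadruple`, which is not always sorted.
rigid-solution : Fin 5 → Solution
rigid-solution 0F = solution 2 2 2 4 (lin (matrix 100074054)) (lin (matrix 411243234)) ((word 11332213211) ∷ (word 233212133211) ∷ [])
rigid-solution 1F = solution 3 3 3 4 (lin (matrix 241422367)) (lin (matrix 300078087)) ((word 12221213) ∷ (word 113311) ∷ [])
rigid-solution 2F = solution 1 1 2 3 (lin (matrix 044712721)) (lin (matrix 055812821)) ((word 3232133) ∷ (word 123233321) ∷ [])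
rigid-solution 3F = solution 3 3 3 1 (lin (matrix 224673412)) (lin (matrix 300078087)) ((word 3111211) ∷ (word 3) ∷ [])
rigid-solution 4F = solution 3 3 2 2 (lin (matrix 300075077)) (lin (matrix 740470003)) ((word 31221311) ∷ (word 3113322) ∷ [])

-- The classes 2A, 3A, 4A and 4B by their class numbers.

minusOne : M → Fin 3 → Fin 3 → K
minusOne m i j = entry m i j ⊖ entry 𝟙 i j

-- All 2×2 minors of m - 1 vanish, that is, its rank is at most one.
RankOne : M → Set
RankOne m = ∀ i k j l → minusOne m i j ⊙ minusOne m k l ≡ minusOne m i l ⊙ minusOne m k j

rankOne? : ∀ m → Dec (RankOne m)
rankOne? m = Fin.all? λ i → Fin.all? λ k → Fin.all? λ j → Fin.all? λ l →
  (minusOne m i j ⊙ minusOne m k l) ≟ᴷ (minusOne m i l ⊙ minusOne m k j)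

update : Column → Column → M
update (a , b , c) (x , y , z) = mk
  (k1 ⊕ a ⊙ x) (k0 ⊕ a ⊙ y) (k0 ⊕ a ⊙ z)
  (k0 ⊕ b ⊙ x) (k1 ⊕ b ⊙ y) (k0 ⊕ b ⊙ z)
  (k0 ⊕ c ⊙ x) (k0 ⊕ c ⊙ y) (k1 ⊕ c ⊙ z)

IsTransvection : M → Column × Column → Set
IsTransvection m (v@(a , b , c) , f@(x , y , z)) =
  v ≢ (k0 , k0 , k0) × f ≢ (k0 , k0 , k0) × dot x y z a b c ≡ k0 × update v f ≡ m

isTransvection? : ∀ m vf → Dec (IsTransvection m vf)
isTransvection? m (v@(a , b , c) , f@(x , y , z)) =
  ¬? (v ≟ᶜ _) ×-dec ¬? (f ≟ᶜ _) ×-dec dot x y z a b c ≟ᴷ k0 ×-dec update v f ≟ᴹ m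
  where
  _≟ᶜ_ : DecidableEquality Column
  _≟ᶜ_ = ≡-dec _≟ᴷ_ (≡-dec _≟ᴷ_ _≟ᴷ_)

-- A matrix of rank one is the product of one of its columns and a multiple of
-- one of its rows.
factorisations : M → List (Column × Column)
factorisations m = concatMap (λ q → concatMap (λ p → map (λ c →
    (n 0F q , n 1F q , n 2F q) , (c ⊙ n p 0F , c ⊙ n p 1F , c ⊙ n p 2F)) allK) (allFin 3)) (allFin 3)
  where n = minusOne m

fromVec : Vec₃ → Column
fromVec v = fromF₉ (v 0F) , fromF₉ (v 1F) , fromF₉ (v 2F)

toVec : Column → Vec₃
toVec (a , b , c) 0F = toF₉ a
toVec (a , b , c) 1F = toF₉ b
toVec (a , b , c) 2F = toF₉ c

fromVec-toVec : ∀ v → fromVec (toVec v) ≡ v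
fromVec-toVec (a , b , c) = cong₂ _,_ (fromF₉-toF₉ a) (cong₂ _,_ (fromF₉-toF₉ b) (fromF₉-toF₉ c))

fromVec-injective : ∀ {v w} → fromVec v ≡ fromVec w → ∀ i → v i ≡ w i
fromVec-injective p 0F = fromF₉-injective (cong proj₁ p)
fromVec-injective p 1F = fromF₉-injective (cong (proj₁ ∘ proj₂) p)
fromVec-injective p 2F = fromF₉-injective (cong (proj₂ ∘ proj₂) p)

fromVec-cong : ∀ {v w : Vec₃} → (∀ i → v i ≡ w i) → fromVec v ≡ fromVec w
fromVec-cong p = cong₂ _,_ (cong fromF₉ (p 0F)) (cong₂ _,_ (cong fromF₉ (p 1F)) (cong fromF₉ (p 2F)))

fromMatrix-update : ∀ v f → fromMatrix (λ i j → 1ᴹ i j + v i * f j) ≡ update (fromVec v) (fromVec f)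
fromMatrix-update v f = mk-cong (q 0F 0F) (q 0F 1F) (q 0F 2F)
  (q 1F 0F) (q 1F 1F) (q 1F 2F) (q 2F 0F) (q 2F 1F) (q 2F 2F)
  where
  q : ∀ i j → fromF₉ (1ᴹ i j + v i * f j) ≡ fromF₉ (1ᴹ i j) ⊕ fromF₉ (v i) ⊙ fromF₉ (f j)
  q i j = trans (fromF₉-+ (1ᴹ i j) _) (cong (fromF₉ (1ᴹ i j) ⊕_) (fromF₉-* (v i) (f j)))

-- Meant for classes up to 4: `Described` links it to the outer involution under that bound.
twistIndex : ℕ → ℕ
twistIndex 3 = 4
twistIndex 4 = 3
twistIndex j = j

module Γ-Facts (tables : Lookup) where
  open Lookup tables
  open Checks Γ-coding Γ-gens Γ-reps tables using (rep)
  open Certificates Γ-coding Γ-gens Γ-reps tables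

  Described : M → Set
  Described m =
    (lin m · lin m ≡ one → lin m ≢ one → cls (lin m) ≡ 1) ×
    (cls (lin m) ≡ 1 → lin m ≢ one × lin m · lin m ≡ one) ×
    (RankOne m → lin m ≢ one → cls (lin m) ≡ 2) ×
    (cls (lin m) ≡ 2 → Any (IsTransvection m) (factorisations m)) ×
    (cls (lin m) ℕ.≤ 4 → cls (lin (conjugateᴹ m)) ≡ twistIndex (cls (lin m)))

  described? : ∀ m → Dec (Described m)
  described? m =
    ((lin m · lin m) ≟ˣ one →-dec ¬? (lin m ≟ˣ one) →-dec cls (lin m) ℕ.≟ 1) ×-dec
    (cls (lin m) ℕ.≟ 1 →-dec ¬? (lin m ≟ˣ one) ×-dec (lin m · lin m) ≟ˣ one) ×-dec
    (rankOne? m →-dec ¬? (lin m ≟ˣ one) →-dec cls (lin m) ℕ.≟ 2) ×-dec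
    (cls (lin m) ℕ.≟ 2 →-dec some? (isTransvection? m) (factorisations m)) ×-dec
    (cls (lin m) ℕ.≤? 4 →-dec cls (lin (conjugateᴹ m)) ℕ.≟ twistIndex (cls (lin m)))

  -- For the full list of elements this is `Valid` together with `SingleOrbit`. It is written out
  -- over `xs` so that the class lists and the centralizer can be computed once.
  RigidSolution : List X → Solution → Set
  RigidSolution xs s = Valid s × Exhausted (filter (λ x → cls x ℕ.≟ a) xs) (filter (λ x → cls x ℕ.≟ b) xs) c (rep d)
      (Conjugated (filter (λ k → (k · rep d) ≟ˣ (rep d · k)) xs) x y)
    where open Solution s

  rigidSolution? : ∀ xs s → Dec (RigidSolution xs s)
  rigidSolution? xs s = valid? s ×-dec
    go (filter (λ x → cls x ℕ.≟ a) xs) (filter (λ x → cls x ℕ.≟ b) xs) (filter (λ k → (k · rep d) ≟ˣ (rep d · k)) xs)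
    where
    open Solution s
    go : ∀ as bs ks → Dec (Exhausted as bs c (rep d) (Conjugated ks x y))
    go as bs ks = exhausted? as bs c (rep d) λ x′ y′ →
      some? (λ k → (k · x) ≟ˣ (x′ · k) ×-dec (k · y) ≟ˣ (y′ · k)) ks

  Facts : Set
  Facts = All Described frames × (∀ k → RigidSolution (map lin frames) (rigid-solution k)) ×
    cls (rep 1) ≡ 1 × cls (rep 2) ≡ 2 × cls (rep 3) ≡ 3 × cls (rep 4) ≡ 4

  facts? : Dec Facts
  facts? = go frames
    where
    rigid? : ∀ xs → Dec (∀ k → RigidSolution xs (rigid-solution k))
    rigid? xs = Fin.all? λ k → rigidSolution? xs (rigid-solution k)
    go : ∀ ms → Dec (All Described ms × (∀ k → RigidSolution (map lin ms) (rigid-solution k)) ×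
                     cls (rep 1) ≡ 1 × cls (rep 2) ≡ 2 × cls (rep 3) ≡ 3 × cls (rep 4) ≡ 4)
    go ms = every? described? ms ×-dec rigid? (map lin ms) ×-dec
      cls (rep 1) ℕ.≟ 1 ×-dec cls (rep 2) ℕ.≟ 2 ×-dec cls (rep 3) ℕ.≟ 3 ×-dec cls (rep 4) ℕ.≟ 4

Γ-Evidence : Lookup → Set
Γ-Evidence tables = Checks.AllChecked Γ-coding Γ-gens Γ-reps tables ×
  Verdicts.Everything Γ-coding Γ-gens Γ-reps tables 6048 (upTo 14) Γ-exceptions Γ-pairs Γ-never? ×
  Γ-Facts.Facts tables

Γ-evidence? : ∀ tables → Dec (Γ-Evidence tables)
Γ-evidence? tables = Checks.allChecked? Γ-coding Γ-gens Γ-reps tables ×-dec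
  Verdicts.everything? Γ-coding Γ-gens Γ-reps tables 6048 (upTo 14) Γ-exceptions Γ-pairs Γ-never? ×-dec
  Γ-Facts.facts? tables

opaque
  unfolding enumeration Γ-tables

  Γ-evidence : Γ-Evidence Γ-tables
  Γ-evidence = toWitness {a? = Γ-evidence? Γ-tables} _

Γ-checked : Checks.AllChecked Γ-coding Γ-gens Γ-reps Γ-tables
Γ-checked = proj₁ Γ-evidence

Γ-everything : Verdicts.Everything Γ-coding Γ-gens Γ-reps Γ-tables 6048 (upTo 14) Γ-exceptions Γ-pairs Γ-never?
Γ-everything = proj₁ (proj₂ Γ-evidence)

Γ-facts : Γ-Facts.Facts Γ-tables
Γ-facts = proj₂ (proj₂ Γ-evidence)

module Γ-Theory = ClassTheory Γ-coding Γ-gens Γ-reps Γ-tables Γ-checked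
open Γ-Theory using () renaming (Cl to Γ-Cl; Cls to Γ-Cls)
open Lookup Γ-tables using () renaming (cls to Γ-cls)

private
  described : ∀ A → Γ-Facts.Described Γ-tables (fromSU A)
  described A = All.lookup (proj₁ Γ-facts) (∈-frames (fromSU A) (fromSU-unitary A))

  one-injective : ∀ A → lin (fromSU A) ≡ one → Group._≈_ Γ A (Group.ε Γ)
  one-injective A = Coding.code-injective Γ-coding {A} {Group.ε Γ}

2A≐Cl : 2A ≐ Γ-Cl 1
2A≐Cl =
  (λ {A} (A≢1 , A²≡1) → proj₁ (described A)
    (trans (sym (Coding.code-∙ Γ-coding A A)) (Coding.code-cong Γ-coding {mulˢ A A} {oneˢ} A²≡1))
    (λ eq → A≢1 (one-injective A eq))) ,
  (λ {A} cls≡1 → let A≢1 , A²≡1 = proj₁ (proj₂ (described A)) cls≡1 in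
    (λ A≈1 → A≢1 (Coding.code-cong Γ-coding {A} {oneˢ} A≈1)) ,
    Coding.code-injective Γ-coding {mulˢ A A} {oneˢ} (trans (Coding.code-∙ Γ-coding A A) A²≡1))

nonzero-entry : ∀ (v : Vec₃) → ¬ (∀ i → v i ≡ 0#) → ∃[ i ] v i ≢ 0#
nonzero-entry v v≢0 = Fin.¬∀⟶∃¬ 3 (λ i → v i ≡ 0#) (λ i → v i ≟₉ 0#) v≢0

outer-product≢0 : ∀ (v f : Vec₃) → ¬ (∀ i → v i ≡ 0#) → ¬ (∀ i → f i ≡ 0#) → ¬ (∀ i j → v i * f j ≡ 0#)
outer-product≢0 v f v≢0 f≢0 vf≡0 with nonzero-entry v v≢0 | nonzero-entry f f≢0
... | i , vᵢ≢0 | j , fⱼ≢0 = fⱼ≢0 (begin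
  f j  ≡⟨ *-identityˡ (f j) ⟨
  1# * f j  ≡⟨ cong (_* f j) (recip-inverseˡ (v i) vᵢ≢0) ⟨
  recip (v i) * v i * f j  ≡⟨ *-assoc (recip (v i)) (v i) (f j) ⟩
  recip (v i) * (v i * f j)  ≡⟨ cong (recip (v i) *_) (vf≡0 i j) ⟩
  recip (v i) * 0#  ≡⟨ zeroʳ (recip (v i)) ⟩
  0#  ∎)
  where
  open ≡-Reasoning

module _ (A : SU) (v f : Vec₃) (A≡ : mat A ≈ᴹ (λ i j → 1ᴹ i j + v i * f j)) where
  private
    cancel : ∀ x y → x + y + - x ≡ y
    cancel = solve-∀ F₉-ring

    minusOne-outer : ∀ i j → minusOne (fromSU A) i j ≡ fromF₉ (v i * f j)
    minusOne-outer i j = begin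
      entry (fromSU A) i j ⊖ entry (fromMatrix 1ᴹ) i j  ≡⟨ cong₂ _⊖_ (entry-fromMatrix (mat A) i j) (entry-fromMatrix 1ᴹ i j) ⟩
      fromF₉ (mat A i j) ⊖ fromF₉ (1ᴹ i j)  ≡⟨ cong (fromF₉ (mat A i j) ⊕_) (fromF₉-- (1ᴹ i j)) ⟨
      fromF₉ (mat A i j) ⊕ fromF₉ (- 1ᴹ i j)  ≡⟨ fromF₉-+ (mat A i j) (- 1ᴹ i j) ⟨
      fromF₉ (mat A i j + - 1ᴹ i j)  ≡⟨ cong (λ x → fromF₉ (x + - 1ᴹ i j)) (A≡ i j) ⟩
      fromF₉ (1ᴹ i j + v i * f j + - 1ᴹ i j)  ≡⟨ cong fromF₉ (cancel (1ᴹ i j) (v i * f j)) ⟩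
      fromF₉ (v i * f j)  ∎
      where open ≡-Reasoning

  transvection-rankOne : RankOne (fromSU A)
  transvection-rankOne i k j l = begin
    minusOne (fromSU A) i j ⊙ minusOne (fromSU A) k l  ≡⟨ cong₂ _⊙_ (minusOne-outer i j) (minusOne-outer k l) ⟩
    fromF₉ (v i * f j) ⊙ fromF₉ (v k * f l)  ≡⟨ fromF₉-* (v i * f j) (v k * f l) ⟨
    fromF₉ (v i * f j * (v k * f l))  ≡⟨ cong fromF₉ (exchange (v i) (f j) (v k) (f l)) ⟩
    fromF₉ (v i * f l * (v k * f j))  ≡⟨ fromF₉-* (v i * f l) (v k * f j) ⟩
    fromF₉ (v i * f l) ⊙ fromF₉ (v k * f j)  ≡⟨ cong₂ _⊙_ (minusOne-outer i l) (minusOne-outer k j) ⟨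
    minusOne (fromSU A) i l ⊙ minusOne (fromSU A) k j  ∎
    where
    open ≡-Reasoning
    exchange : ∀ a b c d → a * b * (c * d) ≡ a * d * (c * b)
    exchange = solve-∀ F₉-ring

  transvection≢1 : ¬ (∀ i → v i ≡ 0#) → ¬ (∀ i → f i ≡ 0#) → lin (fromSU A) ≢ one
  transvection≢1 v≢0 f≢0 A≡1 = outer-product≢0 v f v≢0 f≢0 λ i j → begin
    v i * f j  ≡⟨ cancel (1ᴹ i j) (v i * f j) ⟨
    1ᴹ i j + v i * f j + - 1ᴹ i j  ≡⟨ cong (_+ - 1ᴹ i j) (trans (sym (A≡ i j)) (one-injective A A≡1 i j)) ⟩
    1ᴹ i j + - 1ᴹ i j  ≡⟨ -‿inverseʳ (1ᴹ i j) ⟩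
    0#  ∎
    where open ≡-Reasoning

-- A transvection is a rank-one change of the identity, and all such matrices were found in class 2.
-- Conversely v and f come from the factorisation found for each member of that class.
3A≐Cl : 3A ≐ Γ-Cl 2
3A≐Cl =
  (λ {A} (v , f , v≢0 , f≢0 , fv≡0 , A≡) → proj₁ (proj₂ (proj₂ (described A)))
    (transvection-rankOne A v f A≡) (transvection≢1 A v f A≡ v≢0 f≢0)) ,
  (λ {A} cls≡2 → transvection A (proj₂ (Any.satisfied (proj₁ (proj₂ (proj₂ (proj₂ (described A)))) cls≡2))))
  where
  toVec≢0 : ∀ v → v ≢ (k0 , k0 , k0) → ¬ (∀ i → toVec v i ≡ 0#)
  toVec≢0 v v≢0 p = v≢0 (trans (sym (fromVec-toVec v)) (fromVec-cong {toVec v} {λ _ → 0#} p))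
  transvection : ∀ A {vf} → IsTransvection (fromSU A) vf → A ∈ 3A
  transvection A {v@(a , b , c) , f@(x , y , z)} (v≢0 , f≢0 , fv≡0 , update≡) =
    toVec v , toVec f , toVec≢0 v v≢0 , toVec≢0 f f≢0 ,
    fromF₉-injective (trans (fromF₉-dot (toF₉ x) (toF₉ y) (toF₉ z) (toF₉ a) (toF₉ b) (toF₉ c))
      (trans (dot-cong (fromF₉-toF₉ x) (fromF₉-toF₉ y) (fromF₉-toF₉ z) (fromF₉-toF₉ a) (fromF₉-toF₉ b) (fromF₉-toF₉ c)) fv≡0)) ,
    fromMatrix-injective (trans (sym update≡) (trans (cong₂ update (sym (fromVec-toVec v)) (sym (fromVec-toVec f)))
      (sym (fromMatrix-update (toVec v) (toVec f)))))
    where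
    dot-cong : ∀ {a b c x y z a′ b′ c′ x′ y′ z′} → a ≡ a′ → b ≡ b′ → c ≡ c′ → x ≡ x′ → y ≡ y′ → z ≡ z′ →
      dot a b c x y z ≡ dot a′ b′ c′ x′ y′ z′
    dot-cong refl refl refl refl refl refl = refl

private
  rep-classes : ∀ (j : Fin 4) → Γ-cls (Γ-reps ‼ suc (Fin.toℕ j)) ≡ suc (Fin.toℕ j)
  rep-classes 0F = proj₁ (proj₂ (proj₂ Γ-facts))
  rep-classes 1F = proj₁ (proj₂ (proj₂ (proj₂ Γ-facts)))
  rep-classes 2F = proj₁ (proj₂ (proj₂ (proj₂ (proj₂ Γ-facts))))
  rep-classes 3F = proj₂ (proj₂ (proj₂ (proj₂ (proj₂ Γ-facts))))

class-representative : ∀ (j : Fin 4) → ∃[ A ] lin (fromSU A) ≡ Γ-reps ‼ suc (Fin.toℕ j) × Γ-cls (lin (fromSU A)) ≡ suc (Fin.toℕ j)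
class-representative j =
  let A , A≡ = Coding.decode Γ-coding (Γ-Theory.rep-valid (suc (Fin.toℕ j)))
  in A , A≡ , trans (cong Γ-cls A≡) (rep-classes j)

-- Stated for the matrix diag d, as the unitarity proofs inside 4A and 4B
-- cannot be named.
diagonal-class : ∀ (d : Vec₃) (j : Fin 4) → lin (fromMatrix (diag d)) ≡ Γ-reps ‼ suc (Fin.toℕ j) →
  (λ A → ∃[ k ] mat A ≈ᴹ (mat k *ᴹ diag d) *ᴹ adj (mat k)) ≐ Γ-Cl (suc (Fin.toℕ j))
diagonal-class d j d≡ with class-representative j
... | D , D≡ , cls≡ =
  (λ {A} (k , p) → trans (proj₁ (Γ-Theory.Conjugate≐Cl D) {A} (k , λ a b → trans (p a b) (sym (change k a b)))) cls≡) ,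
  (λ {A} q → let k , p = proj₂ (Γ-Theory.Conjugate≐Cl D) {A} (trans q (sym cls≡))
             in k , λ a b → trans (p a b) (change k a b))
  where
  change : ∀ k → (mat k *ᴹ mat D) *ᴹ adj (mat k) ≈ᴹ (mat k *ᴹ diag d) *ᴹ adj (mat k)
  change k = *ᴹ-cong {mat k *ᴹ mat D} {mat k *ᴹ diag d} {adj (mat k)}
    (*ᴹ-cong {mat k} {mat k} {mat D} {diag d} (λ _ _ → refl)
      (fromMatrix-injective {mat D} {diag d} (lin-injective (trans D≡ (sym d≡))))) (λ _ _ → refl)

4A≐Cl : 4A ≐ Γ-Cl 3
4A≐Cl = diagonal-class (𝕚 Vector.∷ 𝕚 Vector.∷ - 1# Vector.∷ Vector.[]) 2F refl

4B≐Cl : 4B ≐ Γ-Cl 4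
4B≐Cl = diagonal-class (- 𝕚 Vector.∷ - 𝕚 Vector.∷ - 1# Vector.∷ Vector.[]) 3F refl

-- The five quadruples and the outer involution.

-- The classes of the quadruples, by their position in Γ-reps minus one.
quadruple-index : Fin 5 → Fin 4 → Fin 4
quadruple-index 0F = quad 1F 1F 1F 3F
quadruple-index 1F = quad 2F 2F 2F 3F
quadruple-index 2F = quad 0F 0F 1F 2F
quadruple-index 3F = quad 2F 2F 2F 0F
quadruple-index 4F = quad 2F 2F 1F 1F

index-class : Fin 4 → ℕ
index-class j = suc (Fin.toℕ j)

quadruple≐Cl : ∀ k i → quadruple k i ≐ Γ-Cl (index-class (quadruple-index k i))
quadruple≐Cl 0F = four 3A≐Cl 3A≐Cl 3A≐Cl 4B≐Cl
quadruple≐Cl 1F = four 4A≐Cl 4A≐Cl 4A≐Cl 4B≐Cl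
quadruple≐Cl 2F = four 2A≐Cl 2A≐Cl 3A≐Cl 4A≐Cl
quadruple≐Cl 3F = four 4A≐Cl 4A≐Cl 4A≐Cl 2A≐Cl
quadruple≐Cl 4F = four 4A≐Cl 4A≐Cl 3A≐Cl 3A≐Cl

quadruple-nonIdentity : ∀ k → NonIdentityClasses Γ (quadruple k)
quadruple-nonIdentity k i =
  let A , _ , A≡ = class-representative (quadruple-index k i)
  in Γ-Theory.Cl-nonidentity {quadruple k i} A A≡ (λ ()) (quadruple≐Cl k i)

quadruple-strictlyRigid : ∀ k → StrictlyRigid Γ (quadruple k)
quadruple-strictlyRigid k = transport k (VerdictTheory.conjugated⇒strictlyRigid Γ-coding Γ-gens Γ-reps Γ-tables Γ-checked
    (rigid-solution k) (proj₁ (proj₁ (proj₂ Γ-facts) k)) (proj₂ (proj₁ (proj₂ Γ-facts) k)))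
  where
  open Tuples Γ
  classes : Solution → Classes
  classes s = Γ-Cls a b c d where open Solution s
  same : ∀ k → classes (rigid-solution k) ≃ quadruple k
  same k = ≐⇒≃ (λ i → ≐-trans (index≐ k i) (≐-sym (quadruple≐Cl k i)))
    where
    index≐ : ∀ k i → classes (rigid-solution k) i ≐ Γ-Cl (index-class (quadruple-index k i))
    index≐ 0F = four (id , id) (id , id) (id , id) (id , id)
    index≐ 1F = four (id , id) (id , id) (id , id) (id , id)
    index≐ 2F = four (id , id) (id , id) (id , id) (id , id)
    index≐ 3F = four (id , id) (id , id) (id , id) (id , id)
    index≐ 4F = four (id , id) (id , id) (id , id) (id , id)
  transport : ∀ k → StrictlyRigid Γ (classes (rigid-solution k)) → StrictlyRigid Γ (quadruple k)
  transport k (r , s) = rigid-resp (same k) r , μ̄-resp′ (same k) s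

code-frobenius : ∀ A → lin (fromSU (frobenius A)) ≡ lin (conjugateᴹ (fromSU A))
code-frobenius A = cong lin (fromMatrix-conj (mat A))

twistIndex-involutive : ∀ (j : Fin 4) → twistIndex (twistIndex (index-class j)) ≡ index-class j
twistIndex-involutive = λ where
  0F → refl
  1F → refl
  2F → refl
  3F → refl

-- The checked relation between a matrix and its conjugate is applied to the Frobenius image of A
-- for one inclusion and to A itself for the other.
Cl-twist : ∀ j → twist (Γ-Cl (index-class j)) ≐ Γ-Cl (twistIndex (index-class j))
Cl-twist j =
  (λ {A} p → trans (cong Γ-cls (sym (conj-conj A))) (trans (twisted (frobenius A) p) (cong twistIndex p))) ,
  (λ {A} p → trans (cong Γ-cls (code-frobenius A)) (trans (described-twist A (subst (ℕ._≤ 4) (sym p) (bound j)))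
    (trans (cong twistIndex p) (twistIndex-involutive j))))
  where
  described-twist : ∀ A → Γ-cls (lin (fromSU A)) ℕ.≤ 4 → Γ-cls (lin (conjugateᴹ (fromSU A))) ≡ twistIndex (Γ-cls (lin (fromSU A)))
  described-twist A = proj₂ (proj₂ (proj₂ (proj₂ (described A))))
  conj-conj : ∀ A → lin (conjugateᴹ (fromSU (frobenius A))) ≡ lin (fromSU A)
  conj-conj A = cong lin (trans (cong conjugateᴹ (fromMatrix-conj (mat A))) (conjugateᴹ-involutive (fromSU A)))
  index≤4 : ∀ j → index-class j ℕ.≤ 4
  index≤4 j = Fin.toℕ<n j
  bound : ∀ j → twistIndex (index-class j) ℕ.≤ 4
  bound = λ where
    0F → ℕ.s≤s ℕ.z≤n
    1F → ℕ.s≤s (ℕ.s≤s ℕ.z≤n)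
    2F → ℕ.≤-refl
    3F → ℕ.s≤s (ℕ.s≤s (ℕ.s≤s ℕ.z≤n))
  twisted : ∀ A → Γ-cls (lin (fromSU A)) ≡ index-class j → Γ-cls (lin (conjugateᴹ (fromSU A))) ≡ twistIndex (Γ-cls (lin (fromSU A)))
  twisted A p = described-twist A (subst (ℕ._≤ 4) (sym p) (index≤4 j))

Listed : (a b c d : ℕ) → Set
Listed a b c d = ∃[ k ] Γ-Cls a b c d ∼ quadruple k

Listed-swap : ∀ {a b c d} → Listed b a c d → Listed a b c d
Listed-swap (k , π , inj₁ p) = k , transposition ∘ₚ π , inj₁ (four (p 1F) (p 0F) (p 2F) (p 3F))
  where transposition = Permutation.transpose 0F 1F
Listed-swap (k , π , inj₂ p) = k , transposition ∘ₚ π , inj₂ (four (p 1F) (p 0F) (p 2F) (p 3F))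
  where transposition = Permutation.transpose 0F 1F

-- Place 0 of (a, b, c, d) is place 3 of (b, c, d, a), and the other places move down by one.
rotation : Permutation′ 4
rotation = Permutation.permutation (quad 3F 0F 1F 2F) (quad 1F 2F 3F 0F)
  (four refl refl refl refl) (four refl refl refl refl)

Listed-rotate : ∀ {a b c d} → Listed b c d a → Listed a b c d
Listed-rotate (k , π , inj₁ p) = k , rotation ∘ₚ π , inj₁ (four (p 3F) (p 0F) (p 1F) (p 2F))
Listed-rotate (k , π , inj₂ p) = k , rotation ∘ₚ π , inj₂ (four (p 3F) (p 0F) (p 1F) (p 2F))

ListedAt : (f : Fin 4 → ℕ) → Fin 5 → Set
ListedAt f k = Listed (f (quadruple-index k 0F)) (f (quadruple-index k 1F))
                       (f (quadruple-index k 2F)) (f (quadruple-index k 3F))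

listed : ∀ k → ListedAt index-class k
listed k = k , Permutation.id , inj₁ (four (at 0F) (at 1F) (at 2F) (at 3F))
  where
  at : ∀ i → Γ-Cl (index-class (quadruple-index k i)) ≐ quadruple k i
  at i = ≐-sym (quadruple≐Cl k i)

listed-twist : ∀ k → ListedAt (twistIndex ∘ index-class) k
listed-twist k = k , Permutation.id , inj₂ (four (at 0F) (at 1F) (at 2F) (at 3F))
  where
  at : ∀ i → Γ-Cl (twistIndex (index-class (quadruple-index k i))) ≐ twist (quadruple k i)
  at i = ≐-trans (≐-sym (Cl-twist (quadruple-index k i)))
    ((λ {A} x → proj₂ (quadruple≐Cl k i) {frobenius A} x) , (λ {A} x → proj₁ (quadruple≐Cl k i) {frobenius A} x))

-- The exceptions are sorted while the quadruples of the statement need not be; rotations make up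
-- the difference.
exceptions-listed : ∀ {a b c d} → (a , b , c , d) ∈ˡ Γ-exceptions → Listed a b c d
exceptions-listed e = All.lookup {P = λ (a , b , c , d) → Listed a b c d}
  (listed 2F ∷ listed-twist 2F ∷
   Listed-rotate (listed 3F) ∷ Listed-rotate (listed-twist 3F) ∷
   listed-twist 0F ∷ listed 0F ∷
   Listed-rotate (Listed-rotate (listed 4F)) ∷ Listed-rotate (Listed-rotate (listed-twist 4F)) ∷
   listed 1F ∷ Listed-rotate (listed-twist 1F) ∷ []) e

rigid⇒listed : ∀ {C} → NonIdentityClasses Γ C → Rigid Γ C → μ̄<4 Γ C → ∃[ k ] C ∼ quadruple k
rigid⇒listed {C} nonid rigid μ̄ = go (rigid-quadruples Listed Listed-swap Listed-rotate exceptions-listed {C} nonid rigid μ̄)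
  where
  open Conclusion Γ-coding Γ-gens Γ-reps Γ-tables Γ-checked 6048 (upTo 14) Γ-exceptions Γ-pairs Γ-never?
    (Unique.upTo⁺ 14) (from-yes (All.all? (ℕ._<? 14) (upTo 14))) (λ ()) Γ-everything
  go : Σ[ J ∈ Vector ℕ 4 ] (∀ i → C i ≐ Γ-Cl (J i)) × Listed (J 0F) (J 1F) (J 2F) (J 3F) → ∃[ k ] C ∼ quadruple k
  go (J , C≐ , k , π , inj₁ p) = k , π , inj₁ (four (≐-trans (C≐ 0F) (p 0F)) (≐-trans (C≐ 1F) (p 1F))
    (≐-trans (C≐ 2F) (p 2F)) (≐-trans (C≐ 3F) (p 3F)))
  go (J , C≐ , k , π , inj₂ p) = k , π , inj₂ (four (≐-trans (C≐ 0F) (p 0F)) (≐-trans (C≐ 1F) (p 1F))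
    (≐-trans (C≐ 2F) (p 2F)) (≐-trans (C≐ 3F) (p 3F)))

-- Lets the claims on strictly rigid quadruples follow from those on rigid ones with μ̄ < 4.
strictlyRigid⇒μ̄<4 : ∀ {G : Group 0ℓ 0ℓ} {z} {C : Vector (Pred (Group.Carrier G) 0ℓ) z} → StrictlyRigid G C → μ̄<4 G C
strictlyRigid⇒μ̄<4 (_ , μ̄≐1) = 1ℚ , μ̄≐1 , from-yes (1ℚ ℚ.<? ℤ.+ 4 / 1)

-- Invariant under reordering and twisting, and different on the five quadruples.
weight : Fin 4 → ℕ
weight = quad 5 1 0 0

classWeight : ℕ → ℕ
classWeight 1 = 5
classWeight 2 = 1
classWeight _ = 0

same-weight : ∀ i j → Γ-Cl (index-class i) ≐ Γ-Cl (index-class j) → weight i ≡ weight j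
same-weight i j (i⊆j , _) = begin
  weight i  ≡⟨ by-class i ⟨
  classWeight (index-class i)  ≡⟨ cong classWeight (trans (sym A≡) (i⊆j {A} A≡)) ⟩
  classWeight (index-class j)  ≡⟨ by-class j ⟩
  weight j  ∎
  where
  open ≡-Reasoning
  A = proj₁ (class-representative i)
  A≡ = proj₂ (proj₂ (class-representative i))
  by-class : ∀ i → classWeight (index-class i) ≡ weight i
  by-class = four refl refl refl refl

twisted-weight : ∀ i j → Γ-Cl (index-class i) ≐ twist (Γ-Cl (index-class j)) → weight i ≡ weight j
twisted-weight i j p = trans (same-weight i (twisted j) (≐-trans p (≐-trans (Cl-twist j) (Cl-twisted j)))) (weight-twisted j)
  where
  twisted : Fin 4 → Fin 4
  twisted = quad 0F 1F 3F 2F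
  Cl-twisted : ∀ j → Γ-Cl (twistIndex (index-class j)) ≐ Γ-Cl (index-class (twisted j))
  Cl-twisted = four (id , id) (id , id) (id , id) (id , id)
  weight-twisted : ∀ j → weight (twisted j) ≡ weight j
  weight-twisted = four refl refl refl refl

-- A sum of weights ignores the permutation, and equal weights for 4A and 4B make it ignore the
-- twist. The totals are 3, 0, 11, 5 and 2.
quadruples-inequivalent : ∀ j k → quadruple j ∼ quadruple k → j ≡ k
quadruples-inequivalent j k (π , related) = distinct j k (begin
  Sum.sum (total j)  ≡⟨ Sum.sum-cong-≗ (same related) ⟩
  Sum.sum (λ i → total k (π ⟨$⟩ʳ i))  ≡⟨ Sum.sum-permute (total k) π ⟨
  Sum.sum (total k)  ∎)
  where
  open ≡-Reasoning
  module Sum = NatSum ℕ.+-0-commutativeMonoid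
  total : Fin 5 → Vector ℕ 4
  total k i = weight (quadruple-index k i)
  distinct : ∀ j k → Sum.sum (total j) ≡ Sum.sum (total k) → j ≡ k
  distinct = from-yes (Fin.all? λ j → Fin.all? λ k → Sum.sum (total j) ℕ.≟ Sum.sum (total k) →-dec j Fin.≟ k)
  same : ((∀ i → quadruple j i ≐ quadruple k (π ⟨$⟩ʳ i)) ⊎ (∀ i → quadruple j i ≐ twist (quadruple k (π ⟨$⟩ʳ i)))) →
    ∀ i → total j i ≡ total k (π ⟨$⟩ʳ i)
  same (inj₁ p) i = same-weight _ _ (≐-trans (≐-sym (quadruple≐Cl j i)) (≐-trans (p i) (quadruple≐Cl k (π ⟨$⟩ʳ i))))
  same (inj₂ p) i = twisted-weight _ _ (≐-trans (≐-sym (quadruple≐Cl j i)) (≐-trans (p i)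
    ((λ {A} x → proj₁ (quadruple≐Cl k (π ⟨$⟩ʳ i)) {frobenius A} x) ,
     (λ {A} x → proj₂ (quadruple≐Cl k (π ⟨$⟩ʳ i)) {frobenius A} x))))

-- Isotropic points, cycles and the genus.

scale : K → Column → Column
scale c (x , y , z) = c ⊙ x , c ⊙ y , c ⊙ z

reciprocal : K → K
reciprocal k1 = k1
reciprocal k2 = k2
reciprocal k3 = k6
reciprocal k4 = k5
reciprocal k5 = k4
reciprocal k6 = k3
reciprocal k7 = k8
reciprocal k8 = k7
reciprocal k0 = k0

-- Scaling the first non-zero coordinate to 1 selects one vector on each line.
normal : Column → Column
normal u@(k0 , k0 , z) = scale (reciprocal z) u
normal u@(k0 , y  , z) = scale (reciprocal y) u
normal u@(x  , y  , z) = scale (reciprocal x) u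

apply : M → Column → Column
apply (mk a b c d e f g h i) (x , y , z) = dot a b c x y z , dot d e f x y z , dot g h i x y z

_≟ᶜ_ : DecidableEquality Column
_≟ᶜ_ = ≡-dec _≟ᴷ_ (≡-dec _≟ᴷ_ _≟ᴷ_)

Isotropic : Column → Set
Isotropic u@(a , b , c) = u ≢ (k0 , k0 , k0) × dot a b c (conjugate a) (conjugate b) (conjugate c) ≡ k0

isotropic? : ∀ u → Dec (Isotropic u)
isotropic? u@(a , b , c) = ¬? (u ≟ᶜ _) ×-dec dot a b c (conjugate a) (conjugate b) (conjugate c) ≟ᴷ k0

IsPoint : Column → Set
IsPoint u = Isotropic u × normal u ≡ u

isPoint? : ∀ u → Dec (IsPoint u)
isPoint? u = isotropic? u ×-dec normal u ≟ᶜ u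

opaque
  pointList : List Column
  pointList = filter isPoint? columns

  ∈-pointList⁺ : ∀ {u} → IsPoint u → u ∈ˡ pointList
  ∈-pointList⁺ {u} = ∈-filter⁺ isPoint? {xs = columns} (∈-columns u)

  ∈-pointList⁻ : ∀ {u} → u ∈ˡ pointList → IsPoint u
  ∈-pointList⁻ u∈ = proj₂ (∈-filter⁻ isPoint? {xs = columns} u∈)

  pointList-unique : Unique pointList
  pointList-unique = Unique.filter⁺ isPoint? {xs = columns} columns-unique

step : M → Column → Column
step m p = normal (apply m p)

orbit : M → ℕ → Column → List Column
orbit m zero    p = p ∷ []
orbit m (suc n) p = p ∷ orbit m n (step m p)

first : Column → List Column → Column
first d []      = d
first d (x ∷ _) = x

-- The orders of the elements concerned divide 12, so the orbit is a full cycle.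
labelIn : List Column → M → Column → Column
labelIn ps m p = go (orbit m 11 p)
  where
  go : List Column → Column
  go o = first p (filter (λ q → some? (q ≟ᶜ_) o) ps)

-- Together these make `label` choose one point on each cycle: it is constant along a cycle and its
-- value lies on that cycle. The cycles then correspond to the fixed points of `label`.
Labelled : (label : Column → Column) → ℕ → List Column → M → Column → Set
Labelled label n ps m p = label (step m p) ≡ label p × label p ∈ˡ orbit m n p × label p ∈ˡ ps × label (label p) ≡ label p

labelled? : ∀ label n ps m p → Dec (Labelled label n ps m p)
labelled? label n ps m p = label (step m p) ≟ᶜ label p ×-dec some? (label p ≟ᶜ_) (orbit m n p) ×-dec
  some? (label p ≟ᶜ_) ps ×-dec label (label p) ≟ᶜ label p

fixedPoints : (Column → Column) → List Column → List Column
fixedPoints f ps = filter (λ p → f p ≟ᶜ p) ps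

matrixOf : X → M
matrixOf (lin m)  = m
matrixOf (semi m) = m

-- From the cycle types 2¹² 1⁴, 3⁹ 1, 4⁶ 1⁴ and 4⁶ 1⁴.
cycleCount : Fin 4 → ℕ
cycleCount = quad 16 10 10 10

rep-matrix : Fin 4 → M
rep-matrix j = matrixOf (Γ-reps ‼ suc (Fin.toℕ j))

PointFacts : Set
PointFacts =
  All (λ u → All (λ c → c ≢ k0 → normal (scale c u) ≡ normal u) allK ×
    Any (λ c → c ≢ k0 × scale c u ≡ normal u) allK ×
    (Isotropic u → IsPoint (normal u))) columns ×
  length pointList ≡ 28 ×
  (∀ j → All (Labelled (labelIn pointList (rep-matrix j)) 11 pointList (rep-matrix j)) pointList ×
    length (fixedPoints (labelIn pointList (rep-matrix j)) pointList) ≡ cycleCount j)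

opaque
  unfolding pointList

  pointFacts : PointFacts
  pointFacts = toWitness {a? =
    every? (λ u → every? (λ c → ¬? (c ≟ᴷ k0) →-dec normal (scale c u) ≟ᶜ normal u) allK ×-dec
      some? (λ c → ¬? (c ≟ᴷ k0) ×-dec scale c u ≟ᶜ normal u) allK ×-dec
      (isotropic? u →-dec isPoint? (normal u))) columns
    ×-dec from-points pointList} _
    where
    from-points : ∀ ps → Dec (length ps ≡ 28 × (∀ j → All (Labelled (labelIn ps (rep-matrix j)) 11 ps (rep-matrix j)) ps ×
                                      length (fixedPoints (labelIn ps (rep-matrix j)) ps) ≡ cycleCount j))
    from-points ps = length ps ℕ.≟ 28 ×-dec Fin.all? λ j →
      every? (labelled? (labelIn ps (rep-matrix j)) 11 ps (rep-matrix j)) ps ×-dec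
      length (fixedPoints (labelIn ps (rep-matrix j)) ps) ℕ.≟ cycleCount j

open IsotropicVector

private
  column-facts : ∀ u → _
  column-facts u = All.lookup (proj₁ pointFacts) (∈-columns u)

coordinates : IsotropicVector → Column
coordinates u = fromVec (vec u)

canonical : IsotropicVector → Column
canonical u = normal (coordinates u)

∝⇒scale : ∀ {u v} → u ∝ v → ∃[ c ] c ≢ k0 × fromVec v ≡ scale c (fromVec u)
∝⇒scale {u} (c , c≢0 , p) = fromF₉ c , (λ eq → c≢0 (fromF₉-injective eq)) ,
  cong₂ _,_ (at 0F) (cong₂ _,_ (at 1F) (at 2F))
  where
  at : ∀ i → fromF₉ _ ≡ fromF₉ c ⊙ fromF₉ (u i)
  at i = trans (cong fromF₉ (p i)) (fromF₉-* c (u i))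

scale⇒∝ : ∀ {u v} c → c ≢ k0 → fromVec v ≡ scale c (fromVec u) → u ∝ v
scale⇒∝ {u} {v} c c≢0 p = toF₉ c , (λ eq → c≢0 (trans (sym (fromF₉-toF₉ c)) (cong fromF₉ eq))) ,
  fromVec-injective {v} {λ i → toF₉ c * u i} (trans p (cong₂ _,_ (at 0F) (cong₂ _,_ (at 1F) (at 2F))))
  where
  at : ∀ i → c ⊙ fromF₉ (u i) ≡ fromF₉ (toF₉ c * u i)
  at i = sym (trans (fromF₉-* (toF₉ c) (u i)) (cong (_⊙ fromF₉ (u i)) (fromF₉-toF₉ c)))

∝⇒normal : ∀ {u v} → u ∝ v → normal (fromVec u) ≡ normal (fromVec v)
∝⇒normal {u} u∝v = let c , c≢0 , p = ∝⇒scale u∝v in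
  sym (trans (cong normal p) (All.lookup (proj₁ (column-facts (fromVec u))) (∈-allK c) c≢0))

∝-normal : ∀ u → u ∝ toVec (normal (fromVec u))
∝-normal u = let c , _ , c≢0 , p = find (proj₁ (proj₂ (column-facts (fromVec u)))) in
  scale⇒∝ c c≢0 (trans (fromVec-toVec _) (sym p))

normal⇒∝ : ∀ {u v} → normal (fromVec u) ≡ normal (fromVec v) → u ∝ v
normal⇒∝ {u} {v} eq = IsEquivalence.trans ∝-isEquivalence (∝-normal u)
  (subst (λ w → toVec w ∝ v) (sym eq) (IsEquivalence.sym ∝-isEquivalence (∝-normal v)))

isotropic-coordinates : ∀ u → Isotropic (coordinates u)
isotropic-coordinates u = (λ eq → vec≢0 u (fromVec-injective {vec u} {λ _ → 0#} eq)) ,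
  trans (cong₂ _⊕_ (at 0F) (cong₂ _⊕_ (at 1F) (at 2F)))
    (trans (sym (fromF₉-dot (v 0F) (v 1F) (v 2F) (conj (v 0F)) (conj (v 1F)) (conj (v 2F)))) (cong fromF₉ (isotropic u)))
  where
  v = vec u
  at : ∀ i → fromF₉ (v i) ⊙ conjugate (fromF₉ (v i)) ≡ fromF₉ (v i) ⊙ fromF₉ (conj (v i))
  at i = cong (fromF₉ (v i) ⊙_) (sym (fromF₉-conj (v i)))

fromColumn : ∀ p → Isotropic p → IsotropicVector
fromColumn p@(a , b , c) (p≢0 , p⟂p) = record
  { vec = toVec p
  ; vec≢0 = λ eq → p≢0 (trans (sym (fromVec-toVec p)) (fromVec-cong {toVec p} {λ _ → 0#} eq))
  ; isotropic = fromF₉-injective (trans (fromF₉-dot (toF₉ a) (toF₉ b) (toF₉ c) (conj (toF₉ a)) (conj (toF₉ b)) (conj (toF₉ c)))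
      (trans (cong₂ _⊕_ (at a) (cong₂ _⊕_ (at b) (at c))) p⟂p))
  }
  where
  at : ∀ x → fromF₉ (toF₉ x) ⊙ fromF₉ (conj (toF₉ x)) ≡ x ⊙ conjugate x
  at x = cong₂ _⊙_ (fromF₉-toF₉ x) (trans (fromF₉-conj (toF₉ x)) (cong conjugate (fromF₉-toF₉ x)))

canonical-fromColumn : ∀ {p} (q : IsPoint p) → canonical (fromColumn p (proj₁ q)) ≡ p
canonical-fromColumn {p} (i , n) = trans (cong normal (fromVec-toVec p)) n

canonical∈ : ∀ u → canonical u ∈ˡ pointList
canonical∈ u = ∈-pointList⁺
  (proj₂ (proj₂ (column-facts (coordinates u))) (isotropic-coordinates u))

point : ∀ {p} → p ∈ˡ pointList → ∃[ u ] canonical u ≡ p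
point {p} p∈ = let q = ∈-pointList⁻ p∈ in fromColumn p (proj₁ q) , canonical-fromColumn q

points-HasSize : IsotropicPoints HasSize 28
points-HasSize = subst (IsotropicPoints HasSize_) (proj₁ (proj₂ pointFacts))
  (list-HasSize {S = IsotropicPoints} canonical ∝⇒normal normal⇒∝ pointList-unique canonical∈ point)

move : SU → IsotropicVector → IsotropicVector
move A u = record
  { vec = mat A *ᵛ vec u
  ; vec≢0 = λ Au≡0 → vec≢0 u λ i → begin
      vec u i  ≡⟨ 1ᴹ-*ᵛ (vec u) i ⟨
      (1ᴹ *ᵛ vec u) i  ≡⟨ *ᵛ-congˡ (Group.inverseˡ Γ A) (vec u) i ⟨
      ((adj (mat A) *ᴹ mat A) *ᵛ vec u) i  ≡⟨ *ᵛ-*ᴹ (adj (mat A)) (mat A) (vec u) i ⟩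
      (adj (mat A) *ᵛ (mat A *ᵛ vec u)) i  ≡⟨ *ᵛ-congʳ (adj (mat A)) Au≡0 i ⟩
      (adj (mat A) *ᵛ (λ _ → 0#)) i  ≡⟨ vanishes (adj (mat A) i 0F) (adj (mat A) i 1F) (adj (mat A) i 2F) ⟩
      0#  ∎
  ; isotropic = trans (unitary A (vec u) (vec u)) (isotropic u)
  }
  where
  open ≡-Reasoning
  vanishes : ∀ x y z → x * 0# + (y * 0# + (z * 0# + 0#)) ≡ 0#
  vanishes = solve-∀ F₉-ring

*ᵛ-∝ : ∀ A {u v} → u ∝ v → mat A *ᵛ u ∝ mat A *ᵛ v
*ᵛ-∝ A {u} {v} (c , c≢0 , p) = c , c≢0 , λ i →
  trans (*ᵛ-congʳ (mat A) p i) (linear (mat A i 0F) (mat A i 1F) (mat A i 2F) c (u 0F) (u 1F) (u 2F))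
  where
  linear : ∀ a b d c x y z → a * (c * x) + (b * (c * y) + (d * (c * z) + 0#)) ≡ c * (a * x + (b * y + (d * z + 0#)))
  linear = solve-∀ F₉-ring

fromVec-apply : ∀ A v → fromVec (mat A *ᵛ v) ≡ apply (fromSU A) (fromVec v)
fromVec-apply A v = cong₂ _,_ (row 0F) (cong₂ _,_ (row 1F) (row 2F))
  where
  row : ∀ i → _
  row i = fromF₉-dot (mat A i 0F) (mat A i 1F) (mat A i 2F) (v 0F) (v 1F) (v 2F)

canonical-move : ∀ A u → canonical (move A u) ≡ step (fromSU A) (canonical u)
canonical-move A u = begin
  normal (fromVec (mat A *ᵛ vec u))  ≡⟨ ∝⇒normal (*ᵛ-∝ A (∝-normal (vec u))) ⟩
  normal (fromVec (mat A *ᵛ toVec (canonical u))) ≡⟨ cong normal (fromVec-apply A (toVec (canonical u))) ⟩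
  normal (apply (fromSU A) (fromVec (toVec (canonical u)))) ≡⟨ cong (normal ∘ apply (fromSU A)) (fromVec-toVec (canonical u)) ⟩
  step (fromSU A) (canonical u)  ∎
  where open ≡-Reasoning

module _ (A : SU) where
  Moves : IsotropicVector → IsotropicVector → Set
  Moves u v = mat A *ᵛ vec u ∝ vec v

  private module C = Setoid (Cycles A)

  -- The closure relates u only to multiples of A u, so two representatives of one point are
  -- connected through their common image A v.
  ∝⇒cycle : ∀ {u v} → vec u ∝ vec v → C._≈_ u v
  ∝⇒cycle {u} {v} u∝v = C.trans {u} {move A v} {v}
    (EqClosure.return {R = Moves} (*ᵛ-∝ A u∝v))
    (C.sym {v} {move A v} (EqClosure.return {R = Moves} (IsEquivalence.refl ∝-isEquivalence)))

  orbit⇒cycle : ∀ n u v → canonical v ∈ˡ orbit (fromSU A) n (canonical u) → C._≈_ u v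
  orbit⇒cycle zero    u v (here eq)  = ∝⇒cycle (normal⇒∝ (sym eq))
  orbit⇒cycle (suc n) u v (here eq)  = ∝⇒cycle (normal⇒∝ (sym eq))
  orbit⇒cycle (suc n) u v (there v∈) = C.trans {u} {move A u} {v}
    (EqClosure.return {R = Moves} (IsEquivalence.refl ∝-isEquivalence))
    (orbit⇒cycle n (move A u) v (subst (λ p → canonical v ∈ˡ orbit (fromSU A) n p) (sym (canonical-move A u)) v∈))

  module _ (label : Column → Column) (n : ℕ) (labelled : All (Labelled label n pointList (fromSU A)) pointList) where
    private
      label′ : IsotropicVector → Column
      label′ u = label (canonical u)

      facts : ∀ u → Labelled label n pointList (fromSU A) (canonical u)
      facts u = All.lookup labelled (canonical∈ u)

    label-cong : ∀ {u v} → C._≈_ u v → label′ u ≡ label′ v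
    label-cong = EqClosure.gfold isEquivalence label′ λ {u} {v} Au∝v → sym (begin
      label′ v  ≡⟨ cong label (∝⇒normal Au∝v) ⟨
      label′ (move A u)  ≡⟨ cong label (canonical-move A u) ⟩
      label (step (fromSU A) (canonical u))  ≡⟨ proj₁ (facts u) ⟩
      label′ u  ∎)
      where open ≡-Reasoning

    label-injective : ∀ {u v} → label′ u ≡ label′ v → C._≈_ u v
    label-injective {u} {v} eq = go (point (proj₁ (proj₂ (proj₂ (facts u)))))
      where
      go : (∃[ w ] canonical w ≡ label′ u) → C._≈_ u v
      go (w , w≡) = C.trans {u} {w} {v}
        (orbit⇒cycle n u w (subst (_∈ˡ orbit (fromSU A) n (canonical u)) (sym w≡) (proj₁ (proj₂ (facts u)))))
        (C.sym {v} {w} (orbit⇒cycle n v w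
          (subst (_∈ˡ orbit (fromSU A) n (canonical v)) (sym (trans w≡ eq)) (proj₁ (proj₂ (facts v))))))

    cycles-labels : Cycles A HasSize length (fixedPoints label pointList)
    cycles-labels = list-HasSize {S = Cycles A} label′ (λ {u} {v} → label-cong {u} {v}) (λ {u} {v} → label-injective {u} {v})
      (Unique.filter⁺ (λ p → label p ≟ᶜ p) pointList-unique)
      (λ u → ∈-filter⁺ (λ p → label p ≟ᶜ p) (proj₁ (proj₂ (proj₂ (facts u)))) (proj₂ (proj₂ (proj₂ (facts u)))))
      realised
      where
      realised : ∀ {y} → y ∈ˡ fixedPoints label pointList → ∃[ u ] label′ u ≡ y
      realised y∈ with ∈-filter⁻ (λ p → label p ≟ᶜ p) {xs = pointList} y∈
      ... | y∈points , y≡ with point y∈points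
      ...   | u , u≡ = u , trans (cong label u≡) y≡

≗⇒∝ : ∀ (u v : Vec₃) → (∀ i → u i ≡ v i) → u ∝ v
≗⇒∝ u v p = 1# , (λ ()) , λ i → trans (sym (p i)) (sym (*-identityˡ (u i)))

∝-trans : ∀ (u v w : Vec₃) → u ∝ v → v ∝ w → u ∝ w
∝-trans u v w = IsEquivalence.trans ∝-isEquivalence {u} {v} {w}

module _ (k l A B : SU)
  (kA : ∀ u i → (mat B *ᵛ (mat k *ᵛ u)) i ≡ (mat k *ᵛ (mat A *ᵛ u)) i)
  (lk : ∀ u i → (mat l *ᵛ (mat k *ᵛ u)) i ≡ u i)
  (kl : ∀ u i → (mat k *ᵛ (mat l *ᵛ u)) i ≡ u i) where
  private
    module CA = Setoid (Cycles A)
    module CB = Setoid (Cycles B)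

    lB : ∀ u i → (mat A *ᵛ (mat l *ᵛ u)) i ≡ (mat l *ᵛ (mat B *ᵛ u)) i
    lB u i = begin
      (mat A *ᵛ (mat l *ᵛ u)) i  ≡⟨ lk (mat A *ᵛ (mat l *ᵛ u)) i ⟨
      (mat l *ᵛ (mat k *ᵛ (mat A *ᵛ (mat l *ᵛ u)))) i  ≡⟨ *ᵛ-congʳ (mat l) (kA (mat l *ᵛ u)) i ⟨
      (mat l *ᵛ (mat B *ᵛ (mat k *ᵛ (mat l *ᵛ u)))) i  ≡⟨ *ᵛ-congʳ (mat l) (*ᵛ-congʳ (mat B) (kl u)) i ⟩
      (mat l *ᵛ (mat B *ᵛ u)) i  ∎
      where open ≡-Reasoning

    moved : ∀ (k A B : SU) → (∀ u i → (mat B *ᵛ (mat k *ᵛ u)) i ≡ (mat k *ᵛ (mat A *ᵛ u)) i) →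
      ∀ {u v} → Moves A u v → Moves B (move k u) (move k v)
    moved k A B kA {u} {v} Au∝v = ∝-trans (mat B *ᵛ (mat k *ᵛ vec u)) (mat k *ᵛ (mat A *ᵛ vec u)) (mat k *ᵛ vec v)
      (≗⇒∝ _ _ (kA (vec u))) (*ᵛ-∝ k {mat A *ᵛ vec u} {vec v} Au∝v)

    forth : ∀ {u v} → CA._≈_ u v → CB._≈_ (move k u) (move k v)
    forth = EqClosure.gmap {R = Moves A} {S = Moves B} (move k) (λ {u} {v} → moved k A B kA {u} {v})

    back : ∀ {u v} → CB._≈_ u v → CA._≈_ (move l u) (move l v)
    back = EqClosure.gmap {R = Moves B} {S = Moves A} (move l) (λ {u} {v} → moved l B A lB {u} {v})

  cycles-conjugate : Inverse (Cycles A) (Cycles B)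
  cycles-conjugate = record
    { to = move k
    ; from = move l
    ; to-cong = forth
    ; from-cong = back
    ; inverse =
        (λ {u} {v} v≈ → CB.trans {move k v} {move k (move l u)} {u} (forth {v} {move l u} v≈)
          (∝⇒cycle B {move k (move l u)} {u} (≗⇒∝ _ _ (kl (vec u))))) ,
        (λ {u} {v} v≈ → CA.trans {move l v} {move l (move k u)} {u} (back {v} {move k u} v≈)
          (∝⇒cycle A {move l (move k u)} {u} (≗⇒∝ _ _ (lk (vec u)))))
    }

-- Makes the number of cycles a class function, so that counting at the representatives is enough.
conjugate-cycles : ∀ {A B l} → Conjugate Γ A B → Cycles A HasSize l → Cycles B HasSize l
conjugate-cycles {A} {B} (k , B≈) = HasSize-resp {S = Cycles A} {S′ = Cycles B} (cycles-conjugate k (invˢ k) A B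
  (λ u i → begin
    (mat B *ᵛ (mat k *ᵛ u)) i  ≡⟨ *ᵛ-*ᴹ (mat B) (mat k) u i ⟨
    ((mat B *ᴹ mat k) *ᵛ u) i  ≡⟨ *ᵛ-congˡ {mat B *ᴹ mat k} {mat k *ᴹ mat A} Bk≈kA u i ⟩
    ((mat k *ᴹ mat A) *ᵛ u) i  ≡⟨ *ᵛ-*ᴹ (mat k) (mat A) u i ⟩
    (mat k *ᵛ (mat A *ᵛ u)) i  ∎)
  (λ u i → trans (sym (*ᵛ-*ᴹ (mat (invˢ k)) (mat k) u i))
    (trans (*ᵛ-congˡ {mat (invˢ k) *ᴹ mat k} {1ᴹ} (Group.inverseˡ Γ k) u i) (1ᴹ-*ᵛ u i)))
  (λ u i → trans (sym (*ᵛ-*ᴹ (mat k) (mat (invˢ k)) u i))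
    (trans (*ᵛ-congˡ {mat k *ᴹ mat (invˢ k)} {1ᴹ} (Group.inverseʳ Γ k) u i) (1ᴹ-*ᵛ u i))))
  where
  open ≡-Reasoning
  Bk≈kA : mat B *ᴹ mat k ≈ᴹ mat k *ᴹ mat A
  Bk≈kA = Tuples.≈▷⇒∙ Γ {k} {A} {B} B≈

labelled-cycles : ∀ label n m {l} →
  All (Labelled label n pointList m) pointList × length (fixedPoints label pointList) ≡ l →
  ∀ D → fromSU D ≡ m → Cycles D HasSize l
labelled-cycles label n _ (labelled , total) D refl = subst (Cycles D HasSize_) total (cycles-labels D label n labelled)

rep-cycles : ∀ j D → fromSU D ≡ rep-matrix j → Cycles D HasSize cycleCount j
rep-cycles j = labelled-cycles (labelIn pointList (rep-matrix j)) 11 (rep-matrix j) (proj₂ (proj₂ pointFacts) j)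

class-cycles : ∀ (j : Fin 4) A → Γ-cls (lin (fromSU A)) ≡ index-class j → Cycles A HasSize cycleCount j
class-cycles j A A∈ = go (class-representative j)
  where
  go : (∃[ D ] lin (fromSU D) ≡ Γ-reps ‼ index-class j × Γ-cls (lin (fromSU D)) ≡ index-class j) → Cycles A HasSize cycleCount j
  go (D , D≡ , cls≡) = conjugate-cycles {D} {A} (Γ-Theory.conjugate-in-class D A (trans cls≡ (sym A∈)))
    (rep-cycles j D (cong matrixOf D≡))

quadruple-genus : ∀ k (g : Vector SU 4) → g ∈ InΣ Γ (quadruple k) → HasGenus 28 g (genus k)
quadruple-genus k g ((g∈ , _) , _) = points-HasSize , (λ i → cycleCount (quadruple-index k i)) ,
  (λ i → class-cycles (quadruple-index k i) (g i) (proj₁ (quadruple≐Cl k i) {g i} (g∈ i))) , formula k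
  where
  -- The cycle totals 40, 40, 52, 46 and 40 equal 58 - 2g.
  formula : ∀ k → ℤ.+ (Vector.foldr ℕ._+_ 0 (λ i → cycleCount (quadruple-index k i))) ≡
    (ℤ.+ 4 ℤ.- ℤ.+ 2) ℤ.* ℤ.+ 28 ℤ.+ ℤ.+ 2 ℤ.- ℤ.+ 2 ℤ.* ℤ.+ genus k
  formula 0F = refl
  formula 1F = refl
  formula 2F = refl
  formula 3F = refl
  formula 4F = refl

-- Semilinear unitary maps as automorphisms of Γ.

Γ·2-gens Γ·2-reps : List X
Γ·2-gens = σ ∷ υ ∷ []
Γ·2-reps =
  lin (matrix 100010001) ∷
  lin (matrix 020200002) ∷
  lin (matrix 100044057) ∷
  lin (matrix 300030002) ∷
  lin (matrix 001100010) ∷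
  lin (matrix 001010200) ∷
  lin (matrix 100054058) ∷
  lin (matrix 045047100) ∷
  lin (matrix 001030300) ∷
  lin (matrix 001450470) ∷
  semi (matrix 001020100) ∷
  semi (matrix 001010200) ∷
  semi (matrix 100045047) ∷
  semi (matrix 100044057) ∷
  semi (matrix 001030300) ∷
  semi (matrix 001100010) ∷ []

IsSemilinear : Pred X 0ℓ
IsSemilinear x = Unitary (matrixOf x)

isSemilinear? : ∀ x → Dec (IsSemilinear x)
isSemilinear? x = unitary? (matrixOf x)

unitary-⊗ : ∀ {a b} → Unitary a → Unitary b → Unitary (a ⊗ b)
unitary-⊗ {a} {b} u v = subst Unitary
  (trans (fromMatrix-* (mat A) (mat B)) (cong₂ _⊗_ (fromSU-toSU a u) (fromSU-toSU b v)))
  (fromSU-unitary (mulˢ A B))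
  where
  A = toSU a u
  B = toSU b v

unitary-conjugate : ∀ {m} → Unitary m → Unitary (conjugateᴹ m)
unitary-conjugate {m} u = subst Unitary (trans (fromMatrix-conj (mat (toSU m u))) (cong conjugateᴹ (fromSU-toSU m u)))
  (fromSU-unitary (frobenius (toSU m u)))

unitary-† : ∀ {m} → Unitary m → Unitary (m †)
unitary-† {m} u = subst Unitary (trans (fromSU-inv (toSU m u)) (cong _† (fromSU-toSU m u))) (fromSU-unitary (invˢ (toSU m u)))

†-inverseʳ : ∀ {m} → Unitary m → m ⊗ m † ≡ 𝟙
†-inverseʳ {m} u = begin
  m ⊗ m †  ≡⟨ cong₂ (λ a b → a ⊗ b †) (fromSU-toSU m u) (fromSU-toSU m u) ⟨
  fromSU A ⊗ fromSU A †  ≡⟨ cong (fromSU A ⊗_) (fromSU-inv A) ⟨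
  fromSU A ⊗ fromSU (invˢ A)  ≡⟨ fromMatrix-* (mat A) (mat (invˢ A)) ⟨
  fromSU (mulˢ A (invˢ A))  ≡⟨ fromMatrix-cong {mat (mulˢ A (invˢ A))} {1ᴹ} (Group.inverseʳ Γ A) ⟩
  𝟙  ∎
  where
  open ≡-Reasoning
  A = toSU m u

semilinear-· : ∀ {x y} → IsSemilinear x → IsSemilinear y → IsSemilinear (x · y)
semilinear-· {lin a}  {lin b}  u v = unitary-⊗ {a} {b} u v
semilinear-· {lin a}  {semi b} u v = unitary-⊗ {a} {b} u v
semilinear-· {semi a} {lin b}  u v = unitary-⊗ {a} u (unitary-conjugate {b} v)
semilinear-· {semi a} {semi b} u v = unitary-⊗ {a} u (unitary-conjugate {b} v)

transpose≡ : ∀ m → transpose m ≡ conjugateᴹ (m †)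
transpose≡ m = sym (conjugateᴹ-involutive (transpose m))

semilinear-invˣ : ∀ {x} → IsSemilinear x → IsSemilinear (invˣ x)
semilinear-invˣ {lin m}  u = unitary-† {m} u
semilinear-invˣ {semi m} u = subst Unitary (sym (transpose≡ m)) (unitary-conjugate {m †} (unitary-† {m} u))

invˣ-left : ∀ {x} → IsSemilinear x → invˣ x · x ≡ one
invˣ-left {lin m}  u = cong lin (proj₁ u)
invˣ-left {semi m} u = cong lin (begin
  transpose m ⊗ conjugateᴹ m  ≡⟨ cong (_⊗ conjugateᴹ m) (transpose≡ m) ⟩
  conjugateᴹ (m †) ⊗ conjugateᴹ m  ≡⟨ conjugateᴹ-⊗ (m †) m ⟨
  conjugateᴹ (m † ⊗ m)  ≡⟨ cong conjugateᴹ (proj₁ u) ⟩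
  𝟙  ∎)
  where open ≡-Reasoning

invˣ-right : ∀ {x} → IsSemilinear x → x · invˣ x ≡ one
invˣ-right {lin m}  u = cong lin (†-inverseʳ {m} u)
invˣ-right {semi m} u = cong lin (†-inverseʳ {m} u)

cancelˣ : ∀ {x} → IsSemilinear x → ∀ {y z} → y · x ≡ z · x → y ≡ z
cancelˣ {x} u {y} {z} eq = begin
  y  ≡⟨ ·-identityʳ y ⟨
  y · one  ≡⟨ cong (y ·_) (invˣ-right {x} u) ⟨
  y · (x · invˣ x)  ≡⟨ ·-assoc y x (invˣ x) ⟨
  y · x · invˣ x  ≡⟨ cong (_· invˣ x) eq ⟩
  z · x · invˣ x  ≡⟨ ·-assoc z x (invˣ x) ⟩
  z · (x · invˣ x)  ≡⟨ cong (z ·_) (invˣ-right {x} u) ⟩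
  z · one  ≡⟨ ·-identityʳ z ⟩
  z  ∎
  where open ≡-Reasoning

private
  module Γ = Group Γ

  code : SU → X
  code A = lin (fromSU A)

  code-∙ : ∀ A B → code (A Γ.∙ B) ≡ code A · code B
  code-∙ A B = cong lin (fromMatrix-* (mat A) (mat B))

  code-cong : ∀ A B → A Γ.≈ B → code A ≡ code B
  code-cong A B p = cong lin (fromMatrix-cong {mat A} {mat B} p)

  code-injective : ∀ A B → code A ≡ code B → A Γ.≈ B
  code-injective A B p = fromMatrix-injective {mat A} {mat B} (lin-injective p)

open Automorphism using (⟦_⟧; ⟦⟧-cong; ∙-homo; ⁻¹-homo; injective)

-- f is conjugation by x inside the semilinear maps, written without inverses.
Acts : X → Automorphism Γ → Set
Acts x f = ∀ A → code (⟦ f ⟧ A) · x ≡ x · code A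

inner : SU → Automorphism Γ
inner k = mkAutomorphism Γ (k ▷_) ((k Γ.⁻¹) ▷_)
  (λ {x} {y} p → ▷-cong {k} {k} {x} {y} (Γ.refl {k}) p) (▷-homo k)
  (λ {x} {y} p → ▷-cong {k Γ.⁻¹} {k Γ.⁻¹} {x} {y} (Γ.refl {k Γ.⁻¹}) p) (▷⁻¹▷ k) (⁻¹▷▷ k)
  where open Tuples Γ

inner-acts : ∀ k → Acts (code k) (inner k)
inner-acts k A = trans (sym (code-∙ (k ▷ A) k)) (trans (code-cong ((k ▷ A) Γ.∙ k) (k Γ.∙ A) (▷-∙ k A)) (code-∙ k A))
  where open Tuples Γ

toAutomorphism : ∀ x → IsSemilinear x → Automorphism Γ
toAutomorphism (lin m)  u = inner (toSU m u)
toAutomorphism (semi m) u = compose Γ (inner (toSU m u)) outer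

toAutomorphism-acts : ∀ x u → Acts x (toAutomorphism x u)
toAutomorphism-acts (lin m)  u = subst (λ x → Acts x (inner (toSU m u))) (cong lin (fromSU-toSU m u)) (inner-acts (toSU m u))
toAutomorphism-acts (semi m) u A = cong semi (lin-injective (trans
  (subst (λ x → Acts x (inner (toSU m u))) (cong lin (fromSU-toSU m u)) (inner-acts (toSU m u)) (frobenius A))
  (cong (λ a → lin m · lin a) (fromMatrix-conj (mat A)))))

acts-compose : ∀ {x y f g} → Acts x f → Acts y g → Acts (x · y) (compose Γ f g)
acts-compose {x} {y} {f} {g} p q A = begin
  code (⟦ f ⟧ (⟦ g ⟧ A)) · (x · y)  ≡⟨ ·-assoc _ x y ⟨
  code (⟦ f ⟧ (⟦ g ⟧ A)) · x · y  ≡⟨ cong (_· y) (p (⟦ g ⟧ A)) ⟩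
  x · code (⟦ g ⟧ A) · y  ≡⟨ ·-assoc x _ y ⟩
  x · (code (⟦ g ⟧ A) · y)  ≡⟨ cong (x ·_) (q A) ⟩
  x · (y · code A)  ≡⟨ ·-assoc x y _ ⟨
  x · y · code A  ∎
  where open ≡-Reasoning

acts-inverse : ∀ {x f} → IsSemilinear x → Acts x f → Acts (invˣ x) (inverse′ Γ f)
acts-inverse {x} {f} u p A = begin
  b · invˣ x  ≡⟨ ·-identityˡ _ ⟨
  one · (b · invˣ x)  ≡⟨ cong (_· (b · invˣ x)) (invˣ-left {x} u) ⟨
  invˣ x · x · (b · invˣ x)  ≡⟨ ·-assoc (invˣ x) x _ ⟩
  invˣ x · (x · (b · invˣ x))  ≡⟨ cong (invˣ x ·_) (·-assoc x b (invˣ x)) ⟨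
  invˣ x · (x · b · invˣ x)  ≡⟨ cong (λ y → invˣ x · (y · invˣ x)) (p (pre Γ f A)) ⟨
  invˣ x · (code (⟦ f ⟧ (pre Γ f A)) · x · invˣ x)
    ≡⟨ cong (λ y → invˣ x · (y · x · invˣ x)) (code-cong (⟦ f ⟧ (pre Γ f A)) A (pre-inverseʳ Γ f A)) ⟩
  invˣ x · (code A · x · invˣ x)  ≡⟨ cong (invˣ x ·_) (·-assoc (code A) x (invˣ x)) ⟩
  invˣ x · (code A · (x · invˣ x))  ≡⟨ cong (λ y → invˣ x · (code A · y)) (invˣ-right {x} u) ⟩
  invˣ x · (code A · one)  ≡⟨ cong (invˣ x ·_) (·-identityʳ (code A)) ⟩
  invˣ x · code A  ∎
  where
  open ≡-Reasoning
  b = code (pre Γ f A)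

-- Every automorphism of Γ is semilinear conjugation.

seventh : X → X
seventh x = x · (x · (x · (x · (x · (x · x)))))

-- For an involution y the element z is the commutator of x and y.
commutatorSquare : X → X → X
commutatorSquare x y = z · z
  where z = x · y · invˣ x · y

σ-powers : List X
σ-powers = one ∷ σ ∷ σ · σ ∷ σ · (σ · σ) ∷ σ · (σ · (σ · σ)) ∷ σ · (σ · (σ · (σ · σ))) ∷ σ · (σ · (σ · (σ · (σ · σ)))) ∷ []

semilinears : List M → List X
semilinears ms = map lin ms ++ map semi ms

-- σ has order 7, and τ is determined up to the centralizer of σ by the
-- relations τ² = (σ τ σ⁻¹ τ)² = 1.
module Presentation (t : Tree) where
  toσ : X → X
  toσ x = proj₂ (entryAt (key x) t)

  Facts : List M → Set
  Facts ms =
    All (λ m → (seventh (lin m) ≡ one → lin m ≢ one → IsSemilinear (toσ (lin m)) × lin m · toσ (lin m) ≡ toσ (lin m) · σ) ×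
      (lin m · lin m ≡ one → lin m ≢ one → commutatorSquare σ (lin m) ≡ one →
        Any (λ w → lin m · w ≡ w · τ × σ · w ≡ w · σ × IsSemilinear w) σ-powers)) ms ×
    All (λ x → x · σ ≡ σ · x → x · τ ≡ τ · x → x ≡ one) (semilinears ms)

  facts? : ∀ ms → Dec (Facts ms)
  facts? ms =
    every? (λ m → (seventh (lin m) ≟ˣ one →-dec ¬? (lin m ≟ˣ one) →-dec
        isSemilinear? (toσ (lin m)) ×-dec (lin m · toσ (lin m)) ≟ˣ (toσ (lin m) · σ)) ×-dec
      ((lin m · lin m) ≟ˣ one →-dec ¬? (lin m ≟ˣ one) →-dec commutatorSquare σ (lin m) ≟ˣ one →-dec
        some? (λ w → (lin m · w) ≟ˣ (w · τ) ×-dec (σ · w) ≟ˣ (w · σ) ×-dec isSemilinear? w) σ-powers)) ms ×-dec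
    every? (λ x → (x · σ) ≟ˣ (σ · x) →-dec (x · τ) ≟ˣ (τ · x) →-dec x ≟ˣ one) (semilinears ms)

opaque
  -- The elements of order 7 form two classes in Γ but a single one in Γ.2, so the search for
  -- conjugators to `σ` uses the generators of Γ.2.
  σ-classes : Tree
  σ-classes = classTree Γ·2-gens (σ ∷ [])

opaque
  unfolding enumeration σ-classes

  presentation : Presentation.Facts σ-classes frames
  presentation = toWitness {a? = Presentation.facts? σ-classes frames} _

∈-semilinears : ∀ x → IsSemilinear x → x ∈ˡ semilinears frames
∈-semilinears (lin m)  u = ∈-++⁺ˡ (∈-map⁺ lin (∈-frames m u))
∈-semilinears (semi m) u = ∈-++⁺ʳ (map lin frames) (∈-map⁺ semi (∈-frames m u))

-- y⁻¹ x commutes with all of Γ, in particular with `σ` and `τ`; among the semilinear maps only the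
-- identity does.
acts-unique : ∀ {x y f} → IsSemilinear x → IsSemilinear y → Acts x f → Acts y f → x ≡ y
acts-unique {x} {y} {f} u v p q = cancelˣ {invˣ y} (semilinear-invˣ {y} v) (trans equal (sym (invˣ-right {y} v)))
  where
  open ≡-Reasoning
  z = invˣ y · x
  commutes : ∀ A → z · code A ≡ code A · z
  commutes A = begin
    invˣ y · x · code A  ≡⟨ ·-assoc (invˣ y) x _ ⟩
    invˣ y · (x · code A)  ≡⟨ cong (invˣ y ·_) (p A) ⟨
    invˣ y · (b · x)  ≡⟨ ·-assoc (invˣ y) b x ⟨
    invˣ y · b · x  ≡⟨ cong (λ w → invˣ y · w · x) b≡ ⟩
    invˣ y · (y · code A · invˣ y) · x  ≡⟨ cong (λ w → invˣ y · w · x) (·-assoc y (code A) (invˣ y)) ⟩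
    invˣ y · (y · (code A · invˣ y)) · x  ≡⟨ cong (_· x) (·-assoc (invˣ y) y _) ⟨
    invˣ y · y · (code A · invˣ y) · x  ≡⟨ cong (λ w → w · (code A · invˣ y) · x) (invˣ-left {y} v) ⟩
    one · (code A · invˣ y) · x  ≡⟨ cong (_· x) (·-identityˡ (code A · invˣ y)) ⟩
    code A · invˣ y · x  ≡⟨ ·-assoc (code A) (invˣ y) x ⟩
    code A · z  ∎
    where
    b = code (⟦ f ⟧ A)
    b≡ : b ≡ y · code A · invˣ y
    b≡ = cancelˣ {y} v (trans (q A) (sym (trans (·-assoc (y · code A) (invˣ y) y)
      (trans (cong (y · code A ·_) (invˣ-left {y} v)) (·-identityʳ (y · code A))))))
  generator : ∀ m → Unitary m → z · lin m ≡ lin m · z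
  generator m w = subst (λ s → z · s ≡ s · z) (cong lin (fromSU-toSU m w)) (commutes (toSU m w))
  z≡one : z ≡ one
  z≡one = All.lookup (proj₂ presentation) (∈-semilinears z (semilinear-· {invˣ y} (semilinear-invˣ {y} v) u))
    (generator _ (from-yes (unitary? (matrixOf σ)))) (generator _ (from-yes (unitary? (matrixOf τ))))
  equal : x · invˣ y ≡ one
  equal = begin
    x · invˣ y  ≡⟨ cong (_· invˣ y) (trans (sym (·-identityˡ x)) (cong (_· x) (sym (invˣ-right {y} v)))) ⟩
    y · invˣ y · x · invˣ y  ≡⟨ cong (_· invˣ y) (trans (·-assoc y (invˣ y) x) (cong (y ·_) z≡one)) ⟩
    y · one · invˣ y  ≡⟨ cong (_· invˣ y) (·-identityʳ y) ⟩
    y · invˣ y  ≡⟨ invˣ-right {y} v ⟩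
    one  ∎

private
  S T′ : SU
  S  = toSU (matrixOf σ) (from-yes (unitary? (matrixOf σ)))
  T′ = toSU (matrixOf τ) (from-yes (unitary? (matrixOf τ)))

  code-S : code S ≡ σ
  code-S = refl

  code-T : code T′ ≡ τ
  code-T = refl

module _ (f : Automorphism Γ) where
  image-≢ : ∀ A → code A ≢ one → code (⟦ f ⟧ A) ≢ one
  image-≢ A A≢1 eq = A≢1 (code-cong A Γ.ε (injective f {A} {Γ.ε}
    (Γ.trans {⟦ f ⟧ A} {Γ.ε} {⟦ f ⟧ Γ.ε} (code-injective (⟦ f ⟧ A) Γ.ε eq)
      (Γ.sym {⟦ f ⟧ Γ.ε} {Γ.ε} (Automorphism.ε-homo f)))))

  image-∙ : ∀ {A B x y} → code (⟦ f ⟧ A) ≡ x → code (⟦ f ⟧ B) ≡ y → code (⟦ f ⟧ (A Γ.∙ B)) ≡ x · y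
  image-∙ {A} {B} p q = trans (code-cong (⟦ f ⟧ (A Γ.∙ B)) (⟦ f ⟧ A Γ.∙ ⟦ f ⟧ B) (∙-homo f A B))
    (trans (code-∙ (⟦ f ⟧ A) (⟦ f ⟧ B)) (cong₂ _·_ p q))

  image-⁻¹ : ∀ {A x} → code (⟦ f ⟧ A) ≡ x → code (⟦ f ⟧ (A Γ.⁻¹)) ≡ invˣ x
  image-⁻¹ {A} p = trans (code-cong (⟦ f ⟧ (A Γ.⁻¹)) (⟦ f ⟧ A Γ.⁻¹) (⁻¹-homo f A))
    (trans (cong lin (fromSU-inv (⟦ f ⟧ A))) (cong invˣ p))

  image-one : ∀ A → code A ≡ one → code (⟦ f ⟧ A) ≡ one
  image-one A eq = trans (code-cong (⟦ f ⟧ A) (⟦ f ⟧ Γ.ε) (⟦⟧-cong f {A} {Γ.ε} (code-injective A Γ.ε eq)))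
    (code-cong (⟦ f ⟧ Γ.ε) Γ.ε (Automorphism.ε-homo f))

  image-seventh : seventh (code (⟦ f ⟧ S)) ≡ one
  image-seventh = trans (sym (image-∙ {S} {S⁶} refl (image-∙ {S} {S⁵} refl (image-∙ {S} {S⁴} refl
    (image-∙ {S} {S³} refl (image-∙ {S} {S²} refl (image-∙ {S} {S} refl refl))))))) (image-one (S Γ.∙ S⁶) refl)
    where
    S² S³ S⁴ S⁵ S⁶ : SU
    S² = S Γ.∙ S
    S³ = S Γ.∙ S²
    S⁴ = S Γ.∙ S³
    S⁵ = S Γ.∙ S⁴
    S⁶ = S Γ.∙ S⁵

  image-involution : code (⟦ f ⟧ T′) · code (⟦ f ⟧ T′) ≡ one
  image-involution = trans (sym (image-∙ {T′} {T′} refl refl)) (image-one (T′ Γ.∙ T′) refl)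

  image-commutator : commutatorSquare (code (⟦ f ⟧ S)) (code (⟦ f ⟧ T′)) ≡ one
  image-commutator = trans (sym (image-∙ {C} {C} C≡ C≡)) (image-one (C Γ.∙ C) refl)
    where
    C : SU
    C = S Γ.∙ T′ Γ.∙ S Γ.⁻¹ Γ.∙ T′
    C≡ : code (⟦ f ⟧ C) ≡ code (⟦ f ⟧ S) · code (⟦ f ⟧ T′) · invˣ (code (⟦ f ⟧ S)) · code (⟦ f ⟧ T′)
    C≡ = image-∙ {S Γ.∙ T′ Γ.∙ S Γ.⁻¹} {T′} (image-∙ {S Γ.∙ T′} {S Γ.⁻¹} (image-∙ {S} {T′} refl refl) (image-⁻¹ {S} refl)) refl

  move-to-σ : ∃[ z ] IsSemilinear z × code (⟦ f ⟧ S) · z ≡ z · σ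
  move-to-σ = _ , proj₁ (All.lookup (proj₁ presentation) (∈-frames _ (fromSU-unitary (⟦ f ⟧ S)))) image-seventh
    (image-≢ S λ ())

-- As h fixes `σ`, the image of `τ` satisfies the relations with `σ` itself, and the check yields a
-- power w of `σ` that conjugates `τ` to it. Then h agrees with conjugation by w on both generators,
-- hence on Γ.
fixing-σ : ∀ h → code (⟦ h ⟧ S) ≡ σ → ∃[ w ] IsSemilinear w × Acts w h
fixing-σ h hS = go (Any.satisfied (proj₂ (All.lookup (proj₁ presentation) (∈-frames _ (fromSU-unitary (⟦ h ⟧ T′))))
    (image-involution h) (image-≢ h T′ λ ())
    (trans (cong (λ s → commutatorSquare s (code (⟦ h ⟧ T′))) (sym hS)) (image-commutator h))))
  where
  open ≡-Reasoning
  go : (∃[ w ] code (⟦ h ⟧ T′) · w ≡ w · τ × σ · w ≡ w · σ × IsSemilinear w) → ∃[ w ] IsSemilinear w × Acts w h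
  go (w , hT , σw , u) = w , u , Γ-Theory.gens-induction (λ A → code (⟦ h ⟧ A) · w ≡ w · code A)
    (λ {A} {B} A≈B p → trans (cong (_· w) (code-cong (⟦ h ⟧ B) (⟦ h ⟧ A) (⟦⟧-cong h {B} {A} (Γ.sym {A} {B} A≈B))))
      (trans p (cong (w ·_) (code-cong A B A≈B))))
    (trans (cong (_· w) (image-one h Γ.ε refl)) (trans (·-identityˡ w) (sym (·-identityʳ w))))
    λ S′ s∈ S′≡ A p → begin
      code (⟦ h ⟧ (S′ Γ.∙ A)) · w  ≡⟨ cong (_· w) (image-∙ h {S′} {A} refl refl) ⟩
      code (⟦ h ⟧ S′) · code (⟦ h ⟧ A) · w  ≡⟨ ·-assoc _ _ w ⟩
      code (⟦ h ⟧ S′) · (code (⟦ h ⟧ A) · w)  ≡⟨ cong (code (⟦ h ⟧ S′) ·_) p ⟩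
      code (⟦ h ⟧ S′) · (w · code A)  ≡⟨ ·-assoc _ w _ ⟨
      code (⟦ h ⟧ S′) · w · code A  ≡⟨ cong (_· code A) (generator S′ s∈ S′≡) ⟩
      w · code S′ · code A  ≡⟨ ·-assoc w _ _ ⟩
      w · (code S′ · code A)  ≡⟨ cong (w ·_) (code-∙ S′ A) ⟨
      w · code (S′ Γ.∙ A)  ∎
    where
    same-image : ∀ A B {x} → code A ≡ x → code B ≡ x → code (⟦ h ⟧ A) ≡ code (⟦ h ⟧ B)
    same-image A B A≡ B≡ = code-cong (⟦ h ⟧ A) (⟦ h ⟧ B) (⟦⟧-cong h {A} {B} (code-injective A B (trans A≡ (sym B≡))))
    generator : ∀ {s} S′ → s ∈ˡ Γ-gens → code S′ ≡ s → code (⟦ h ⟧ S′) · w ≡ w · code S′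
    generator S′ (here refl) S′≡ = trans (cong (_· w) (trans (same-image S′ S S′≡ code-S) hS))
      (trans σw (cong (w ·_) (sym S′≡)))
    generator S′ (there (here refl)) S′≡ = trans (cong (_· w) (same-image S′ T′ S′≡ code-T))
      (trans hT (cong (w ·_) (sym S′≡)))

opaque
  -- Some z conjugates `σ` to f(`σ`); with z undone, the automorphism fixes `σ`.
  classify : ∀ f → ∃[ x ] IsSemilinear x × Acts x f
  classify f = go (move-to-σ f)
    where
    open ≡-Reasoning
    go : (∃[ z ] IsSemilinear z × code (⟦ f ⟧ S) · z ≡ z · σ) → ∃[ x ] IsSemilinear x × Acts x f
    go (z , u , fS) = finish (fixing-σ h hS)
      where
      Z h : Automorphism Γ
      Z = toAutomorphism z u
      h = compose Γ (inverse′ Γ Z) f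
      ZS≈fS : ⟦ Z ⟧ S Γ.≈ ⟦ f ⟧ S
      ZS≈fS = code-injective (⟦ Z ⟧ S) (⟦ f ⟧ S) (cancelˣ {z} u (trans (toAutomorphism-acts z u S) (sym fS)))
      hS : code (⟦ h ⟧ S) ≡ σ
      hS = code-cong (⟦ h ⟧ S) S (Γ.trans {⟦ h ⟧ S} {pre Γ Z (⟦ Z ⟧ S)} {S}
        (pre-cong Γ Z {⟦ f ⟧ S} {⟦ Z ⟧ S} (Γ.sym {⟦ Z ⟧ S} {⟦ f ⟧ S} ZS≈fS)) (pre-inverseˡ Γ Z S))
      finish : (∃[ w ] IsSemilinear w × Acts w h) → ∃[ x ] IsSemilinear x × Acts x f
      finish (w , v , p) = z · w , semilinear-· {z} {w} u v , λ A →
        trans (cong (_· (z · w)) (code-cong (⟦ f ⟧ A) (⟦ Z ⟧ (⟦ h ⟧ A))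
          (Γ.sym {⟦ Z ⟧ (⟦ h ⟧ A)} {⟦ f ⟧ A} (pre-inverseʳ Γ Z (⟦ f ⟧ A)))))
          (acts-compose {z} {w} {Z} {h} (toAutomorphism-acts z u) p A)

-- The coding of Γ.2.

semi-injective : ∀ {a b} → semi a ≡ semi b → a ≡ b
semi-injective refl = refl

Γ·2-code : Automorphism Γ → X
Γ·2-code f = proj₁ (classify f)

Γ·2-code-semilinear : ∀ f → IsSemilinear (Γ·2-code f)
Γ·2-code-semilinear f = proj₁ (proj₂ (classify f))

Γ·2-code-acts : ∀ f → Acts (Γ·2-code f) f
Γ·2-code-acts f = proj₂ (proj₂ (classify f))

-- Reduces each law of the coding to exhibiting a semilinear map that acts as the automorphism in
-- question.
Γ·2-code-unique : ∀ f {x} → IsSemilinear x → Acts x f → Γ·2-code f ≡ x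
Γ·2-code-unique f {x} u p = acts-unique {Γ·2-code f} {x} {f} (Γ·2-code-semilinear f) u (Γ·2-code-acts f) p

Γ·2-code-cong : ∀ f g → (∀ A → ⟦ f ⟧ A Γ.≈ ⟦ g ⟧ A) → Γ·2-code f ≡ Γ·2-code g
Γ·2-code-cong f g f≈g = Γ·2-code-unique f {Γ·2-code g} (Γ·2-code-semilinear g) λ A →
  trans (cong (_· Γ·2-code g) (code-cong (⟦ f ⟧ A) (⟦ g ⟧ A) (f≈g A))) (Γ·2-code-acts g A)

Γ·2-code-injective : ∀ f g → Γ·2-code f ≡ Γ·2-code g → ∀ A → ⟦ f ⟧ A Γ.≈ ⟦ g ⟧ A
Γ·2-code-injective f g eq A = code-injective (⟦ f ⟧ A) (⟦ g ⟧ A)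
  (cancelˣ {Γ·2-code f} (Γ·2-code-semilinear f) (trans (Γ·2-code-acts f A)
    (trans (cong (_· code A) eq) (trans (sym (Γ·2-code-acts g A)) (cong (code (⟦ g ⟧ A) ·_) (sym eq))))))

-- The products below are those of the record Γ·2: converting between them and
-- compose, identity′ and inverse′ would compare the proofs inside automorphisms.
Γ·2-code-∙ : ∀ f g → Γ·2-code (Group._∙_ Γ·2 f g) ≡ Γ·2-code f · Γ·2-code g
Γ·2-code-∙ f g = Γ·2-code-unique (Group._∙_ Γ·2 f g) {Γ·2-code f · Γ·2-code g}
  (semilinear-· {Γ·2-code f} {Γ·2-code g} (Γ·2-code-semilinear f) (Γ·2-code-semilinear g))
  λ A → acts-compose {Γ·2-code f} {Γ·2-code g} {f} {g} (Γ·2-code-acts f) (Γ·2-code-acts g) A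

Γ·2-code-ε : Γ·2-code (Group.ε Γ·2) ≡ one
Γ·2-code-ε = Γ·2-code-unique (Group.ε Γ·2) {one} (from-yes (unitary? 𝟙))
  λ A → trans (·-identityʳ (code A)) (sym (·-identityˡ (code A)))

Γ·2-code-⁻¹ : ∀ f → Γ·2-code (Group._⁻¹ Γ·2 f) ≡ invˣ (Γ·2-code f)
Γ·2-code-⁻¹ f = Γ·2-code-unique (Group._⁻¹ Γ·2 f) {invˣ (Γ·2-code f)} (semilinear-invˣ {Γ·2-code f} (Γ·2-code-semilinear f))
  λ A → acts-inverse {Γ·2-code f} {f} (Γ·2-code-semilinear f) (Γ·2-code-acts f) A

Γ·2-decode : ∀ {x} → IsSemilinear x → ∃[ f ] Γ·2-code f ≡ x
Γ·2-decode {x} u = toAutomorphism x u , Γ·2-code-unique (toAutomorphism x u) {x} u (toAutomorphism-acts x u)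

semilinears-unique : ∀ {ms} → Unique ms → Unique (semilinears ms)
semilinears-unique {ms} u = Unique.++⁺ (Unique.map⁺ lin-injective u) (Unique.map⁺ semi-injective u) disjoint
  where
  disjoint : ∀ {x} → ¬ (x ∈ˡ map lin ms × x ∈ˡ map semi ms)
  disjoint (p , q) with ∈-map⁻ lin p | ∈-map⁻ semi q
  ... | _ , _ , refl | _ , _ , ()

Γ·2-coding : Coding Γ·2
Γ·2-coding = record
  { elements = semilinears frames
  ; elements-unique = semilinears-unique frames-unique
  ; code = Γ·2-code
  ; code-cong = λ {f} {g} → Γ·2-code-cong f g
  ; code-injective = λ {f} {g} → Γ·2-code-injective f g
  ; code-∙ = Γ·2-code-∙
  ; code-ε = Γ·2-code-ε
  ; code-⁻¹ = Γ·2-code-⁻¹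
  ; code∈ = λ f → ∈-semilinears (Γ·2-code f) (Γ·2-code-semilinear f)
  ; IsElement = IsSemilinear
  ; isElement? = isSemilinear?
  ; elements-valid = All.++⁺ (All.map⁺ frames-unitary) (All.map⁺ frames-unitary)
  ; decode = Γ·2-decode
  }

-- Parity and the verdicts for Γ.2.

Γ·2-pairs : List (Solution × Solution × ℕ × ℕ)
Γ·2-pairs =
  (solution 1 2 10 11 (lin (matrix 003020600)) (lin (matrix 100045047)) (word 123323122123 ∷ word 223323123123 ∷ []) ,
   solution 1 2 10 11 (lin (matrix 044712721)) (lin (matrix 100074054)) (word 131232231312 ∷ word 1213121313 ∷ []) , 0 , 2) ∷
  (solution 1 2 11 11 (lin (matrix 010100002)) (lin (matrix 422143134)) (word 323323122 ∷ word 31331 ∷ []) ,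
   solution 1 2 11 11 (lin (matrix 010100002)) (lin (matrix 462641124)) (word 22132332231 ∷ word 31331 ∷ []) , 0 , 1) ∷ []

isSemi : X → Bool
isSemi (lin _)  = false
isSemi (semi _) = true

isSemi-· : ∀ x y → isSemi (x · y) ≡ isSemi x xor isSemi y
isSemi-· (lin _)  (lin _)  = refl
isSemi-· (lin _)  (semi _) = refl
isSemi-· (semi _) (lin _)  = refl
isSemi-· (semi _) (semi _) = refl

isSemi-invˣ : ∀ x → isSemi (invˣ x) ≡ isSemi x
isSemi-invˣ (lin _)  = refl
isSemi-invˣ (semi _) = refl

-- The representatives outside Γ come last in Γ·2-reps.
isOuterClass : ℕ → Bool
isOuterClass j = 10 ℕ.≤ᵇ j

-- With an odd number of factors outside Γ the product lies outside Γ and is not 1; with none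
-- outside, the tuple generates a subgroup of Γ.
WrongParity : (a b c d : ℕ) → Set
WrongParity a b c d =
  isOuterClass a xor (isOuterClass b xor (isOuterClass c xor isOuterClass d)) ≡ true ⊎
  isOuterClass a ∨ isOuterClass b ∨ isOuterClass c ∨ isOuterClass d ≡ false

wrongParity? : ∀ a b c d → Dec (WrongParity a b c d)
wrongParity? a b c d = _ Bool.≟ _ ⊎-dec _ Bool.≟ _

opaque
  Γ·2-tables : Lookup
  Γ·2-tables = lookups (classTree Γ·2-gens Γ·2-reps) (cayleyTree Γ·2-gens)

OuterClasses : Lookup → Set
OuterClasses tables = All (λ x → isSemi x ≡ isOuterClass (Lookup.cls tables x)) (semilinears frames)

-- In a sorted quadruple of the right parity either c and d or all four classes lie outside Γ, so u
-- = g₁ g₂ is always in Γ. Among the classes inside, 2A, 3A and the fused class of 4A and 4B are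
-- left out; the others already make the bound large enough.
Γ·2-indices : List ℕ
Γ·2-indices = 0 ∷ 4 ∷ 5 ∷ 6 ∷ 7 ∷ 8 ∷ 9 ∷ []

Γ·2-Evidence : Lookup → Set
Γ·2-Evidence tables = Checks.AllChecked Γ·2-coding Γ·2-gens Γ·2-reps tables × OuterClasses tables ×
  Verdicts.Everything Γ·2-coding Γ·2-gens Γ·2-reps tables 12096 Γ·2-indices [] Γ·2-pairs wrongParity?

Γ·2-evidence? : ∀ tables → Dec (Γ·2-Evidence tables)
Γ·2-evidence? tables = Checks.allChecked? Γ·2-coding Γ·2-gens Γ·2-reps tables ×-dec
  every? (λ x → isSemi x Bool.≟ isOuterClass (Lookup.cls tables x)) (semilinears frames) ×-dec
  Verdicts.everything? Γ·2-coding Γ·2-gens Γ·2-reps tables 12096 Γ·2-indices [] Γ·2-pairs wrongParity?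

opaque
  unfolding enumeration Γ·2-tables

  Γ·2-evidence : Γ·2-Evidence Γ·2-tables
  Γ·2-evidence = toWitness {a? = Γ·2-evidence? Γ·2-tables} _

Γ·2-checked : Checks.AllChecked Γ·2-coding Γ·2-gens Γ·2-reps Γ·2-tables
Γ·2-checked = proj₁ Γ·2-evidence

Γ·2-outer : OuterClasses Γ·2-tables
Γ·2-outer = proj₁ (proj₂ Γ·2-evidence)

module Γ·2-Theory = ClassTheory Γ·2-coding Γ·2-gens Γ·2-reps Γ·2-tables Γ·2-checked

module Parity (G : Group 0ℓ 0ℓ) where
  open Group G using (Carrier; _≈_; _∙_; ε; _⁻¹)

  module _ (outside : Carrier → Bool)
    (outside-cong : ∀ {x y} → x ≈ y → outside x ≡ outside y)
    (outside-∙ : ∀ x y → outside (x ∙ y) ≡ outside x xor outside y)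
    (outside-⁻¹ : ∀ x → outside (x ⁻¹) ≡ outside x) (outside-ε : outside ε ≡ false) where

    open RawMonoidSum (Group.rawMonoid G) using () renaming (sum to product)

    inside-Generated : ∀ {z} {g : Vector Carrier z} → (∀ i → outside (g i) ≡ false) →
      ∀ {x} → x ∈ Generated G g → outside x ≡ false
    inside-Generated p (gen i)            = p i
    inside-Generated p unit               = outside-ε
    inside-Generated p (mul {x} {y} q r)  = trans (outside-∙ x y) (cong₂ _xor_ (inside-Generated p q) (inside-Generated p r))
    inside-Generated p (inv {x} q)        = trans (outside-⁻¹ x) (inside-Generated p q)
    inside-Generated p (resp e q)         = trans (sym (outside-cong e)) (inside-Generated p q)

    outside-product : ∀ (g : Vector Carrier 4) → product g ≈ ε →
      outside (g 0F) xor (outside (g 1F) xor (outside (g 2F) xor outside (g 3F))) ≡ false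
    outside-product g Πg≈ε = begin
      outside (g 0F) xor (outside (g 1F) xor (outside (g 2F) xor outside (g 3F)))
        ≡⟨ cong (λ x → outside (g 0F) xor (outside (g 1F) xor (outside (g 2F) xor x))) (outside-cong (Group.identityʳ G (g 3F))) ⟨
      outside (g 0F) xor (outside (g 1F) xor (outside (g 2F) xor outside (g 3F ∙ ε)))
        ≡⟨ cong (λ x → outside (g 0F) xor (outside (g 1F) xor x)) (outside-∙ (g 2F) _) ⟨
      outside (g 0F) xor (outside (g 1F) xor outside (g 2F ∙ (g 3F ∙ ε)))
        ≡⟨ cong (outside (g 0F) xor_) (outside-∙ (g 1F) _) ⟨
      outside (g 0F) xor outside (g 1F ∙ (g 2F ∙ (g 3F ∙ ε)))
        ≡⟨ outside-∙ (g 0F) _ ⟨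
      outside (product g)
        ≡⟨ outside-cong Πg≈ε ⟩
      outside ε
        ≡⟨ outside-ε ⟩
      false ∎
      where open ≡-Reasoning

    wrongParity⇒empty : ∀ {C : Vector (Pred Carrier 0ℓ) 4} {a b c d} →
      (∀ {x} → x ∈ C 0F → outside x ≡ isOuterClass a) → (∀ {x} → x ∈ C 1F → outside x ≡ isOuterClass b) →
      (∀ {x} → x ∈ C 2F → outside x ≡ isOuterClass c) → (∀ {x} → x ∈ C 3F → outside x ≡ isOuterClass d) →
      (∃[ x ] outside x ≡ true) → WrongParity a b c d → ∀ {g} → ¬ InΣ G C g
    wrongParity⇒empty o₀ o₁ o₂ o₃ _ (inj₁ odd) {g} ((g∈ , Πg≈ε) , _) = contradiction (trans (sym odd)
      (trans (sym (cong₂ _xor_ (o₀ (g∈ 0F)) (cong₂ _xor_ (o₁ (g∈ 1F)) (cong₂ _xor_ (o₂ (g∈ 2F)) (o₃ (g∈ 3F))))))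
        (outside-product g Πg≈ε))) λ ()
    wrongParity⇒empty {a = a} {b} {c} {d} o₀ o₁ o₂ o₃ (x , x-outside) (inj₂ none) {g} ((g∈ , _) , gg) =
      contradiction (trans (sym x-outside) (inside-Generated inside (gg x))) λ ()
      where
      ∨-false : ∀ x y → x ∨ y ≡ false → x ≡ false × y ≡ false
      ∨-false false _ p = refl , p
      n₀ = ∨-false (isOuterClass a) _ none
      n₁ = ∨-false (isOuterClass b) _ (proj₂ n₀)
      n₂ = ∨-false (isOuterClass c) _ (proj₂ n₁)
      inside : ∀ i → outside (g i) ≡ false
      inside = four (trans (o₀ (g∈ 0F)) (proj₁ n₀)) (trans (o₁ (g∈ 1F)) (proj₁ n₁))
        (trans (o₂ (g∈ 2F)) (proj₁ n₂)) (trans (o₃ (g∈ 3F)) (proj₂ n₂))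

Γ·2-wrongParity⇒empty : ∀ {a b c d} → WrongParity a b c d → ∀ {g} → ¬ InΣ Γ·2 (Γ·2-Theory.Cls a b c d) g
Γ·2-wrongParity⇒empty {a} {b} {c} {d} = Parity.wrongParity⇒empty Γ·2 (isSemi ∘ Γ·2-code)
  (λ {f} {g} f≈g → cong isSemi (Γ·2-code-cong f g f≈g))
  (λ f g → trans (cong isSemi (Γ·2-code-∙ f g)) (isSemi-· (Γ·2-code f) (Γ·2-code g)))
  (λ f → trans (cong isSemi (Γ·2-code-⁻¹ f)) (isSemi-invˣ (Γ·2-code f)))
  (cong isSemi Γ·2-code-ε)
  {Γ·2-Theory.Cls a b c d} {a} {b} {c} {d}
  (outside-class {a}) (outside-class {b}) (outside-class {c}) (outside-class {d})
  (proj₁ (Γ·2-decode {υ} υ-valid) , cong isSemi (proj₂ (Γ·2-decode {υ} υ-valid)))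
  where
  υ-valid : IsSemilinear υ
  υ-valid = from-yes (unitary? (matrixOf υ))
  outside-class : ∀ {j f} → Γ·2-Theory.Cl j f → isSemi (Γ·2-code f) ≡ isOuterClass j
  outside-class {j} {f} refl = All.lookup Γ·2-outer (∈-semilinears (Γ·2-code f) (Γ·2-code-semilinear f))

-- The list of exceptions is empty, so `Good` can be taken to be the empty type.
Γ·2-not-rigid : ∀ {C} → NonIdentityClasses Γ·2 C → Rigid Γ·2 C → ¬ μ̄<4 Γ·2 C
Γ·2-not-rigid {C} nonid rigid μ̄ = proj₂ (proj₂ (rigid-quadruples (λ _ _ _ _ → ⊥) id id (λ ()) {C} nonid rigid μ̄))
  where
  open Conclusion Γ·2-coding Γ·2-gens Γ·2-reps Γ·2-tables Γ·2-checked 12096 Γ·2-indices [] Γ·2-pairs wrongParity?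
    (from-yes (unique? ℕ._≟_ Γ·2-indices)) (from-yes (All.all? (ℕ._<? 16) Γ·2-indices))
    (λ {a} {b} {c} {d} → Γ·2-wrongParity⇒empty {a} {b} {c} {d}) (proj₂ (proj₂ Γ·2-evidence))

proposition3p1 : ((C : Vector (Pred (Group.Carrier Γ·2) 0ℓ) 4) → NonIdentityClasses Γ·2 C → ¬ StrictlyRigid Γ·2 C)
    ×
    ( (∀ k → NonIdentityClasses Γ (quadruple k) × StrictlyRigid Γ (quadruple k))
    × ((C : Vector (Pred SU 0ℓ) 4) → NonIdentityClasses Γ C → StrictlyRigid Γ C → ∃[ k ] C ∼ quadruple k)
    × (∀ j k → quadruple j ∼ quadruple k → j ≡ k)
    × (∀ k (g : Vector SU 4) → g ∈ InΣ Γ (quadruple k) → HasGenus 28 g (genus k))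
    )
    ×
    ( ((C : Vector (Pred SU 0ℓ) 4) → NonIdentityClasses Γ C → Rigid Γ C → μ̄<4 Γ C → ∃[ k ] C ∼ quadruple k)
    × ((C : Vector (Pred (Group.Carrier Γ·2) 0ℓ) 4) → NonIdentityClasses Γ·2 C → Rigid Γ·2 C → ¬ μ̄<4 Γ·2 C)
    )
proposition3p1 =
  (λ C nonid strict → Γ·2-not-rigid {C} nonid (proj₁ strict) (strictlyRigid⇒μ̄<4 {Γ·2} {4} {C} strict)) ,
  ((λ k → quadruple-nonIdentity k , quadruple-strictlyRigid k) ,
   (λ C nonid strict → rigid⇒listed {C} nonid (proj₁ strict) (strictlyRigid⇒μ̄<4 {Γ} {4} {C} strict)) ,
   quadruples-inequivalent ,
   quadruple-genus) ,
  ((λ C → rigid⇒listed {C}) , (λ C → Γ·2-not-rigid {C}))
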